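{- Fix an integer $k\ge1$ and let $H_n^k$ be the length of the longest monotone subsequence in a uniformly random element of $L_n^k$. Then $E[H_n^k]=\Theta(n^{\frac{k}{k+1}})$, and $H_n^k=\Theta_k(n^{\frac{k}{k+1}})$ asymptotically almost surely (i.e., there are constants $0<a_k<b_k$ such that $\Pr[a_k n^{k/(k+1)}\le H_n^k\le b_k n^{k/(k+1)}]\to1$ as $n\to\infty$).
   Context: An order-$n$ $k$-dimensional permutation is an array $A:[n]^{k+1}\to\{0,1\}$ such that every line contains exactly one $1$, where a line is the set of positions obtained by fixing $k$ of the $k+1$ coordinates and letting the remaining coordinate range over $[n]$. $L_n^k$ denotes the set of all such arrays. The support of $A$ is $G_A=\{\alpha\in[n]^{k+1}:A(\alpha)=1\}$. A monotone subsequence of length $m$ in $A$ is a sequence $\alpha^1,\dots,\alpha^m\in G_A$ such that for every coordinate $1\le j\le k+1$ the sequence $\alpha^1_j,\dots,\alpha^m_j$ is strictly monotone (the direction may depend on $j$). Asymptotics are as $n\to\infty$ with $k$ fixed. -}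

module Defs where

open import Data.Bool using (Bool; true; false; T)
open import Data.Nat as ℕ using (ℕ; zero; suc; _⊔_)
import Data.Nat.Properties as ℕP
open import Data.Fin using (Fin; toℕ)
open import Data.Vec as Vec using (Vec; []; _∷_; lookup; _[_]≔_)
open import Data.List as List using (List; length; filter; map; concatMap; foldr; allFin; upTo)
open import Data.Nat.ListAction using (sum)
open import Data.List.Relation.Unary.All using (All; all?)
open import Data.List.Relation.Unary.Any using (Any; any?)
open import Data.List.Relation.Unary.Linked using (Linked; linked?)
open import Data.Product using (_×_)
open import Data.Sum using (_⊎_)
open import Relation.Binary.PropositionalEquality using (_≡_)
open import Relation.Nullary using (Dec; does)
open import Relation.Nullary.Decidable using (T?; _×-dec_; _⊎-dec_)
open import Data.Integer using (+_)
open import Data.Rational as ℚ using (ℚ; _/_; 1ℚ)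

Pos : ℕ → ℕ → Set
Pos n m = Vec (Fin n) m

allVecs : ∀ {a} {A : Set a} → (m : ℕ) → List A → List (Vec A m)
allVecs zero    xs = [] List.∷ List.[]
allVecs (suc m) xs = concatMap (λ x → map (x ∷_) (allVecs m xs)) xs

allPos : (n m : ℕ) → List (Pos n m)
allPos n m = allVecs m (allFin n)

-- Arrays A : [n]^m → {0,1}, represented as nested vectors (a finite,
-- enumerable representation of all functions [n]^m → {0,1}).

Array : ℕ → ℕ → Set
Array n zero    = Bool
Array n (suc m) = Vec (Array n m) n

at : ∀ {n m} → Array n m → Pos n m → Bool
at {m = zero}  b []      = b
at {m = suc m} v (i ∷ α) = at (lookup v i) α

allArrays : (n m : ℕ) → List (Array n m)
allArrays n zero    = true List.∷ false List.∷ List.[]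
allArrays n (suc m) = allVecs n (allArrays n m)

lineCount : ∀ {n m} → Array n m → Fin m → Pos n m → ℕ
lineCount {n} A j α = length (filter (λ i → T? (at A (α [ j ]≔ i))) (allFin n))

IsPerm : ∀ {n} k → Array n (suc k) → Set
IsPerm {n} k A =
  All (λ j → All (λ α → lineCount A j α ≡ 1) (allPos n (suc k))) (allFin (suc k))

isPerm? : ∀ {n} k → (A : Array n (suc k)) → Dec (IsPerm k A)
isPerm? {n} k A = all? (λ j → all? (λ α → lineCount A j α ℕ.≟ 1) (allPos n (suc k))) (allFin (suc k))

-- L_n^k, as a duplicate-free list of all its elements
L : (n k : ℕ) → List (Array n (suc k))
L n k = filter (isPerm? k) (allArrays n (suc k))

StrictlyMonotone : List ℕ → Set
StrictlyMonotone xs = Linked ℕ._<_ xs ⊎ Linked ℕ._>_ xs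

strictlyMonotone? : (xs : List ℕ) → Dec (StrictlyMonotone xs)
strictlyMonotone? xs = linked? ℕ._<?_ xs ⊎-dec linked? ℕ._>?_ xs

IsMonotoneSubseq : ∀ {n m} → Array n m → List (Pos n m) → Set
IsMonotoneSubseq {n} {m} A s =
  All (λ α → T (at A α)) s ×
  All (λ j → StrictlyMonotone (map (λ α → toℕ (lookup α j)) s)) (allFin m)

isMonotoneSubseq? : ∀ {n m} → (A : Array n m) → (s : List (Pos n m)) → Dec (IsMonotoneSubseq A s)
isMonotoneSubseq? {n} {m} A s =
  all? (λ α → T? (at A α)) s ×-dec
  all? (λ j → strictlyMonotone? (map (λ α → toℕ (lookup α j)) s)) (allFin m)

HasMonotone : ∀ {n m} → Array n m → ℕ → Set
HasMonotone {n} {m} A ℓ = Any (λ s → IsMonotoneSubseq A (Vec.toList s)) (allVecs ℓ (allPos n m))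

hasMonotone? : ∀ {n m} → (A : Array n m) → (ℓ : ℕ) → Dec (HasMonotone A ℓ)
hasMonotone? {n} {m} A ℓ = any? (λ s → isMonotoneSubseq? A (Vec.toList s)) (allVecs ℓ (allPos n m))

-- Length of the longest monotone subsequence of A.  For m ≥ 1 every monotone
-- subsequence has length ≤ n (its first coordinates are distinct elements
-- of [n]), so the maximum over ℓ ∈ {0,…,n} is the maximum over all ℓ.
longestMonotone : ∀ {n m} → Array n m → ℕ
longestMonotone {n} A =
  foldr (λ ℓ acc → (if does (hasMonotone? A ℓ) then ℓ else 0) ⊔ acc) 0 (upTo (suc n))
  where open import Data.Bool using (if_then_else_)

ℕ→ℚ : ℕ → ℚ
ℕ→ℚ n = + n / 1

_^ℚ_ : ℚ → ℕ → ℚ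
q ^ℚ zero  = 1ℚ
q ^ℚ suc e = q ℚ.* (q ^ℚ e)

-- For c ≥ 0, x ≥ 0:   c · n^(k/(k+1)) ≤ x   ⟺   c^(k+1) · n^k ≤ x^(k+1)
_·n^[_/1+_]≤_ : ℚ → ℕ → ℕ → ℚ → Set
c ·n^[ n /1+ k ]≤ x = (c ^ℚ suc k) ℚ.* (ℕ→ℚ n ^ℚ k) ℚ.≤ x ^ℚ suc k

-- For c ≥ 0, x ≥ 0:   x ≤ c · n^(k/(k+1))   ⟺   x^(k+1) ≤ c^(k+1) · n^k
_≤_·n^[_/1+_] : ℚ → ℚ → ℕ → ℕ → Set
x ≤ c ·n^[ n /1+ k ] = x ^ℚ suc k ℚ.≤ (c ^ℚ suc k) ℚ.* (ℕ→ℚ n ^ℚ k)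

H : ∀ {n} k → Array n (suc k) → ℕ
H k A = longestMonotone A

card : ℕ → ℕ → ℕ
card n k = length (L n k)

-- Σ_{A ∈ L_n^k} H(A)   (so E[H_n^k] = totalH n k / card n k)
totalH : ℕ → ℕ → ℕ
totalH n k = sum (map (H k) (L n k))

Good : ∀ {n} k → ℚ → ℚ → Array n (suc k) → Set
Good {n} k a b A = (a ·n^[ n /1+ k ]≤ ℕ→ℚ (H k A)) × (ℕ→ℚ (H k A) ≤ b ·n^[ n /1+ k ])

good? : ∀ {n} k → (a b : ℚ) → (A : Array n (suc k)) → Dec (Good k a b A)
good? {n} k a b A = (_ ℚ.≤? _) ×-dec (_ ℚ.≤? _)

-- Number of A ∈ L_n^k in the event  (so Pr = goodCount / card)
goodCount : ℕ → ℕ → ℚ → ℚ → ℕ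
goodCount n k a b = length (filter (good? k a b) (L n k))

{-# OPTIONS --safe #-}
-- The set L is invariant under permuting the values of each coordinate, so the number of A ∈ L with a
-- given pattern on given rows depends only on the pattern as long as the rows are injective.  Averaging
-- over all rows, injective or not, bounds this number by a count over independent uniform rows, where
-- every single A can be analysed exactly (the lemma transfer).
--
-- Upper bound.  A prescribed chain of t cells is contained in A with probability at most
-- n^(kt) / (n(n-1)...(n-t+1))^(k+1), and there are about 2^(k+1) binom(n,t)^(k+1) monotone chains; the
-- expected number of monotone subsequences of length t is thus at most 2^(k+1) n^(kt) / t!^(k+1).
--
-- Lower bound, k ≥ 2.  Put n/ℓ boxes of side ℓ ≈ n^(1/(k+1)) on the diagonal; points in different boxes
-- form an increasing sequence.  For every A a random box has a constant expected number of points, which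
-- are pairwise independent, hence it is empty with probability at most some γ < 1.  By the averaging
-- principle t given diagonal boxes are simultaneously empty with probability at most (1 + o(1)) γ^t, and
-- Markov's inequality for the t-th factorial moment of the number of empty boxes, with t large but fixed,
-- shows that a positive fraction of them is nonempty.
--
-- For k = 1 the rows of t boxes collide too often for this, but there the Erdős–Szekeres theorem gives
-- H² ≥ n for every A.
module Submission where

open import Defs

-- No formula for the size of `L` is available, so nothing about a random array is computed
-- directly: only the symmetry is used, and every probability appears as a count compared with a
-- multiple of `card`. Replacing injective rows of length r by independent ones costs the factor
-- (n^r / fall n r)^(k+1), which is at most 2 once 2(k+1)r² ≤ n. In the upper bound the falling
-- factorial cancels against the number of chains. In the lower bound r = tℓ with ℓ ≈ n^(1/(k+1)),
-- and r² is small against n for fixed t exactly when k ≥ 2.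
--
-- Pairwise independence inside one box yields only a constant: emptiness has probability at most 1
-- - 1/Q with Q = 2^(k+2). Rounding ℓ loses at most 2^(k+1) in the expected number of points, and
-- the inclusion-exclusion bound loses another 2. A high moment over many boxes turns this constant
-- into a failure probability below any 1/D, while the constant in front of n^(k/(k+1)) stays
-- independent of D; t is chosen after D and before n.

module Counting where
  open import Algebra.Bundles using (CommutativeMonoid)
  open import Data.Bool using (Bool; true; false; T; _∧_; if_then_else_)
  open import Data.Nat
  open import Data.Nat.Properties
  open import Data.Nat.DivMod using (m/n*n≤m; m≡m%n+[m/n]*n; m%n<n; m≥n⇒m/n>0)
  open import Data.Nat.ListAction using (sum)
  open import Data.Nat.ListAction.Properties using (sum-++; sum-↭)
  open import Data.Nat.Tactic.RingSolver using (solve-∀)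
  open import Algebra.Properties.CommutativeSemigroup +-commutativeSemigroup using () renaming (interchange to +-interchange)
  import Data.Nat.Coprimality as Coprime
  import Data.Integer as ℤ
  import Data.Integer.Properties as ℤP
  open import Data.Rational as ℚ using (ℚ; mkℚ; 0ℚ; 1ℚ)
  import Data.Rational.Properties as ℚP
  import Data.Rational.Unnormalised as ℚᵘ
  import Data.Rational.Unnormalised.Properties as ℚᵘP
  open import Data.Fin as Fin using (Fin; zero; suc; toℕ; inject≤; opposite; combine)
  import Data.Fin.Properties as FinP
  import Data.Fin.Permutation as Perm
  open Perm using (Permutation′; _⟨$⟩ʳ_; _⟨$⟩ˡ_; _∘ₚ_)
  open import Data.Vec as Vec using (Vec; []; _∷_; lookup; _[_]≔_)
  open import Data.Vec.Properties using (lookup∘tabulate; tabulate∘lookup; tabulate-cong; tabulate-∘; lookup-map; map-id; map-cong; map-∘; ≡-dec; take-map; drop-map; lookup-zipWith; lookup-replicate; map-replicate; toList∘fromList)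
  import Data.Vec.Relation.Unary.All as VAll
  open VAll using ([]; _∷_)
  import Data.Vec.Relation.Unary.All.Properties as VAllP
  import Data.Vec.Relation.Unary.AllPairs as VAllPairs
  open VAllPairs using ([]; _∷_)
  import Data.Vec.Relation.Unary.AllPairs.Properties as VAllPairsP
  import Data.Vec.Relation.Unary.Unique.Propositional as V
  import Data.Vec.Relation.Unary.Unique.Propositional.Properties as VUniqueP
  open import Data.List as List using (List; []; _∷_; length; filter; concatMap; cartesianProductWith; allFin; upTo; foldr)
  import Data.List.Properties as ListP
  open ListP using (length-++; length-map)
  open import Data.List.Membership.Propositional using (_∈_; find; lose)
  open import Data.List.Membership.Propositional.Properties using (∈-map⁺; ∈-map⁻; ∈-++⁺ˡ; ∈-++⁺ʳ; ∈-++⁻; ∈-filter⁺; ∈-filter⁻; ∈-cartesianProductWith⁺; ∈-cartesianProductWith⁻; ∈-allFin; ∈-upTo⁺; ∈-upTo⁻)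
  open import Data.List.Membership.Propositional.Properties.WithK using (unique∧set⇒bag)
  open import Data.List.Relation.Unary.Any using (here; there)
  open import Data.List.Relation.Unary.All as All using (All; []; _∷_)
  import Data.List.Relation.Unary.All.Properties as AllP
  open import Data.List.Relation.Unary.AllPairs as AllPairs using (AllPairs; []; _∷_)
  import Data.List.Relation.Unary.AllPairs.Properties as AllPairsP
  open import Data.List.Relation.Unary.Linked using (Linked)
  open import Data.List.Relation.Unary.Linked.Properties using (Linked⇒AllPairs; AllPairs⇒Linked)
  open import Data.List.Relation.Unary.Unique.Propositional using (Unique)
  import Data.List.Relation.Unary.Unique.Propositional.Properties as UniqueP
  open import Data.List.Relation.Binary.BagAndSetEquality using (∼bag⇒↭)
  import Data.List.Relation.Binary.Permutation.Propositional.Properties as ↭P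
  open import Data.Product using (Σ; ∃-syntax; _×_; _,_; proj₁; proj₂)
  open import Data.Sum using (_⊎_; inj₁; inj₂)
  open import Data.Unit using (⊤; tt)
  open import Function using (_∘_; mk⇔)
  open import Relation.Nullary using (Dec; yes; no; does; ¬_; contradiction; ¬?)
  open import Relation.Nullary.Decidable using (T?; dec-true; dec-false; toWitness)
  open import Relation.Unary using (Decidable)
  open import Relation.Binary using (Transitive; tri<; tri≈; tri>)
  open import Relation.Binary.Definitions using (DecidableEquality)
  open import Relation.Binary.PropositionalEquality using (_≡_; _≢_; refl; sym; trans; cong; cong₂; subst; subst₂; module ≡-Reasoning)

  -- Finite sums

  ∑ : {A : Set} → List A → (A → ℕ) → ℕ
  ∑ xs f = sum (List.map f xs)

  𝟙 : Bool → ℕ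
  𝟙 b = if b then 1 else 0

  ∑-cong : {A : Set} (xs : List A) {f g : A → ℕ} → (∀ x → f x ≡ g x) → ∑ xs f ≡ ∑ xs g
  ∑-cong xs f≗g = cong sum (ListP.map-cong f≗g xs)

  ∑-cong-∈ : {A : Set} (xs : List A) {f g : A → ℕ} → (∀ {x} → x ∈ xs → f x ≡ g x) → ∑ xs f ≡ ∑ xs g
  ∑-cong-∈ []       f≗g = refl
  ∑-cong-∈ (x ∷ xs) f≗g = cong₂ _+_ (f≗g (here refl)) (∑-cong-∈ xs (f≗g ∘ there))

  ∑-mono-∈ : {A : Set} (xs : List A) {f g : A → ℕ} → (∀ {x} → x ∈ xs → f x ≤ g x) → ∑ xs f ≤ ∑ xs g
  ∑-mono-∈ []       f≤g = z≤n
  ∑-mono-∈ (x ∷ xs) f≤g = +-mono-≤ (f≤g (here refl)) (∑-mono-∈ xs (f≤g ∘ there))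

  ∑-mono : {A : Set} (xs : List A) {f g : A → ℕ} → (∀ x → f x ≤ g x) → ∑ xs f ≤ ∑ xs g
  ∑-mono xs f≤g = ∑-mono-∈ xs (λ {x} _ → f≤g x)

  ∑-++ : {A : Set} (xs ys : List A) (f : A → ℕ) → ∑ (xs List.++ ys) f ≡ ∑ xs f + ∑ ys f
  ∑-++ xs ys f = trans (cong sum (ListP.map-++ f xs ys)) (sum-++ (List.map f xs) (List.map f ys))

  ∑-map : {A B : Set} (h : A → B) (xs : List A) (f : B → ℕ) → ∑ (List.map h xs) f ≡ ∑ xs (f ∘ h)
  ∑-map h xs f = cong sum (sym (ListP.map-∘ xs))

  ∑-concatMap : {A B : Set} (h : A → List B) (xs : List A) (f : B → ℕ) →
    ∑ (concatMap h xs) f ≡ ∑ xs (λ x → ∑ (h x) f)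
  ∑-concatMap h []       f = refl
  ∑-concatMap h (x ∷ xs) f = trans (∑-++ (h x) (concatMap h xs) f) (cong (∑ (h x) f +_) (∑-concatMap h xs f))

  ^-distribʳ-* : ∀ m a b → (a * b) ^ m ≡ a ^ m * b ^ m
  ^-distribʳ-* zero    a b = refl
  ^-distribʳ-* (suc m) a b = trans (cong (a * b *_) (^-distribʳ-* m a b)) ([m*n]*[o*p]≡[m*o]*[n*p] a b (a ^ m) (b ^ m))

  ∑-+ : {A : Set} (xs : List A) (f g : A → ℕ) → ∑ xs (λ x → f x + g x) ≡ ∑ xs f + ∑ xs g
  ∑-+ []       f g = refl
  ∑-+ (x ∷ xs) f g = trans (cong (f x + g x +_) (∑-+ xs f g)) (+-interchange (f x) (g x) (∑ xs f) (∑ xs g))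

  ∑-*ˡ : {A : Set} (xs : List A) (c : ℕ) (f : A → ℕ) → ∑ xs (λ x → c * f x) ≡ c * ∑ xs f
  ∑-*ˡ []       c f = sym (*-zeroʳ c)
  ∑-*ˡ (x ∷ xs) c f = trans (cong (c * f x +_) (∑-*ˡ xs c f)) (sym (*-distribˡ-+ c (f x) (∑ xs f)))

  ∑-*ʳ : {A : Set} (xs : List A) (c : ℕ) (f : A → ℕ) → ∑ xs (λ x → f x * c) ≡ ∑ xs f * c
  ∑-*ʳ xs c f = trans (∑-cong xs (λ x → *-comm (f x) c)) (trans (∑-*ˡ xs c f) (*-comm c (∑ xs f)))

  ∑-const : {A : Set} (xs : List A) (c : ℕ) → ∑ xs (λ _ → c) ≡ length xs * c
  ∑-const []       c = refl
  ∑-const (x ∷ xs) c = cong (c +_) (∑-const xs c)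

  ∑-1 : {A : Set} (xs : List A) → ∑ xs (λ _ → 1) ≡ length xs
  ∑-1 xs = trans (∑-const xs 1) (*-identityʳ (length xs))

  ∑-swap : {A B : Set} (xs : List A) (ys : List B) (f : A → B → ℕ) →
    ∑ xs (λ x → ∑ ys (f x)) ≡ ∑ ys (λ y → ∑ xs (λ x → f x y))
  ∑-swap []       ys f = sym (trans (∑-const ys 0) (*-zeroʳ (length ys)))
  ∑-swap (x ∷ xs) ys f = trans (cong (∑ ys (f x) +_) (∑-swap xs ys f)) (sym (∑-+ ys (f x) (λ y → ∑ xs (λ x → f x y))))

  term≤∑ : {A : Set} {xs : List A} (f : A → ℕ) {x : A} → x ∈ xs → f x ≤ ∑ xs f
  term≤∑ f (here refl) = m≤m+n _ _
  term≤∑ f (there x∈)  = ≤-trans (term≤∑ f x∈) (m≤n+m _ _)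

  ∑-*-∑ : {A B : Set} (xs : List A) (ys : List B) (f : A → ℕ) (g : B → ℕ) →
    ∑ xs (λ x → ∑ ys (λ y → f x * g y)) ≡ ∑ xs f * ∑ ys g
  ∑-*-∑ xs ys f g = trans (∑-cong xs (λ x → ∑-*ˡ ys (f x) g)) (∑-*ʳ xs (∑ ys g) f)

  length-filter : {A : Set} {P : A → Set} (P? : Decidable P) (xs : List A) →
    length (filter P? xs) ≡ ∑ xs (λ x → 𝟙 (does (P? x)))
  length-filter P? []       = refl
  length-filter P? (x ∷ xs) with does (P? x)
  ... | true  = cong suc (length-filter P? xs)
  ... | false = length-filter P? xs

  ∑-bijection : {A B : Set} {xs : List A} {ys : List B} → Unique xs → Unique ys →
    (to : A → B) (from : B → A) → (∀ a → from (to a) ≡ a) → (∀ b → to (from b) ≡ b) →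
    (∀ {a} → a ∈ xs → to a ∈ ys) → (∀ {b} → b ∈ ys → from b ∈ xs) →
    (f : B → ℕ) → ∑ xs (f ∘ to) ≡ ∑ ys f
  ∑-bijection {xs = xs} {ys} xs! ys! to from from-to to-from to-∈ from-∈ f = begin
    ∑ xs (f ∘ to)            ≡⟨ ∑-map to xs f ⟨
    ∑ (List.map to xs) f     ≡⟨ sum-↭ (↭P.map⁺ f (∼bag⇒↭ (unique∧set⇒bag to-xs! ys! (mk⇔ ⊆₁ ⊆₂)))) ⟩
    ∑ ys f                   ∎
    where
    open ≡-Reasoning
    to-xs! : Unique (List.map to xs)
    to-xs! = UniqueP.map⁺ (λ {x} {y} eq → trans (sym (from-to x)) (trans (cong from eq) (from-to y))) xs!
    ⊆₁ : ∀ {b} → b ∈ List.map to xs → b ∈ ys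
    ⊆₁ b∈ with ∈-map⁻ to b∈
    ... | a , a∈ , refl = to-∈ a∈
    ⊆₂ : ∀ {b} → b ∈ ys → b ∈ List.map to xs
    ⊆₂ {b} b∈ = subst (_∈ List.map to xs) (to-from b) (∈-map⁺ to (from-∈ b∈))

  length-allFin : ∀ n → length (allFin n) ≡ n
  length-allFin n = ListP.length-tabulate {n = n} (λ i → i)

  ∑-allVecs-suc : {A : Set} (m : ℕ) (xs : List A) (f : Vec A (suc m) → ℕ) →
    ∑ (allVecs (suc m) xs) f ≡ ∑ xs (λ x → ∑ (allVecs m xs) (λ v → f (x ∷ v)))
  ∑-allVecs-suc m xs f = trans (∑-concatMap _ xs f) (∑-cong xs (λ x → ∑-map (x ∷_) (allVecs m xs) f))

  length-allVecs : {A : Set} (m : ℕ) (xs : List A) → length (allVecs m xs) ≡ length xs ^ m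
  length-allVecs zero    xs = refl
  length-allVecs (suc m) xs = begin
    length (allVecs (suc m) xs)                ≡⟨ ∑-1 (allVecs (suc m) xs) ⟨
    ∑ (allVecs (suc m) xs) (λ _ → 1)           ≡⟨ ∑-allVecs-suc m xs _ ⟩
    ∑ xs (λ x → ∑ (allVecs m xs) (λ v → 1))    ≡⟨ ∑-const xs _ ⟩
    length xs * ∑ (allVecs m xs) (λ v → 1)     ≡⟨ cong (length xs *_) (trans (∑-1 (allVecs m xs)) (length-allVecs m xs)) ⟩
    length xs * length xs ^ m                  ∎
    where open ≡-Reasoning

  allVecs-cartesian : {A : Set} (m : ℕ) (xs ys : List A) →
    concatMap (λ x → List.map (Vec._∷_ x) (allVecs m ys)) xs ≡ cartesianProductWith Vec._∷_ xs (allVecs m ys)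
  allVecs-cartesian m []       ys = refl
  allVecs-cartesian m (x ∷ xs) ys = cong (List.map (Vec._∷_ x) (allVecs m ys) List.++_) (allVecs-cartesian m xs ys)

  allVecs-unique : {A : Set} (m : ℕ) {xs : List A} → Unique xs → Unique (allVecs m xs)
  allVecs-unique zero    xs! = [] ∷ []
  allVecs-unique (suc m) {xs} xs! = subst Unique (sym (allVecs-cartesian m xs xs))
    (UniqueP.cartesianProductWith⁺ Vec._∷_ (λ { refl → refl , refl }) xs! (allVecs-unique m xs!))

  ∈-allVecs⁺ : {A : Set} (m : ℕ) {xs : List A} (v : Vec A m) → (∀ i → lookup v i ∈ xs) → v ∈ allVecs m xs
  ∈-allVecs⁺ zero    []      v∈ = here refl
  ∈-allVecs⁺ (suc m) {xs} (x ∷ v) v∈ = subst (x ∷ v ∈_) (sym (allVecs-cartesian m xs xs))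
    (∈-cartesianProductWith⁺ Vec._∷_ (v∈ zero) (∈-allVecs⁺ m v (v∈ ∘ suc)))

  ∈-allVecs⁻ : {A : Set} (m : ℕ) {xs : List A} {v : Vec A m} → v ∈ allVecs m xs → ∀ i → lookup v i ∈ xs
  ∈-allVecs⁻ (suc m) {xs} v∈ i with ∈-cartesianProductWith⁻ Vec._∷_ xs (allVecs m xs) (subst (_ ∈_) (allVecs-cartesian m xs xs) v∈)
  ∈-allVecs⁻ (suc m) v∈ zero    | x , w , x∈ , w∈ , refl = x∈
  ∈-allVecs⁻ (suc m) v∈ (suc i) | x , w , x∈ , w∈ , refl = ∈-allVecs⁻ m w∈ i

  ∑-allVecs-++ : {A : Set} (a b : ℕ) (xs : List A) (h : Vec A a → Vec A b → ℕ) →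
    ∑ (allVecs (a + b) xs) (λ v → h (Vec.take a v) (Vec.drop a v)) ≡ ∑ (allVecs a xs) (λ u → ∑ (allVecs b xs) (h u))
  ∑-allVecs-++ zero    b xs h = sym (+-identityʳ _)
  ∑-allVecs-++ (suc a) b xs h = begin
    ∑ (allVecs (suc a + b) xs) (λ v → h (Vec.take (suc a) v) (Vec.drop (suc a) v))
      ≡⟨ ∑-allVecs-suc (a + b) xs _ ⟩
    ∑ xs (λ x → ∑ (allVecs (a + b) xs) (λ v → h (x ∷ Vec.take a v) (Vec.drop a v)))
      ≡⟨ ∑-cong xs (λ x → ∑-allVecs-++ a b xs (λ u → h (x ∷ u))) ⟩
    ∑ xs (λ x → ∑ (allVecs a xs) (λ u → ∑ (allVecs b xs) (h (x ∷ u))))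
      ≡⟨ ∑-allVecs-suc a xs _ ⟨
    ∑ (allVecs (suc a) xs) (λ u → ∑ (allVecs b xs) (h u)) ∎
    where open ≡-Reasoning

  -- The hypothesis is Fubini for a single entry; induction lifts it to vectors, with `∑-swap`
  -- moving the second part of an entry past the remaining first parts. The instances `head`/`tail`
  -- and `take`/`drop` split the first cell or box off all rows at once.
  ∑-allVecs-unzip : {Z U W : Set} (zs : List Z) (us : List U) (ws : List W) (p : Z → U) (q : Z → W) →
    (∀ (h : U → W → ℕ) → ∑ zs (λ z → h (p z) (q z)) ≡ ∑ us (λ u → ∑ ws (h u))) →
    ∀ m (h : Vec U m → Vec W m → ℕ) →
    ∑ (allVecs m zs) (λ v → h (Vec.map p v) (Vec.map q v)) ≡ ∑ (allVecs m us) (λ u → ∑ (allVecs m ws) (h u))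
  ∑-allVecs-unzip zs us ws p q zs≗ zero    h = sym (+-identityʳ _)
  ∑-allVecs-unzip zs us ws p q zs≗ (suc m) h = begin
    ∑ (allVecs (suc m) zs) (λ v → h (Vec.map p v) (Vec.map q v))
      ≡⟨ ∑-allVecs-suc m zs _ ⟩
    ∑ zs (λ z → ∑ (allVecs m zs) (λ v → h (p z ∷ Vec.map p v) (q z ∷ Vec.map q v)))
      ≡⟨ ∑-cong zs (λ z → ∑-allVecs-unzip zs us ws p q zs≗ m (λ u w → h (p z ∷ u) (q z ∷ w))) ⟩
    ∑ zs (λ z → ∑ (allVecs m us) (λ u → ∑ (allVecs m ws) (λ w → h (p z ∷ u) (q z ∷ w))))
      ≡⟨ zs≗ (λ a b → ∑ (allVecs m us) (λ u → ∑ (allVecs m ws) (λ w → h (a ∷ u) (b ∷ w)))) ⟩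
    ∑ us (λ a → ∑ ws (λ b → ∑ (allVecs m us) (λ u → ∑ (allVecs m ws) (λ w → h (a ∷ u) (b ∷ w)))))
      ≡⟨ ∑-cong us (λ a → ∑-swap ws (allVecs m us) _) ⟩
    ∑ us (λ a → ∑ (allVecs m us) (λ u → ∑ ws (λ b → ∑ (allVecs m ws) (λ w → h (a ∷ u) (b ∷ w)))))
      ≡⟨ ∑-cong us (λ a → ∑-cong (allVecs m us) (λ u → sym (∑-allVecs-suc m ws _))) ⟩
    ∑ us (λ a → ∑ (allVecs m us) (λ u → ∑ (allVecs (suc m) ws) (h (a ∷ u))))
      ≡⟨ ∑-allVecs-suc m us _ ⟨
    ∑ (allVecs (suc m) us) (λ u → ∑ (allVecs (suc m) ws) (h u)) ∎
    where open ≡-Reasoning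

  -- Relabelling the coordinates

  fromFun : ∀ {n} m → (Pos n m → Bool) → Array n m
  fromFun zero    f = f []
  fromFun (suc m) f = Vec.tabulate (λ i → fromFun m (λ α → f (i ∷ α)))

  at-fromFun : ∀ {n} m (f : Pos n m → Bool) α → at (fromFun m f) α ≡ f α
  at-fromFun zero    f []      = refl
  at-fromFun (suc m) f (i ∷ α) =
    trans (cong (λ A → at A α) (lookup∘tabulate (λ i → fromFun m (λ α → f (i ∷ α))) i)) (at-fromFun m (λ α → f (i ∷ α)) α)

  -- Nested vectors that agree everywhere are propositionally equal, so relabelling gets the
  -- propositional inverse that `∑-bijection` requires.
  array-ext : ∀ {n} m (A B : Array n m) → (∀ α → at A α ≡ at B α) → A ≡ B
  array-ext zero    A B A≗B = A≗B []
  array-ext (suc m) A B A≗B = begin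
    A                          ≡⟨ tabulate∘lookup A ⟨
    Vec.tabulate (lookup A)    ≡⟨ tabulate-cong (λ i → array-ext m (lookup A i) (lookup B i) (λ α → A≗B (i ∷ α))) ⟩
    Vec.tabulate (lookup B)    ≡⟨ tabulate∘lookup B ⟩
    B                          ∎
    where open ≡-Reasoning

  Perms : ℕ → ℕ → Set
  Perms n m = Vec (Permutation′ n) m

  permute : ∀ {n m} → Perms n m → Pos n m → Pos n m
  permute = Vec.zipWith _⟨$⟩ʳ_

  inverse : ∀ {n m} → Perms n m → Perms n m
  inverse = Vec.map Perm.flip

  permute-inverseˡ : ∀ {n m} (σ : Perms n m) α → permute (inverse σ) (permute σ α) ≡ α
  permute-inverseˡ []      []      = refl
  permute-inverseˡ (π ∷ σ) (i ∷ α) = cong₂ _∷_ (Perm.inverseˡ π) (permute-inverseˡ σ α)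

  permute-inverseʳ : ∀ {n m} (σ : Perms n m) α → permute σ (permute (inverse σ) α) ≡ α
  permute-inverseʳ []      []      = refl
  permute-inverseʳ (π ∷ σ) (i ∷ α) = cong₂ _∷_ (Perm.inverseʳ π) (permute-inverseʳ σ α)

  permute-[]≔ : ∀ {n m} (σ : Perms n m) α j i → permute σ (α [ j ]≔ i) ≡ permute σ α [ j ]≔ (lookup σ j ⟨$⟩ʳ i)
  permute-[]≔ (π ∷ σ) (x ∷ α) zero    i = refl
  permute-[]≔ (π ∷ σ) (x ∷ α) (suc j) i = cong (_ ∷_) (permute-[]≔ σ α j i)

  relabel : ∀ {n m} → Perms n m → Array n m → Array n m
  relabel {m = m} σ A = fromFun m (λ α → at A (permute σ α))

  at-relabel : ∀ {n m} (σ : Perms n m) (A : Array n m) α → at (relabel σ A) α ≡ at A (permute σ α)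
  at-relabel {m = m} σ A α = at-fromFun m (λ α → at A (permute σ α)) α

  relabel-inverseˡ : ∀ {n m} (σ : Perms n m) (A : Array n m) → relabel (inverse σ) (relabel σ A) ≡ A
  relabel-inverseˡ {m = m} σ A = array-ext m _ _ (λ α →
    trans (at-relabel (inverse σ) (relabel σ A) α) (trans (at-relabel σ A _) (cong (at A) (permute-inverseʳ σ α))))

  relabel-inverseʳ : ∀ {n m} (σ : Perms n m) (A : Array n m) → relabel σ (relabel (inverse σ) A) ≡ A
  relabel-inverseʳ {m = m} σ A = array-ext m _ _ (λ α →
    trans (at-relabel σ (relabel (inverse σ) A) α) (trans (at-relabel (inverse σ) A _) (cong (at A) (permute-inverseˡ σ α))))

  lineCount-∑ : ∀ {n m} (A : Array n m) j α → lineCount A j α ≡ ∑ (allFin n) (λ i → 𝟙 (at A (α [ j ]≔ i)))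
  lineCount-∑ {n} A j α = length-filter (λ i → T? (at A (α [ j ]≔ i))) (allFin n)

  lineCount-relabel : ∀ {n m} (σ : Perms n m) (A : Array n m) j α → lineCount (relabel σ A) j α ≡ lineCount A j (permute σ α)
  lineCount-relabel {n} σ A j α = begin
    lineCount (relabel σ A) j α
      ≡⟨ lineCount-∑ (relabel σ A) j α ⟩
    ∑ (allFin n) (λ i → 𝟙 (at (relabel σ A) (α [ j ]≔ i)))
      ≡⟨ ∑-cong (allFin n) (λ i → cong 𝟙 (trans (at-relabel σ A _) (cong (at A) (permute-[]≔ σ α j i)))) ⟩
    ∑ (allFin n) (λ i → 𝟙 (at A (permute σ α [ j ]≔ (lookup σ j ⟨$⟩ʳ i))))
      ≡⟨ ∑-bijection (UniqueP.allFin⁺ n) (UniqueP.allFin⁺ n) (lookup σ j ⟨$⟩ʳ_) (lookup σ j ⟨$⟩ˡ_)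
           (λ _ → Perm.inverseˡ (lookup σ j)) (λ _ → Perm.inverseʳ (lookup σ j))
           (λ _ → ∈-allFin _) (λ _ → ∈-allFin _) (λ i → 𝟙 (at A (permute σ α [ j ]≔ i))) ⟩
    ∑ (allFin n) (λ i → 𝟙 (at A (permute σ α [ j ]≔ i)))
      ≡⟨ lineCount-∑ A j (permute σ α) ⟨
    lineCount A j (permute σ α) ∎
    where open ≡-Reasoning

  -- The dimension is arbitrary, so that the property passes to slices of an array and inductions on
  -- the dimension can use it.
  Lines : ∀ {n m} → Array n m → Set
  Lines {n} {m} A = ∀ j (α : Pos n m) → lineCount A j α ≡ 1

  ∈-allPos : ∀ {n m} (α : Pos n m) → α ∈ allPos n m
  ∈-allPos {m = m} α = ∈-allVecs⁺ m α (λ i → ∈-allFin _)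

  ∈-allArrays : ∀ n m (A : Array n m) → A ∈ allArrays n m
  ∈-allArrays n zero    true  = here refl
  ∈-allArrays n zero    false = there (here refl)
  ∈-allArrays n (suc m) A     = ∈-allVecs⁺ n A (λ i → ∈-allArrays n m (lookup A i))

  allArrays-unique : ∀ n m → Unique (allArrays n m)
  allArrays-unique n zero    = ((λ ()) ∷ []) ∷ [] ∷ []
  allArrays-unique n (suc m) = allVecs-unique n (allArrays-unique n m)

  ∈-L⁻ : ∀ {n k} {A : Array n (suc k)} → A ∈ L n k → Lines A
  ∈-L⁻ {n} {k} A∈ j α =
    All.lookup (All.lookup (proj₂ (∈-filter⁻ (isPerm? k) {xs = allArrays n (suc k)} A∈)) (∈-allFin j)) (∈-allPos α)

  ∈-L⁺ : ∀ {n k} {A : Array n (suc k)} → Lines A → A ∈ L n k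
  ∈-L⁺ {n} {k} {A} lines =
    ∈-filter⁺ (isPerm? k) (∈-allArrays n (suc k) A) (All.tabulate (λ {j} _ → All.tabulate (λ {α} _ → lines j α)))

  L-unique : ∀ n k → Unique (L n k)
  L-unique n k = UniqueP.filter⁺ (isPerm? k) (allArrays-unique n (suc k))

  relabel-∈-L : ∀ {n k} (σ : Perms n (suc k)) {A : Array n (suc k)} → A ∈ L n k → relabel σ A ∈ L n k
  relabel-∈-L σ {A} A∈ = ∈-L⁺ (λ j α → trans (lineCount-relabel σ A j α) (∈-L⁻ A∈ j (permute σ α)))

  ∑-relabel : ∀ {n k} (σ : Perms n (suc k)) (F : Array n (suc k) → ℕ) → ∑ (L n k) (F ∘ relabel σ) ≡ ∑ (L n k) F
  ∑-relabel {n} {k} σ F = ∑-bijection (L-unique n k) (L-unique n k) (relabel σ) (relabel (inverse σ))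
    (relabel-inverseˡ σ) (relabel-inverseʳ σ) (relabel-∈-L σ) (relabel-∈-L (inverse σ)) F

  -- Stored coordinate by coordinate. Read by columns this is a list of r cells; with one entry
  -- chosen freely from each row it is a box with r^m cells.
  Rows : ℕ → ℕ → ℕ → Set
  Rows n r m = Vec (Vec (Fin n) r) m

  permuteRows : ∀ {n m r} → Perms n m → Rows n r m → Rows n r m
  permuteRows = Vec.zipWith (λ π → Vec.map (π ⟨$⟩ʳ_))

  transpose-at : ∀ {n} (i j : Fin n) → Perm.transpose i j ⟨$⟩ʳ i ≡ j
  transpose-at i j rewrite dec-true (i FinP.≟ i) refl = refl

  transpose-away : ∀ {n} (i j k : Fin n) → i ≢ k → j ≢ k → Perm.transpose i j ⟨$⟩ʳ k ≡ k
  transpose-away i j k i≢k j≢k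
    rewrite dec-false (k FinP.≟ i) (i≢k ∘ sym) | dec-false (k FinP.≟ j) (j≢k ∘ sym) = refl

  -- A permutation that works for the tails is followed by the transposition of π x and y. It moves
  -- none of the remaining images: they differ from π x because u has no repetitions, and from y
  -- because v has none.
  injective-extends : ∀ {n r} (u v : Vec (Fin n) r) → V.Unique u → V.Unique v →
    Σ (Permutation′ n) λ π → Vec.map (π ⟨$⟩ʳ_) u ≡ v
  injective-extends []      []      _          _          = Perm.id , refl
  injective-extends (x ∷ u) (y ∷ v) (x∉u ∷ u!) (y∉v ∷ v!) with injective-extends u v u! v!
  ... | π , πu≡v = π ∘ₚ Perm.transpose (π ⟨$⟩ʳ x) y , cong₂ _∷_ (transpose-at (π ⟨$⟩ʳ x) y) (fixed u v x∉u y∉v πu≡v)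
    where
    fixed : ∀ {r} (u v : Vec (Fin _) r) → VAll.All (x ≢_) u → VAll.All (y ≢_) v → Vec.map (π ⟨$⟩ʳ_) u ≡ v →
      Vec.map ((π ∘ₚ Perm.transpose (π ⟨$⟩ʳ x) y) ⟨$⟩ʳ_) u ≡ v
    fixed []      []      _          _          _    = refl
    fixed (a ∷ u) (_ ∷ v) (x≢a ∷ x∉) (y≢b ∷ y∉) refl = cong₂ _∷_
      (transpose-away (π ⟨$⟩ʳ x) y (π ⟨$⟩ʳ a)
        (λ eq → x≢a (trans (sym (Perm.inverseˡ π)) (trans (cong (π ⟨$⟩ˡ_) eq) (Perm.inverseˡ π)))) y≢b)
      (fixed u _ x∉ y∉ refl)

  rows-transitive : ∀ {n r m} (β γ : Rows n r m) → (∀ j → V.Unique (lookup β j)) → (∀ j → V.Unique (lookup γ j)) →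
    Σ (Perms n m) λ σ → permuteRows σ β ≡ γ
  rows-transitive []      []      _  _  = [] , refl
  rows-transitive (u ∷ β) (v ∷ γ) β! γ! with injective-extends u v (β! zero) (γ! zero) | rows-transitive β γ (β! ∘ suc) (γ! ∘ suc)
  ... | π , πu≡v | σ , σβ≡γ = π ∷ σ , cong₂ _∷_ πu≡v σβ≡γ

  -- Injective tuples

  -- The falling factorial n(n-1)...(n-r+1). Truncated subtraction makes it vanish for r > n.
  fall : ℕ → ℕ → ℕ
  fall n zero    = 1
  fall n (suc r) = (n ∸ r) * fall n r

  ∏ : ∀ {A : Set} {t} → (A → ℕ) → Vec A t → ℕ
  ∏ w []      = 1
  ∏ w (x ∷ v) = w x * ∏ w v

  unique? : ∀ {n t} → Decidable (V.Unique {A = Fin n} {t})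
  unique? = VAllPairs.allPairs? (λ x y → ¬? (x FinP.≟ y))

  fresh? : ∀ {n t} (x : Fin n) → Decidable (VAll.All (x ≢_) {t})
  fresh? x = VAll.all? (λ y → ¬? (x FinP.≟ y))

  injVecs : ∀ n t → List (Vec (Fin n) t)
  injVecs n t = filter unique? (allVecs t (allFin n))

  ∑-filter : {A : Set} {P : A → Set} (P? : Decidable P) (xs : List A) (f : A → ℕ) →
    ∑ (filter P? xs) f ≡ ∑ xs (λ x → 𝟙 (does (P? x)) * f x)
  ∑-filter P? []       f = refl
  ∑-filter P? (x ∷ xs) f with does (P? x)
  ... | true  = cong₂ _+_ (sym (+-identityʳ (f x))) (∑-filter P? xs f)
  ... | false = ∑-filter P? xs f

  ∑-filter-≤ : {A : Set} {P : A → Set} (P? : Decidable P) (xs : List A) (f : A → ℕ) → ∑ (filter P? xs) f ≤ ∑ xs f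
  ∑-filter-≤ P? []       f = z≤n
  ∑-filter-≤ P? (x ∷ xs) f with does (P? x)
  ... | true  = +-monoʳ-≤ (f x) (∑-filter-≤ P? xs f)
  ... | false = ≤-trans (∑-filter-≤ P? xs f) (m≤n+m _ (f x))

  𝟙≤1 : ∀ b → 𝟙 b ≤ 1
  𝟙≤1 true  = ≤-refl
  𝟙≤1 false = z≤n

  𝟙-≤ : {P : Set} (P? : Dec P) {c : ℕ} → (P → 1 ≤ c) → 𝟙 (does P?) ≤ c
  𝟙-≤ (yes p) 1≤c = 1≤c p
  𝟙-≤ (no _)  1≤c = z≤n

  ∑-≟-unique : {A : Set} (_≟_ : DecidableEquality A) {xs : List A} (y : A) → Unique xs → ∑ xs (λ x → 𝟙 (does (x ≟ y))) ≤ 1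
  ∑-≟-unique _≟_ y []                  = z≤n
  ∑-≟-unique _≟_ {x ∷ xs} y (x∉xs ∷ xs!) with x ≟ y
  ... | no  _    = ∑-≟-unique _≟_ y xs!
  ... | yes refl = s≤s (≤-reflexive (trans
    (∑-cong-∈ xs (λ {z} z∈ → cong 𝟙 (dec-false (z ≟ x) (λ z≡x → All.lookup x∉xs z∈ (sym z≡x)))))
    (trans (∑-const xs 0) (*-zeroʳ (length xs)))))

  -- Each of the t entries of `v` forbids at most one `x`, of weight at most 1.
  ∑-fresh : ∀ {n t} (w : Fin n → ℕ) → (∀ x → w x ≤ 1) → (v : Vec (Fin n) t) →
    ∑ (allFin n) w ≤ ∑ (allFin n) (λ x → 𝟙 (does (fresh? x v)) * w x) + t
  ∑-fresh {n} w w≤1 [] = ≤-reflexive (sym (trans (+-identityʳ _) (∑-cong (allFin n) (λ x → +-identityʳ (w x)))))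
  ∑-fresh {n} {suc t} w w≤1 (y ∷ v) = begin
    ∑ (allFin n) w
      ≤⟨ ∑-fresh w w≤1 v ⟩
    ∑ (allFin n) (λ x → 𝟙 (does (fresh? x v)) * w x) + t
      ≤⟨ +-monoˡ-≤ t (∑-mono (allFin n) pointwise) ⟩
    ∑ (allFin n) (λ x → 𝟙 (does (fresh? x (y ∷ v))) * w x + 𝟙 (does (x FinP.≟ y))) + t
      ≡⟨ cong (_+ t) (∑-+ (allFin n) _ _) ⟩
    S + ∑ (allFin n) (λ x → 𝟙 (does (x FinP.≟ y))) + t
      ≤⟨ +-monoˡ-≤ t (+-monoʳ-≤ S (∑-≟-unique FinP._≟_ y (UniqueP.allFin⁺ n))) ⟩
    S + 1 + t
      ≡⟨ +-assoc S 1 t ⟩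
    S + suc t ∎
    where
    open ≤-Reasoning
    S = ∑ (allFin n) (λ x → 𝟙 (does (fresh? x (y ∷ v))) * w x)
    pointwise : ∀ x → 𝟙 (does (fresh? x v)) * w x ≤ 𝟙 (does (fresh? x (y ∷ v))) * w x + 𝟙 (does (x FinP.≟ y))
    pointwise x with does (x FinP.≟ y)
    ... | false = m≤m+n _ 0
    ... | true  = *-mono-≤ (𝟙≤1 (does (fresh? x v))) (w≤1 x)

  -- Entries are chosen one at a time: by `∑-fresh` the choices still allowed after t entries have
  -- total weight at least W ∸ t. Weight 1 counts injective tuples; emptiness indicators as weights
  -- give the factorial moment of the number of empty boxes.
  fall≤∑∏ : ∀ {n} t (w : Fin n → ℕ) → (∀ x → w x ≤ 1) → fall (∑ (allFin n) w) t ≤ ∑ (injVecs n t) (∏ w)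
  fall≤∑∏ {n} zero w w≤1 = ≤-refl
  fall≤∑∏ {n} (suc t) w w≤1 = begin
    (W ∸ t) * fall W t
      ≤⟨ *-monoʳ-≤ (W ∸ t) (fall≤∑∏ t w w≤1) ⟩
    (W ∸ t) * ∑ (injVecs n t) (∏ w)
      ≡⟨ ∑-*ˡ (injVecs n t) (W ∸ t) (∏ w) ⟨
    ∑ (injVecs n t) (λ v → (W ∸ t) * ∏ w v)
      ≤⟨ ∑-mono (injVecs n t) (λ v → *-monoˡ-≤ (∏ w v) (m≤n+o⇒m∸n≤o W t (≤-trans (∑-fresh w w≤1 v) (≤-reflexive (+-comm _ t))))) ⟩
    ∑ (injVecs n t) (λ v → ∑ (allFin n) (λ x → 𝟙 (does (fresh? x v)) * w x) * ∏ w v)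
      ≡⟨ ∑-filter unique? (allVecs t (allFin n)) _ ⟩
    ∑ (allVecs t (allFin n)) (λ v → 𝟙 (does (unique? v)) * (∑ (allFin n) (λ x → 𝟙 (does (fresh? x v)) * w x) * ∏ w v))
      ≡⟨ ∑-cong (allVecs t (allFin n)) (λ v → trans (cong (𝟙 (does (unique? v)) *_) (sym (∑-*ʳ (allFin n) (∏ w v) _)))
          (sym (∑-*ˡ (allFin n) (𝟙 (does (unique? v))) _))) ⟩
    ∑ (allVecs t (allFin n)) (λ v → ∑ (allFin n) (λ x → 𝟙 (does (unique? v)) * (𝟙 (does (fresh? x v)) * w x * ∏ w v)))
      ≡⟨ ∑-swap (allVecs t (allFin n)) (allFin n) _ ⟩
    ∑ (allFin n) (λ x → ∑ (allVecs t (allFin n)) (λ v → 𝟙 (does (unique? v)) * (𝟙 (does (fresh? x v)) * w x * ∏ w v)))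
      ≡⟨ ∑-cong (allFin n) (λ x → ∑-cong (allVecs t (allFin n)) (λ v → rearrange x v)) ⟩
    ∑ (allFin n) (λ x → ∑ (allVecs t (allFin n)) (λ v → 𝟙 (does (unique? (x ∷ v))) * ∏ w (x ∷ v)))
      ≡⟨ ∑-allVecs-suc t (allFin n) _ ⟨
    ∑ (allVecs (suc t) (allFin n)) (λ v → 𝟙 (does (unique? v)) * ∏ w v)
      ≡⟨ ∑-filter unique? (allVecs (suc t) (allFin n)) (∏ w) ⟨
    ∑ (injVecs n (suc t)) (∏ w) ∎
    where
    open ≤-Reasoning
    W = ∑ (allFin n) w
    rearrange : ∀ x v → 𝟙 (does (unique? v)) * (𝟙 (does (fresh? x v)) * w x * ∏ w v)
              ≡ 𝟙 (does (fresh? x v) ∧ does (unique? v)) * (w x * ∏ w v)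
    rearrange x v with does (fresh? x v)
    ... | true  = cong (𝟙 (does (unique? v)) *_) (cong (_* ∏ w v) (+-identityʳ (w x)))
    ... | false = *-zeroʳ (𝟙 (does (unique? v)))

  ∑-allVecs-filter-≤ : {A : Set} {P : A → Set} (P? : Decidable P) (xs : List A) (m : ℕ) (f : Vec A m → ℕ) →
    ∑ (allVecs m (filter P? xs)) f ≤ ∑ (allVecs m xs) f
  ∑-allVecs-filter-≤ P? xs zero    f = ≤-refl
  ∑-allVecs-filter-≤ P? xs (suc m) f = begin
    ∑ (allVecs (suc m) (filter P? xs)) f
      ≡⟨ ∑-allVecs-suc m (filter P? xs) f ⟩
    ∑ (filter P? xs) (λ x → ∑ (allVecs m (filter P? xs)) (λ v → f (x ∷ v)))
      ≤⟨ ∑-mono (filter P? xs) (λ x → ∑-allVecs-filter-≤ P? xs m (λ v → f (x ∷ v))) ⟩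
    ∑ (filter P? xs) (λ x → ∑ (allVecs m xs) (λ v → f (x ∷ v)))
      ≤⟨ ∑-filter-≤ P? xs _ ⟩
    ∑ xs (λ x → ∑ (allVecs m xs) (λ v → f (x ∷ v)))
      ≡⟨ ∑-allVecs-suc m xs f ⟨
    ∑ (allVecs (suc m) xs) f ∎
    where open ≤-Reasoning

  fall≤length-injVecs : ∀ n t → fall n t ≤ length (injVecs n t)
  fall≤length-injVecs n t = begin
    fall n t                             ≡⟨ cong (λ z → fall z t) (sym (trans (∑-1 (allFin n)) (length-allFin n))) ⟩
    fall (∑ (allFin n) (λ _ → 1)) t      ≤⟨ fall≤∑∏ t (λ _ → 1) (λ _ → ≤-refl) ⟩
    ∑ (injVecs n t) (∏ (λ _ → 1))        ≡⟨ ∑-cong (injVecs n t) ∏1 ⟩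
    ∑ (injVecs n t) (λ _ → 1)            ≡⟨ ∑-1 (injVecs n t) ⟩
    length (injVecs n t)                 ∎
    where
    open ≤-Reasoning
    ∏1 : ∀ {A : Set} {t} (v : Vec A t) → ∏ (λ _ → 1) v ≡ 1
    ∏1 []      = refl
    ∏1 (x ∷ v) = trans (+-identityʳ _) (∏1 v)

  -- By symmetry the sum over L has the same value C for every β with injective rows; averaging over all
  -- such β, and then dropping injectivity, bounds C by an average over independent uniform entries.
  transfer : ∀ {n k r} (F : Array n (suc k) → Rows n r (suc k) → ℕ) →
    (∀ σ A β → F (relabel σ A) β ≡ F A (permuteRows σ β)) →
    ∀ β → (∀ j → V.Unique (lookup β j)) →
    fall n r ^ suc k * ∑ (L n k) (λ A → F A β) ≤ ∑ (L n k) (λ A → ∑ (allVecs (suc k) (allVecs r (allFin n))) (F A))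
  transfer {n} {k} {r} F F-relabel β β! = begin
    fall n r ^ m * C
      ≤⟨ *-monoˡ-≤ C (^-monoˡ-≤ m (fall≤length-injVecs n r)) ⟩
    length (injVecs n r) ^ m * C
      ≡⟨ cong (_* C) (sym (length-allVecs m (injVecs n r))) ⟩
    length (allVecs m (injVecs n r)) * C
      ≡⟨ ∑-const (allVecs m (injVecs n r)) C ⟨
    ∑ (allVecs m (injVecs n r)) (λ _ → C)
      ≡⟨ ∑-cong-∈ (allVecs m (injVecs n r)) (λ {γ} γ∈ → constant γ (λ j → proj₂ (∈-filter⁻ unique? {xs = allVecs r (allFin n)} (∈-allVecs⁻ m γ∈ j)))) ⟩
    ∑ (allVecs m (injVecs n r)) (λ γ → ∑ (L n k) (λ A → F A γ))
      ≤⟨ ∑-allVecs-filter-≤ unique? (allVecs r (allFin n)) m _ ⟩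
    ∑ (allVecs m (allVecs r (allFin n))) (λ γ → ∑ (L n k) (λ A → F A γ))
      ≡⟨ ∑-swap (allVecs m (allVecs r (allFin n))) (L n k) _ ⟩
    ∑ (L n k) (λ A → ∑ (allVecs m (allVecs r (allFin n))) (F A)) ∎
    where
    open ≤-Reasoning
    m = suc k
    C = ∑ (L n k) (λ A → F A β)
    constant : ∀ γ → (∀ j → V.Unique (lookup γ j)) → C ≡ ∑ (L n k) (λ A → F A γ)
    constant γ γ! with rows-transitive γ β γ! β!
    ... | σ , refl = sym (trans (sym (∑-relabel σ (λ A → F A γ))) (∑-cong (L n k) (λ A → F-relabel σ A γ)))

  length-allPos : ∀ n m → length (allPos n m) ≡ n ^ m
  length-allPos n m = trans (length-allVecs m (allFin n)) (cong (_^ m) (length-allFin n))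

  -- The longest monotone subsequence as a maximum

  longest : {P : ℕ → Set} → Decidable P → List ℕ → ℕ
  longest P? = foldr (λ ℓ acc → (if does (P? ℓ) then ℓ else 0) ⊔ acc) 0

  longest-max : {P : ℕ → Set} (P? : Decidable P) {xs : List ℕ} {h : ℕ} → h ∈ xs → P h → h ≤ longest P? xs
  longest-max P? {x ∷ xs} (here refl) p with P? x
  ... | yes _ = m≤m⊔n x _
  ... | no ¬p = contradiction p ¬p
  longest-max P? {x ∷ xs} (there h∈) p = ≤-trans (longest-max P? h∈ p) (m≤n⊔m (if does (P? x) then x else 0) _)

  -- The value 0 may be the default of the fold instead of a witness, hence the separate
  -- alternative.
  longest-attained : {P : ℕ → Set} (P? : Decidable P) (xs : List ℕ) →
    longest P? xs ≡ 0 ⊎ (longest P? xs ∈ xs × P (longest P? xs))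
  longest-attained P? []       = inj₁ refl
  longest-attained {P} P? (x ∷ xs) with P? x | longest-attained P? xs
  ... | no _  | inj₁ eq        = inj₁ eq
  ... | no _  | inj₂ (h∈ , p)  = inj₂ (there h∈ , p)
  ... | yes p | rest with ⊔-sel x (longest P? xs)
  ...   | inj₁ eq rewrite eq = inj₂ (here refl , p)
  ...   | inj₂ eq rewrite eq with rest
  ...     | inj₁ eq′       = inj₁ eq′
  ...     | inj₂ (h∈ , p′) = inj₂ (there h∈ , p′)

  H-max : ∀ {n k} (A : Array n (suc k)) {h} → h ≤ n → HasMonotone A h → h ≤ H k A
  H-max A h≤n = longest-max (hasMonotone? A) (∈-upTo⁺ (s≤s h≤n))

  H-attained : ∀ {n k} (A : Array n (suc k)) → H k A ≡ 0 ⊎ (H k A ≤ n × HasMonotone A (H k A))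
  H-attained {n} A with longest-attained (hasMonotone? A) (upTo (suc n))
  ... | inj₁ H≡0       = inj₁ H≡0
  ... | inj₂ (H∈ , mono) = inj₂ (s≤s⁻¹ (∈-upTo⁻ H∈) , mono)

  H≤n : ∀ {n k} (A : Array n (suc k)) → H k A ≤ n
  H≤n A with H-attained A
  ... | inj₁ H≡0       = ≤-trans (≤-reflexive H≡0) z≤n
  ... | inj₂ (H≤n , _) = H≤n

  -- Monotone sequences

  -- Pascal's recursion: an increasing sequence either starts with `zero` or avoids it.
  increasing : ∀ n t → List (Vec (Fin n) t)
  increasing n       zero    = [] ∷ []
  increasing zero    (suc t) = []
  increasing (suc n) (suc t) =
    List.map (λ v → zero ∷ Vec.map suc v) (increasing n t) List.++ List.map (Vec.map suc) (increasing n (suc t))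

  fall-suc : ∀ n t → fall (suc n) (suc t) ≡ suc n * fall n t
  fall-suc n zero    = refl
  fall-suc n (suc t) = begin
    (n ∸ t) * fall (suc n) (suc t)     ≡⟨ cong ((n ∸ t) *_) (fall-suc n t) ⟩
    (n ∸ t) * (suc n * fall n t)       ≡⟨ *-assoc (n ∸ t) (suc n) _ ⟨
    (n ∸ t) * suc n * fall n t         ≡⟨ cong (_* fall n t) (*-comm (n ∸ t) (suc n)) ⟩
    suc n * (n ∸ t) * fall n t         ≡⟨ *-assoc (suc n) (n ∸ t) _ ⟩
    suc n * ((n ∸ t) * fall n t)       ∎
    where open ≡-Reasoning

  fall-zero : ∀ n t → n < t → fall n t ≡ 0
  fall-zero n (suc t) (s≤s n≤t) = cong (_* fall n t) (m≤n⇒m∸n≡0 n≤t)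

  fall-pos : ∀ n t → t ≤ n → 0 < fall n t
  fall-pos n zero    t≤n = s≤s z≤n
  fall-pos n (suc t) t<n = *-mono-≤ {1} {_} {1} (m<n⇒0<n∸m t<n) (fall-pos n t (<⇒≤ t<n))

  length-increasing : ∀ n t → length (increasing n t) * t ! ≤ fall n t
  length-increasing n       zero    = ≤-refl
  length-increasing zero    (suc t) = z≤n
  length-increasing (suc n) (suc t) = begin
    length (increasing (suc n) (suc t)) * (suc t) !
      ≡⟨ cong (_* (suc t) !) (trans (length-++ (List.map (λ v → zero ∷ Vec.map suc v) (increasing n t)))
           (cong₂ _+_ (length-map _ (increasing n t)) (length-map _ (increasing n (suc t))))) ⟩
    (a + b) * (suc t * t !)
      ≡⟨ *-distribʳ-+ (suc t * t !) a b ⟩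
    a * (suc t * t !) + b * (suc t) !
      ≡⟨ cong (_+ b * (suc t) !) (trans (sym (*-assoc a (suc t) (t !))) (trans (cong (_* t !) (*-comm a (suc t))) (*-assoc (suc t) a (t !)))) ⟩
    suc t * (a * t !) + b * (suc t) !
      ≤⟨ +-mono-≤ (*-monoʳ-≤ (suc t) (length-increasing n t)) (length-increasing n (suc t)) ⟩
    suc t * fall n t + (n ∸ t) * fall n t
      ≡⟨ *-distribʳ-+ (fall n t) (suc t) (n ∸ t) ⟨
    (suc t + (n ∸ t)) * fall n t
      ≤⟨ bound (t ≤? n) ⟩
    suc n * fall n t
      ≡⟨ fall-suc n t ⟨
    fall (suc n) (suc t) ∎
    where
    open ≤-Reasoning
    a = length (increasing n t)
    b = length (increasing n (suc t))
    -- For t > n truncation breaks the identity (t + 1) + (n - t) = n + 1, but then the common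
    -- factor `fall n t` is 0.
    bound : Dec (t ≤ n) → (suc t + (n ∸ t)) * fall n t ≤ suc n * fall n t
    bound (yes t≤n) = ≤-reflexive (cong (λ z → suc z * fall n t) (m+[n∸m]≡n t≤n))
    bound (no  t≰n) rewrite fall-zero n t (≰⇒> t≰n) = ≤-reflexive (trans (*-zeroʳ (suc t + (n ∸ t))) (sym (*-zeroʳ (suc n))))

  increasing-injective : ∀ n t {v} → v ∈ increasing n t → V.Unique v
  increasing-injective n       zero    (here refl) = []
  increasing-injective (suc n) (suc t) v∈ with ∈-++⁻ (List.map (λ v → zero ∷ Vec.map suc v) (increasing n t)) v∈
  ... | inj₁ v∈₁ with ∈-map⁻ _ v∈₁
  ...   | w , w∈ , refl = VAllP.map⁺ (VAll.universal (λ _ ()) w) ∷ VUniqueP.map⁺ FinP.suc-injective (increasing-injective n t w∈)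
  increasing-injective (suc n) (suc t) v∈ | inj₂ v∈₂ with ∈-map⁻ _ v∈₂
  ...   | w , w∈ , refl = VUniqueP.map⁺ FinP.suc-injective (increasing-injective n (suc t) w∈)

  unmap-suc : ∀ {n t} (v : Vec (Fin (suc n)) t) → (∀ i → 0 < toℕ (lookup v i)) → ∃[ w ] v ≡ Vec.map suc w
  unmap-suc []          v>0 = [] , refl
  unmap-suc (zero  ∷ v) v>0 with v>0 zero
  ... | ()
  unmap-suc (suc x ∷ v) v>0 with unmap-suc v (v>0 ∘ suc)
  ... | w , refl = x ∷ w , refl

  unmap-suc-increasing : ∀ {n t} (w : Vec (Fin n) t) {i j : Fin t} →
    toℕ (lookup (Vec.map suc w) i) < toℕ (lookup (Vec.map suc w) j) → toℕ (lookup w i) < toℕ (lookup w j)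
  unmap-suc-increasing w {i} {j} lt = s≤s⁻¹ (subst₂ _<_ (cong toℕ (lookup-map i suc w)) (cong toℕ (lookup-map j suc w)) lt)

  ∈-increasing : ∀ n t (v : Vec (Fin n) t) → (∀ {i j} → toℕ i < toℕ j → toℕ (lookup v i) < toℕ (lookup v j)) →
    v ∈ increasing n t
  ∈-increasing n       zero    []      inc = here refl
  ∈-increasing (suc n) (suc t) (zero ∷ v) inc with unmap-suc v (λ i → inc {zero} {suc i} (s≤s z≤n))
  ... | w , refl = ∈-++⁺ˡ (∈-map⁺ _ (∈-increasing n t w
        (λ {i} {j} i<j → unmap-suc-increasing w (inc {suc i} {suc j} (s≤s i<j)))))
  ∈-increasing (suc n) (suc t) (suc x ∷ v) inc with unmap-suc (suc x ∷ v) positive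
    where
    positive : ∀ i → 0 < toℕ (lookup (suc x ∷ v) i)
    positive zero    = s≤s z≤n
    positive (suc i) = ≤-trans (s≤s z≤n) (inc {zero} {suc i} (s≤s z≤n))
  ... | w , eq rewrite eq = ∈-++⁺ʳ (List.map (λ v → zero ∷ Vec.map suc v) (increasing n t)) (∈-map⁺ _ (∈-increasing n (suc t) w
        (λ {i} {j} i<j → unmap-suc-increasing w (inc {i} {j} i<j))))

  -- Decreasing sequences are increasing ones with the values reflected by `opposite`. For t ≤ 1
  -- sequences are listed twice, which is harmless because only an upper bound on the length of the
  -- list is used.
  monotone : ∀ n t → List (Vec (Fin n) t)
  monotone n t = increasing n t List.++ List.map (Vec.map opposite) (increasing n t)

  length-monotone : ∀ n t → length (monotone n t) * t ! ≤ 2 * fall n t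
  length-monotone n t = begin
    length (monotone n t) * t !
      ≡⟨ cong (_* t !) (trans (length-++ (increasing n t)) (cong (length (increasing n t) +_) (length-map _ (increasing n t)))) ⟩
    (a + a) * t !         ≡⟨ *-distribʳ-+ (t !) a a ⟩
    a * t ! + a * t !     ≤⟨ +-mono-≤ (length-increasing n t) (≤-trans (length-increasing n t) (m≤m+n _ 0)) ⟩
    2 * fall n t          ∎
    where
    open ≤-Reasoning
    a = length (increasing n t)

  opposite-injective : ∀ {n} {i j : Fin n} → opposite i ≡ opposite j → i ≡ j
  opposite-injective {i = i} {j} eq = trans (sym (FinP.opposite-involutive i)) (trans (cong opposite eq) (FinP.opposite-involutive j))

  monotone-injective : ∀ n t {v} → v ∈ monotone n t → V.Unique v
  monotone-injective n t v∈ with ∈-++⁻ (increasing n t) v∈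
  ... | inj₁ v∈₁ = increasing-injective n t v∈₁
  ... | inj₂ v∈₂ with ∈-map⁻ _ v∈₂
  ...   | w , w∈ , refl = VUniqueP.map⁺ opposite-injective (increasing-injective n t w∈)

  opposite-anti : ∀ {n} {i j : Fin n} → toℕ i > toℕ j → toℕ (opposite i) < toℕ (opposite j)
  opposite-anti {n} {i} {j} i>j rewrite FinP.opposite-prop i | FinP.opposite-prop j = ∸-monoʳ-< (s≤s i>j) (FinP.toℕ<n i)

  ∈-monotone : ∀ n t (v : Vec (Fin n) t) →
    (∀ {i j} → toℕ i < toℕ j → toℕ (lookup v i) < toℕ (lookup v j)) ⊎
    (∀ {i j} → toℕ i < toℕ j → toℕ (lookup v i) > toℕ (lookup v j)) → v ∈ monotone n t
  ∈-monotone n t v (inj₁ inc) = ∈-++⁺ˡ (∈-increasing n t v inc)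
  ∈-monotone n t v (inj₂ dec) = ∈-++⁺ʳ (increasing n t) (subst (_∈ List.map (Vec.map opposite) (increasing n t)) twice
    (∈-map⁺ (Vec.map opposite) (∈-increasing n t (Vec.map opposite v) inc′)))
    where
    twice : Vec.map opposite (Vec.map opposite v) ≡ v
    twice = trans (sym (map-∘ opposite opposite v)) (trans (map-cong FinP.opposite-involutive v) (map-id v))
    inc′ : ∀ {i j} → toℕ i < toℕ j → toℕ (lookup (Vec.map opposite v) i) < toℕ (lookup (Vec.map opposite v) j)
    inc′ {i} {j} i<j rewrite lookup-map i opposite v | lookup-map j opposite v = opposite-anti (dec i<j)

  lookup-All : ∀ {A : Set} {P : ℕ → Set} {h} (f : A → ℕ) (s : Vec A h) → All P (List.map f (Vec.toList s)) → ∀ i → P (f (lookup s i))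
  lookup-All f (x ∷ s) (p ∷ ps) zero    = p
  lookup-All f (x ∷ s) (p ∷ ps) (suc i) = lookup-All f s ps i

  lookup-AllPairs : ∀ {A : Set} {R : ℕ → ℕ → Set} {h} (f : A → ℕ) (s : Vec A h) →
    AllPairs R (List.map f (Vec.toList s)) → ∀ {i j} → toℕ i < toℕ j → R (f (lookup s i)) (f (lookup s j))
  lookup-AllPairs f (x ∷ s) (r ∷ rs) {zero}  {suc j} _         = lookup-All f s r j
  lookup-AllPairs f (x ∷ s) (r ∷ rs) {suc i} {suc j} (s≤s i<j) = lookup-AllPairs f s rs i<j

  -- Indicator that all t columns of `β` are support cells. The product form lets a sum over
  -- independent columns factorise.
  allOnes : ∀ {n m} t → Array n m → Rows n t m → ℕ
  allOnes zero    A β = 1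
  allOnes (suc t) A β = 𝟙 (at A (Vec.map Vec.head β)) * allOnes t A (Vec.map Vec.tail β)

  permute-head : ∀ {n m t} (σ : Perms n m) (β : Rows n (suc t) m) → permute σ (Vec.map Vec.head β) ≡ Vec.map Vec.head (permuteRows σ β)
  permute-head []      []            = refl
  permute-head (π ∷ σ) ((x ∷ u) ∷ β) = cong (_ ∷_) (permute-head σ β)

  permute-tail : ∀ {n m t} (σ : Perms n m) (β : Rows n (suc t) m) → permuteRows σ (Vec.map Vec.tail β) ≡ Vec.map Vec.tail (permuteRows σ β)
  permute-tail []      []            = refl
  permute-tail (π ∷ σ) ((x ∷ u) ∷ β) = cong (_ ∷_) (permute-tail σ β)

  allOnes-relabel : ∀ {n m} t (σ : Perms n m) (A : Array n m) β → allOnes t (relabel σ A) β ≡ allOnes t A (permuteRows σ β)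
  allOnes-relabel zero    σ A β = refl
  allOnes-relabel (suc t) σ A β = cong₂ _*_
    (cong 𝟙 (trans (at-relabel σ A _) (cong (at A) (permute-head σ β))))
    (trans (allOnes-relabel t σ A _) (cong (allOnes t A) (permute-tail σ β)))

  ∑-at : ∀ {n k} (A : Array (suc n) (suc k)) → Lines A → ∑ (allPos (suc n) (suc k)) (λ α → 𝟙 (at A α)) ≡ suc n ^ k
  ∑-at {n} {k} A lines = begin
    ∑ (allPos (suc n) (suc k)) (λ α → 𝟙 (at A α))
      ≡⟨ ∑-allVecs-suc k (allFin (suc n)) _ ⟩
    ∑ (allFin (suc n)) (λ x → ∑ (allPos (suc n) k) (λ α → 𝟙 (at A (x ∷ α))))
      ≡⟨ ∑-swap (allFin (suc n)) (allPos (suc n) k) _ ⟩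
    ∑ (allPos (suc n) k) (λ α → ∑ (allFin (suc n)) (λ x → 𝟙 (at A (x ∷ α))))
      ≡⟨ ∑-cong (allPos (suc n) k) (λ α → trans (sym (lineCount-∑ A zero (zero ∷ α))) (lines zero (zero ∷ α))) ⟩
    ∑ (allPos (suc n) k) (λ _ → 1)
      ≡⟨ trans (∑-1 (allPos (suc n) k)) (length-allPos (suc n) k) ⟩
    suc n ^ k ∎
    where open ≡-Reasoning

  -- With unrestricted rows the t columns range independently over all cells, and each hits the
  -- support n^k times. This holds for every single `A`.
  ∑-allOnes : ∀ {n k} (A : Array (suc n) (suc k)) → Lines A → ∀ t →
    ∑ (allVecs (suc k) (allVecs t (allFin (suc n)))) (allOnes t A) ≡ (suc n ^ k) ^ t
  ∑-allOnes {n} {k} A lines zero = trans (∑-1 (allVecs (suc k) (allVecs 0 (allFin (suc n)))))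
    (trans (length-allVecs (suc k) (allVecs 0 (allFin (suc n)))) (^-zeroˡ (suc k)))
  ∑-allOnes {n} {k} A lines (suc t) = begin
    ∑ (allVecs (suc k) (allVecs (suc t) (allFin (suc n)))) (allOnes (suc t) A)
      ≡⟨ ∑-allVecs-unzip (allVecs (suc t) (allFin (suc n))) (allFin (suc n)) (allVecs t (allFin (suc n))) Vec.head Vec.tail
           (λ h → ∑-allVecs-suc t (allFin (suc n)) _) (suc k) (λ α γ → 𝟙 (at A α) * allOnes t A γ) ⟩
    ∑ (allPos (suc n) (suc k)) (λ α → ∑ (allVecs (suc k) (allVecs t (allFin (suc n)))) (λ γ → 𝟙 (at A α) * allOnes t A γ))
      ≡⟨ ∑-*-∑ (allPos (suc n) (suc k)) (allVecs (suc k) (allVecs t (allFin (suc n)))) _ _ ⟩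
    ∑ (allPos (suc n) (suc k)) (λ α → 𝟙 (at A α)) * ∑ (allVecs (suc k) (allVecs t (allFin (suc n)))) (allOnes t A)
      ≡⟨ cong₂ _*_ (∑-at A lines) (∑-allOnes A lines t) ⟩
    (suc n ^ k) ^ suc t ∎
    where open ≡-Reasoning

  ∑-L-allOnes : ∀ n k t (β : Rows (suc n) t (suc k)) → (∀ j → V.Unique (lookup β j)) →
    fall (suc n) t ^ suc k * ∑ (L (suc n) k) (λ A → allOnes t A β) ≤ card (suc n) k * (suc n ^ k) ^ t
  ∑-L-allOnes n k t β β! = begin
    fall (suc n) t ^ suc k * ∑ (L (suc n) k) (λ A → allOnes t A β)
      ≤⟨ transfer (allOnes t) (allOnes-relabel t) β β! ⟩
    ∑ (L (suc n) k) (λ A → ∑ (allVecs (suc k) (allVecs t (allFin (suc n)))) (allOnes t A))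
      ≡⟨ ∑-cong-∈ (L (suc n) k) (λ {A} A∈ → ∑-allOnes A (∈-L⁻ A∈) t) ⟩
    ∑ (L (suc n) k) (λ _ → (suc n ^ k) ^ t)
      ≡⟨ ∑-const (L (suc n) k) _ ⟩
    card (suc n) k * (suc n ^ k) ^ t ∎
    where open ≤-Reasoning

  allOnes≡1 : ∀ {n m} t (A : Array n m) (β : Rows n t m) → (∀ i → T (at A (Vec.map (λ u → lookup u i) β))) → allOnes t A β ≡ 1
  allOnes≡1 zero    A β ones = refl
  allOnes≡1 (suc t) A β ones = cong₂ _*_
    (trans (cong (λ α → 𝟙 (at A α)) (map-cong (λ { (x ∷ u) → refl }) β)) (𝟙-T (ones zero)))
    (allOnes≡1 t A (Vec.map Vec.tail β) (λ i → subst (T ∘ at A) (trans (map-cong (λ { (x ∷ u) → refl }) β) (map-∘ _ Vec.tail β)) (ones (suc i))))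
    where
    𝟙-T : ∀ {b} → T b → 𝟙 b ≡ 1
    𝟙-T {true} _ = refl

  -- The first t points of a longer monotone sequence are again monotone in every coordinate;
  -- transposed into rows they form a member of the list with all its cells in `A`. This is the
  -- event behind the union bound.
  HasMonotone-covered : ∀ {n k} (A : Array n (suc k)) {t h} → t ≤ h → HasMonotone A h →
    1 ≤ ∑ (allVecs (suc k) (monotone n t)) (allOnes t A)
  HasMonotone-covered {n} {k} A {t} t≤h mono with find mono
  ... | s , _ , s⊆A , cols = ≤-trans (≤-reflexive (sym (allOnes≡1 t A β ones))) (term≤∑ (allOnes t A) β∈)
    where
    pos : Fin t → Pos n (suc k)
    pos i = lookup s (inject≤ i t≤h)
    row : Fin (suc k) → Vec (Fin n) t
    row j = Vec.tabulate (λ i → lookup (pos i) j)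
    β : Rows n t (suc k)
    β = Vec.tabulate row
    column : ∀ i → Vec.map (λ u → lookup u i) β ≡ pos i
    column i = begin
      Vec.map (λ u → lookup u i) β                     ≡⟨ tabulate-∘ (λ u → lookup u i) row ⟨
      Vec.tabulate (λ j → lookup (row j) i)            ≡⟨ tabulate-cong (λ j → lookup∘tabulate (λ i → lookup (pos i) j) i) ⟩
      Vec.tabulate (lookup (pos i))                    ≡⟨ tabulate∘lookup (pos i) ⟩
      pos i                                            ∎
      where open ≡-Reasoning
    T-lookup : ∀ {h} (s : Vec (Pos n (suc k)) h) → All (T ∘ at A) (Vec.toList s) → ∀ i → T (at A (lookup s i))
    T-lookup (x ∷ s) (p ∷ ps) zero    = p
    T-lookup (x ∷ s) (p ∷ ps) (suc i) = T-lookup s ps i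
    ones : ∀ i → T (at A (Vec.map (λ u → lookup u i) β))
    ones i = subst (T ∘ at A) (sym (column i)) (T-lookup s s⊆A (inject≤ i t≤h))
    ordered : ∀ {R : ℕ → ℕ → Set} → Transitive R → ∀ j → Linked R (List.map (λ α → toℕ (lookup α j)) (Vec.toList s)) →
      ∀ {i i′} → toℕ i < toℕ i′ → R (toℕ (lookup (row j) i)) (toℕ (lookup (row j) i′))
    ordered {R} R-trans j linked {i} {i′} i<i′
      rewrite lookup∘tabulate (λ i → lookup (pos i) j) i | lookup∘tabulate (λ i → lookup (pos i) j) i′ =
      lookup-AllPairs {R = R} (λ α → toℕ (lookup α j)) s (Linked⇒AllPairs R-trans linked) {inject≤ i t≤h} {inject≤ i′ t≤h}
        (subst (λ z → z < toℕ (inject≤ i′ t≤h)) (sym (FinP.toℕ-inject≤ i t≤h)) (subst (toℕ i <_) (sym (FinP.toℕ-inject≤ i′ t≤h)) i<i′))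
    β∈ : β ∈ allVecs (suc k) (monotone n t)
    β∈ = ∈-allVecs⁺ (suc k) β (λ j → subst (_∈ monotone n t) (sym (lookup∘tabulate row j)) (∈-monotone n t (row j)
      (directions j (All.lookup cols (∈-allFin j)))))
      where
      directions : ∀ j → StrictlyMonotone (List.map (λ α → toℕ (lookup α j)) (Vec.toList s)) →
        (∀ {i i′} → toℕ i < toℕ i′ → toℕ (lookup (row j) i) < toℕ (lookup (row j) i′)) ⊎
        (∀ {i i′} → toℕ i < toℕ i′ → toℕ (lookup (row j) i) > toℕ (lookup (row j) i′))
      directions j (inj₁ inc) = inj₁ (ordered <-trans j inc)
      directions j (inj₂ dec) = inj₂ (ordered (λ p q → <-trans q p) j dec)

  monotone-covered : ∀ {n k} (A : Array n (suc k)) {t} → 1 ≤ t → t ≤ H k A →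
    1 ≤ ∑ (allVecs (suc k) (monotone n t)) (allOnes t A)
  monotone-covered {n} {k} A {t} 1≤t t≤H with H-attained A
  ... | inj₁ H≡0        = contradiction (≤-trans 1≤t (subst (t ≤_) H≡0 t≤H)) λ ()
  ... | inj₂ (_ , mono) = HasMonotone-covered A t≤H mono

  -- The upper tail

  long : ∀ n k → ℕ → ℕ
  long n k t = ∑ (L n k) (λ A → 𝟙 (does (t ≤? H k A)))

  -- Union bound over chains. Their number contributes (2 fall n t / t!)^(k+1), and its falling
  -- factorial cancels the one paid in `transfer`, so the estimate holds for all t without loss.
  long-bound : ∀ n k t → 1 ≤ t → long (suc n) k t * (t !) ^ suc k ≤ 2 ^ suc k * (card (suc n) k * (suc n ^ k) ^ t)
  long-bound n k t 1≤t with t ≤? suc n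
  -- Here the falling factorial is 0 and cannot be cancelled, but H ≤ n makes the count 0.
  ... | no t≰n = ≤-trans (≤-reflexive (cong (_* (t !) ^ suc k) (trans
    (∑-cong (L (suc n) k) (λ A → cong 𝟙 (dec-false (t ≤? H k A) (λ t≤H → t≰n (≤-trans t≤H (H≤n A))))))
    (trans (∑-const (L (suc n) k) 0) (*-zeroʳ (card (suc n) k)))))) z≤n
  ... | yes t≤n = *-cancelˡ-≤ (f ^ m) {{>-nonZero (m^n>0 f {{>-nonZero (fall-pos (suc n) t t≤n)}} m)}} (begin
    f ^ m * (long (suc n) k t * (t !) ^ m)
      ≡⟨ *-assoc (f ^ m) (long (suc n) k t) ((t !) ^ m) ⟨
    f ^ m * long (suc n) k t * (t !) ^ m
      ≤⟨ *-monoˡ-≤ ((t !) ^ m) union ⟩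
    length (monotone (suc n) t) ^ m * X * (t !) ^ m
      ≡⟨ trans (*-assoc (length (monotone (suc n) t) ^ m) X _) (trans (cong (length (monotone (suc n) t) ^ m *_) (*-comm X _))
           (trans (sym (*-assoc (length (monotone (suc n) t) ^ m) _ X)) (cong (_* X) (sym (^-distribʳ-* m (length (monotone (suc n) t)) (t !)))))) ⟩
    (length (monotone (suc n) t) * t !) ^ m * X
      ≤⟨ *-monoˡ-≤ X (^-monoˡ-≤ m (length-monotone (suc n) t)) ⟩
    (2 * f) ^ m * X
      ≡⟨ cong (_* X) (trans (^-distribʳ-* m 2 f) (*-comm (2 ^ m) (f ^ m))) ⟩
    f ^ m * 2 ^ m * X
      ≡⟨ *-assoc (f ^ m) (2 ^ m) X ⟩
    f ^ m * (2 ^ m * X) ∎)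
    where
    open ≤-Reasoning
    m = suc k
    f = fall (suc n) t
    X = card (suc n) k * (suc n ^ k) ^ t
    βs = allVecs m (monotone (suc n) t)
    union : f ^ m * long (suc n) k t ≤ length (monotone (suc n) t) ^ m * X
    union = begin
      f ^ m * long (suc n) k t
        ≤⟨ *-monoʳ-≤ (f ^ m) (∑-mono (L (suc n) k) covered) ⟩
      f ^ m * ∑ (L (suc n) k) (λ A → ∑ βs (allOnes t A))
        ≡⟨ cong (f ^ m *_) (∑-swap (L (suc n) k) βs _) ⟩
      f ^ m * ∑ βs (λ β → ∑ (L (suc n) k) (λ A → allOnes t A β))
        ≡⟨ ∑-*ˡ βs (f ^ m) _ ⟨
      ∑ βs (λ β → f ^ m * ∑ (L (suc n) k) (λ A → allOnes t A β))
        ≤⟨ ∑-mono-∈ βs (λ {β} β∈ → ∑-L-allOnes n k t β (λ j → monotone-injective (suc n) t (∈-allVecs⁻ m β∈ j))) ⟩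
      ∑ βs (λ _ → X)
        ≡⟨ trans (∑-const βs X) (cong (_* X) (length-allVecs m (monotone (suc n) t))) ⟩
      length (monotone (suc n) t) ^ m * X ∎
      where
      covered : ∀ A → 𝟙 (does (t ≤? H k A)) ≤ ∑ βs (allOnes t A)
      covered A = 𝟙-≤ (t ≤? H k A) (monotone-covered A 1≤t)

  -- Integer roots and elementary estimates

  least : {P : ℕ → Set} → Decidable P → ∀ N → P N → ∃[ t ] P t × (∀ s → s < t → ¬ P s)
  least P? N pN with P? 0
  least P? N       pN | yes p0 = 0 , p0 , λ _ ()
  least P? zero    pN | no ¬p0 = contradiction pN ¬p0
  least {P} P? (suc N) pN | no ¬p0 with least {P ∘ suc} (P? ∘ suc) N pN
  ... | t , pt , below = suc t , pt , λ { zero _ → ¬p0 ; (suc s) (s≤s s<t) → below s s<t }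

  1≤^ : ∀ {a} e → 1 ≤ a → 1 ≤ a ^ e
  1≤^ {a} e 1≤a = m^n>0 a {{>-nonZero 1≤a}} e

  x≤x^suc : ∀ x e → x ≤ x ^ suc e
  x≤x^suc zero    e = z≤n
  x≤x^suc (suc x) e = m≤m*n (suc x) (suc x ^ e) {{m^n≢0 (suc x) e}}

  -- The rounded-up root is returned through its predecessor `s`: the upper bound uses `suc s` as
  -- the chain length, the lower bound uses `s` as the side of a box.
  ceilingRoot : ∀ k X → 1 ≤ X → ∃[ s ] X ≤ suc s ^ suc k × s ^ suc k < X
  ceilingRoot k X 1≤X with least (λ t → X ≤? t ^ suc k) X (x≤x^suc X k)
  ... | zero  , X≤0 , _     = contradiction (≤-trans 1≤X X≤0) λ ()
  ... | suc s , X≤  , below = s , X≤ , ≰⇒> (below s ≤-refl)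

  -- Bernoulli's inequality (1 - r/N)^e ≥ 1 - er/N for N = a + r, with denominators cleared.
  bernoulli : ∀ a r e → (a + r) ^ e * (a + r) ≤ a ^ e * (a + r) + e * r * (a + r) ^ e
  bernoulli a r zero    = m≤m+n (1 * (a + r)) 0
  bernoulli a r (suc e) = begin
    N * N ^ e * N                          ≡⟨ *-assoc N (N ^ e) N ⟩
    N * (N ^ e * N)                        ≤⟨ *-monoʳ-≤ N (bernoulli a r e) ⟩
    N * (a ^ e * N + e * r * N ^ e)        ≡⟨ expand a r e (a ^ e) (N ^ e) ⟩
    a * a ^ e * N + (r * a ^ e * N + e * r * (N * N ^ e))
      ≤⟨ +-monoʳ-≤ (a * a ^ e * N) (+-monoˡ-≤ (e * r * (N * N ^ e)) (*-monoˡ-≤ N (*-monoʳ-≤ r (^-monoˡ-≤ e (m≤m+n a r))))) ⟩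
    a * a ^ e * N + (r * N ^ e * N + e * r * (N * N ^ e))
      ≡⟨ cong (a * a ^ e * N +_) (collect r e N (N ^ e)) ⟩
    a * a ^ e * N + suc e * r * (N * N ^ e) ∎
    where
    open ≤-Reasoning
    N = a + r
    expand : ∀ a r e x y → (a + r) * (x * (a + r) + e * r * y) ≡ a * x * (a + r) + (r * x * (a + r) + e * r * ((a + r) * y))
    expand = solve-∀
    collect : ∀ r e N y → r * y * N + e * r * (N * y) ≡ (r + e * r) * (N * y)
    collect = solve-∀

  ^-halving : ∀ a r e → 1 ≤ a + r → 2 * (e * r) ≤ a + r → (a + r) ^ e ≤ 2 * a ^ e
  ^-halving a r e 1≤N 2er≤N = *-cancelʳ-≤ (N ^ e) (2 * a ^ e) N {{>-nonZero 1≤N}} (+-cancelʳ-≤ (N ^ e * N) _ _ (begin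
    N ^ e * N + N ^ e * N
      ≤⟨ +-mono-≤ (bernoulli a r e) (bernoulli a r e) ⟩
    a ^ e * N + e * r * N ^ e + (a ^ e * N + e * r * N ^ e)
      ≡⟨ double (a ^ e * N) (e * r) (N ^ e) ⟩
    2 * (a ^ e * N) + 2 * (e * r) * N ^ e
      ≤⟨ +-monoʳ-≤ (2 * (a ^ e * N)) (*-monoˡ-≤ (N ^ e) 2er≤N) ⟩
    2 * (a ^ e * N) + N * N ^ e
      ≡⟨ cong₂ _+_ (sym (*-assoc 2 (a ^ e) N)) (*-comm N (N ^ e)) ⟩
    2 * a ^ e * N + N ^ e * N ∎))
    where
    open ≤-Reasoning
    N = a + r
    double : ∀ x y z → x + y * z + (x + y * z) ≡ 2 * x + 2 * y * z
    double = solve-∀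

  -- This is (1 + 1/t)^t ≤ 4: the exponent is cut into two halves, each short enough for `^-halving`
  -- and so costing a factor 2.
  suc^≤4* : ∀ t → suc t ^ t ≤ 4 * t ^ t
  suc^≤4* t = begin
    suc t ^ t                        ≡⟨ cong (suc t ^_) (⌊n/2⌋+⌈n/2⌉≡n t) ⟨
    suc t ^ (a + b)                  ≡⟨ ^-distribˡ-+-* (suc t) a b ⟩
    suc t ^ a * suc t ^ b            ≤⟨ *-mono-≤ (half a (≤-trans (⌊n/2⌋≤⌈n/2⌉ t) ≤-refl)) (half b ≤-refl) ⟩
    2 * t ^ a * (2 * t ^ b)          ≡⟨ [m*n]*[o*p]≡[m*o]*[n*p] 2 (t ^ a) 2 (t ^ b) ⟩
    4 * (t ^ a * t ^ b)              ≡⟨ cong (4 *_) (^-distribˡ-+-* t a b) ⟨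
    4 * t ^ (a + b)                  ≡⟨ cong (λ z → 4 * t ^ z) (⌊n/2⌋+⌈n/2⌉≡n t) ⟩
    4 * t ^ t                        ∎
    where
    open ≤-Reasoning
    a = ⌊ t /2⌋
    b = ⌈ t /2⌉
    2b≤ : 2 * b ≤ suc t
    2b≤ = begin
      b + (b + 0)                    ≡⟨ cong (b +_) (+-identityʳ b) ⟩
      b + b                          ≤⟨ +-monoʳ-≤ b (⌊n/2⌋≤⌈n/2⌉ (suc t)) ⟩
      b + ⌈ suc t /2⌉                ≡⟨ ⌊n/2⌋+⌈n/2⌉≡n (suc t) ⟩
      suc t                          ∎
    half : ∀ e → e ≤ b → suc t ^ e ≤ 2 * t ^ e
    half e e≤b = subst (λ z → z ^ e ≤ 2 * t ^ e) (+-comm t 1) (^-halving t 1 e (m≤n+m 1 t)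
      (≤-trans (*-monoʳ-≤ 2 (≤-trans (≤-reflexive (*-identityʳ e)) e≤b)) (≤-trans 2b≤ (≤-reflexive (+-comm 1 t)))))

  -- A crude Stirling bound with 4 in place of e.
  ^self≤4^*! : ∀ t → t ^ t ≤ 4 ^ t * t !
  ^self≤4^*! zero    = ≤-refl
  ^self≤4^*! (suc t) = begin
    suc t * suc t ^ t              ≤⟨ *-monoʳ-≤ (suc t) (suc^≤4* t) ⟩
    suc t * (4 * t ^ t)            ≤⟨ *-monoʳ-≤ (suc t) (*-monoʳ-≤ 4 (^self≤4^*! t)) ⟩
    suc t * (4 * (4 ^ t * t !))    ≡⟨ rearrange (suc t) (4 ^ t) (t !) ⟩
    4 * 4 ^ t * (suc t * t !)      ∎
    where
    open ≤-Reasoning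
    rearrange : ∀ s x y → s * (4 * (x * y)) ≡ 4 * x * (s * y)
    rearrange = solve-∀

  n<2^n : ∀ n → n < 2 ^ n
  n<2^n zero    = s≤s z≤n
  n<2^n (suc n) = +-mono-≤ (1≤^ n (s≤s z≤n)) (≤-trans (n<2^n n) (m≤m+n _ 0))

  ^-swap : ∀ a b c → (a ^ b) ^ c ≡ (a ^ c) ^ b
  ^-swap a b c = trans (^-*-assoc a b c) (trans (cong (a ^_) (*-comm b c)) (sym (^-*-assoc a c b)))

  -- The 8 is 4 · 2: the 4 pays for t! ≥ (t/4)^t, and the 2 remains as the decay 2^(-(k+1)t).
  long-decay : ∀ n k t → 1 ≤ t → 8 ^ suc k * suc n ^ k ≤ t ^ suc k →
    (2 ^ suc k) ^ t * long (suc n) k t ≤ 2 ^ suc k * card (suc n) k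
  long-decay n k t 1≤t root = *-cancelˡ-≤ ((4 ^ m * X) ^ t)
    {{>-nonZero (1≤^ t (*-mono-≤ {1} {_} {1} (1≤^ m (s≤s z≤n)) (1≤^ k (s≤s z≤n))))}} (begin
    (4 ^ m * X) ^ t * ((2 ^ m) ^ t * #)
      ≡⟨ *-assoc ((4 ^ m * X) ^ t) ((2 ^ m) ^ t) # ⟨
    (4 ^ m * X) ^ t * (2 ^ m) ^ t * #
      ≡⟨ cong (_* #) (trans (sym (^-distribʳ-* t (4 ^ m * X) (2 ^ m))) (cong (_^ t) 8-split)) ⟩
    (8 ^ m * X) ^ t * #
      ≤⟨ *-monoˡ-≤ # (^-monoˡ-≤ t root) ⟩
    (t ^ m) ^ t * #
      ≡⟨ cong (_* #) (^-swap t m t) ⟩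
    (t ^ t) ^ m * #
      ≤⟨ *-monoˡ-≤ # (^-monoˡ-≤ m (^self≤4^*! t)) ⟩
    (4 ^ t * t !) ^ m * #
      ≡⟨ trans (cong (_* #) (^-distribʳ-* m (4 ^ t) (t !))) (trans (*-assoc ((4 ^ t) ^ m) _ #) (cong ((4 ^ t) ^ m *_) (*-comm _ #))) ⟩
    (4 ^ t) ^ m * (# * (t !) ^ m)
      ≤⟨ *-monoʳ-≤ ((4 ^ t) ^ m) (long-bound n k t 1≤t) ⟩
    (4 ^ t) ^ m * (2 ^ m * (card (suc n) k * X ^ t))
      ≡⟨ rearrange ((4 ^ t) ^ m) (2 ^ m) (card (suc n) k) (X ^ t) ⟩
    (4 ^ t) ^ m * X ^ t * (2 ^ m * card (suc n) k)
      ≡⟨ cong (_* (2 ^ m * card (suc n) k)) (trans (cong (_* X ^ t) (^-swap 4 t m)) (sym (^-distribʳ-* t (4 ^ m) X))) ⟩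
    (4 ^ m * X) ^ t * (2 ^ m * card (suc n) k) ∎)
    where
    open ≤-Reasoning
    m = suc k
    X = suc n ^ k
    # = long (suc n) k t
    rearrange : ∀ a b c d → a * (b * (c * d)) ≡ a * d * (b * c)
    rearrange = solve-∀
    8-split : 4 ^ m * X * 2 ^ m ≡ 8 ^ m * X
    8-split = trans (*-assoc (4 ^ m) X (2 ^ m)) (trans (cong (4 ^ m *_) (*-comm X (2 ^ m)))
      (trans (sym (*-assoc (4 ^ m) (2 ^ m) X)) (cong (_* X) (sym (^-distribʳ-* m 4 2)))))

  -- Since t! ≥ (t/4)^t, the expected number of monotone sequences of length t ≥ 8 n^(k/m), m = k + 1, is at
  -- most 2^m 2^(-tm), which beats the trivial bound H ≤ n; rounding t up to an integer turns 8 into at most 16.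
  upper-tail : ∀ k → 1 ≤ k → ∀ n → ∃[ t ] 1 ≤ t × t ^ suc k ≤ 16 ^ suc k * suc n ^ k
    × suc n * long (suc n) k t ≤ 2 ^ suc k * card (suc n) k
  upper-tail k 1≤k n with ceilingRoot k (8 ^ suc k * suc n ^ k) (*-mono-≤ {1} {_} {1} (1≤^ (suc k) (s≤s z≤n)) (1≤^ k (s≤s z≤n)))
  ... | s , root , below = suc s , s≤s z≤n , small s below , (begin
    suc n * long (suc n) k (suc s)
      ≤⟨ *-monoˡ-≤ (long (suc n) k (suc s)) n≤ ⟩
    (2 ^ m) ^ suc s * long (suc n) k (suc s)
      ≤⟨ long-decay n k (suc s) (s≤s z≤n) root ⟩
    2 ^ m * card (suc n) k ∎)
    where
    open ≤-Reasoning
    m = suc k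
    X = 8 ^ m * suc n ^ k
    n≤X : suc n ≤ X
    n≤X = ≤-trans (≤-trans (≤-reflexive (sym (*-identityʳ (suc n)))) (^-monoʳ-≤ (suc n) 1≤k))
      (m≤n*m (suc n ^ k) (8 ^ m) {{m^n≢0 8 m}})
    n≤ : suc n ≤ (2 ^ m) ^ suc s
    n≤ = begin
      suc n             ≤⟨ n≤X ⟩
      X                 ≤⟨ root ⟩
      suc s ^ m         ≤⟨ ^-monoˡ-≤ m (<⇒≤ (n<2^n (suc s))) ⟩
      (2 ^ suc s) ^ m   ≡⟨ ^-swap 2 (suc s) m ⟩
      (2 ^ m) ^ suc s   ∎
    small : ∀ s → s ^ m < X → suc s ^ m ≤ 16 ^ m * suc n ^ k
    small zero    _  = ≤-trans (≤-reflexive (^-zeroˡ m)) (*-mono-≤ {1} {_} {1} (1≤^ m (s≤s z≤n)) (1≤^ k (s≤s z≤n)))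
    small (suc s) s< = begin
      suc (suc s) ^ m              ≤⟨ ^-monoˡ-≤ m (s≤s (≤-trans (m≤n+m (suc s) s) (≤-reflexive (cong (s +_) (sym (+-identityʳ (suc s))))))) ⟩
      (2 * suc s) ^ m              ≡⟨ ^-distribʳ-* m 2 (suc s) ⟩
      2 ^ m * suc s ^ m            ≤⟨ *-monoʳ-≤ (2 ^ m) (<⇒≤ s<) ⟩
      2 ^ m * (8 ^ m * suc n ^ k)  ≡⟨ *-assoc (2 ^ m) (8 ^ m) _ ⟨
      2 ^ m * 8 ^ m * suc n ^ k    ≡⟨ cong (_* suc n ^ k) (^-distribʳ-* m 2 8) ⟨
      16 ^ m * suc n ^ k           ∎

  -- Independence of the entries of a uniform tuple

  *-∑-const : {A : Set} (c d : ℕ) (xs : List A) (f : A → ℕ) → (∀ x → c * f x ≡ d) → c * ∑ xs f ≡ length xs * d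
  *-∑-const c d xs f cf≡d = trans (sym (∑-*ˡ xs c f)) (trans (∑-cong xs cf≡d) (∑-const xs d))

  -- The factor n on the left stands for the exponent r - 1 on the right.
  ∑-entry : ∀ {n} r (a : Fin r) (g : Fin n → ℕ) →
    n * ∑ (allVecs r (allFin n)) (λ v → g (lookup v a)) ≡ n ^ r * ∑ (allFin n) g
  ∑-entry {n} (suc r) zero g = begin
    n * ∑ (allVecs (suc r) (allFin n)) (λ v → g (lookup v zero))
      ≡⟨ cong (n *_) (∑-allVecs-suc r (allFin n) _) ⟩
    n * ∑ (allFin n) (λ x → ∑ (allVecs r (allFin n)) (λ _ → g x))
      ≡⟨ cong (n *_) (trans (∑-cong (allFin n) (λ x → trans (∑-const (allVecs r (allFin n)) (g x)) (cong (_* g x) (length-allPos n r))))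
           (∑-*ˡ (allFin n) (n ^ r) g)) ⟩
    n * (n ^ r * ∑ (allFin n) g)
      ≡⟨ *-assoc n (n ^ r) _ ⟨
    n ^ suc r * ∑ (allFin n) g ∎
    where open ≡-Reasoning
  ∑-entry {n} (suc r) (suc a) g = begin
    n * ∑ (allVecs (suc r) (allFin n)) (λ v → g (lookup v (suc a)))
      ≡⟨ cong (n *_) (∑-allVecs-suc r (allFin n) _) ⟩
    n * ∑ (allFin n) (λ _ → ∑ (allVecs r (allFin n)) (λ v → g (lookup v a)))
      ≡⟨ *-∑-const n _ (allFin n) _ (λ _ → ∑-entry r a g) ⟩
    length (allFin n) * (n ^ r * ∑ (allFin n) g)
      ≡⟨ cong (_* (n ^ r * ∑ (allFin n) g)) (length-allFin n) ⟩
    n * (n ^ r * ∑ (allFin n) g)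
      ≡⟨ *-assoc n (n ^ r) _ ⟨
    n ^ suc r * ∑ (allFin n) g ∎
    where open ≡-Reasoning

  ∑-entries : ∀ {n} r (a b : Fin r) → a ≢ b → (g h : Fin n → ℕ) →
    n * n * ∑ (allVecs r (allFin n)) (λ v → g (lookup v a) * h (lookup v b)) ≡ n ^ r * (∑ (allFin n) g * ∑ (allFin n) h)
  ∑-entries {n} (suc r) zero zero a≢b g h = contradiction refl a≢b
  ∑-entries {n} (suc r) zero (suc b) a≢b g h = begin
    n * n * ∑ (allVecs (suc r) (allFin n)) (λ v → g (lookup v zero) * h (lookup v (suc b)))
      ≡⟨ cong (n * n *_) (∑-allVecs-suc r (allFin n) _) ⟩
    n * n * ∑ (allFin n) (λ x → ∑ (allVecs r (allFin n)) (λ v → g x * h (lookup v b)))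
      ≡⟨ cong (n * n *_) (∑-*-∑ (allFin n) (allVecs r (allFin n)) g (λ v → h (lookup v b))) ⟩
    n * n * (G * ∑ (allVecs r (allFin n)) (λ v → h (lookup v b)))
      ≡⟨ rearrange n G _ ⟩
    n * G * (n * ∑ (allVecs r (allFin n)) (λ v → h (lookup v b)))
      ≡⟨ cong (n * G *_) (∑-entry r b h) ⟩
    n * G * (n ^ r * ∑ (allFin n) h)
      ≡⟨ rearrange′ n G (n ^ r) _ ⟩
    n ^ suc r * (G * ∑ (allFin n) h) ∎
    where
    open ≡-Reasoning
    G = ∑ (allFin n) g
    rearrange : ∀ n x y → n * n * (x * y) ≡ n * x * (n * y)
    rearrange = solve-∀
    rearrange′ : ∀ n x y z → n * x * (y * z) ≡ n * y * (x * z)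
    rearrange′ = solve-∀
  ∑-entries {n} (suc r) (suc a) zero a≢b g h = begin
    n * n * ∑ (allVecs (suc r) (allFin n)) (λ v → g (lookup v (suc a)) * h (lookup v zero))
      ≡⟨ cong (n * n *_) (∑-cong (allVecs (suc r) (allFin n)) (λ v → *-comm (g (lookup v (suc a))) _)) ⟩
    n * n * ∑ (allVecs (suc r) (allFin n)) (λ v → h (lookup v zero) * g (lookup v (suc a)))
      ≡⟨ ∑-entries (suc r) zero (suc a) (λ ()) h g ⟩
    n ^ suc r * (∑ (allFin n) h * ∑ (allFin n) g)
      ≡⟨ cong (n ^ suc r *_) (*-comm (∑ (allFin n) h) _) ⟩
    n ^ suc r * (∑ (allFin n) g * ∑ (allFin n) h) ∎
    where open ≡-Reasoning
  ∑-entries {n} (suc r) (suc a) (suc b) a≢b g h = begin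
    n * n * ∑ (allVecs (suc r) (allFin n)) (λ v → g (lookup v (suc a)) * h (lookup v (suc b)))
      ≡⟨ cong (n * n *_) (∑-allVecs-suc r (allFin n) _) ⟩
    n * n * ∑ (allFin n) (λ _ → ∑ (allVecs r (allFin n)) (λ v → g (lookup v a) * h (lookup v b)))
      ≡⟨ *-∑-const (n * n) _ (allFin n) _ (λ _ → ∑-entries r a b (a≢b ∘ cong suc) g h) ⟩
    length (allFin n) * (n ^ r * (∑ (allFin n) g * ∑ (allFin n) h))
      ≡⟨ cong (_* (n ^ r * (∑ (allFin n) g * ∑ (allFin n) h))) (length-allFin n) ⟩
    n * (n ^ r * (∑ (allFin n) g * ∑ (allFin n) h))
      ≡⟨ *-assoc n (n ^ r) _ ⟨
    n ^ suc r * (∑ (allFin n) g * ∑ (allFin n) h) ∎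
    where open ≡-Reasoning

  -- Random boxes

  point : ∀ {n ℓ m} → Rows n ℓ m → Pos ℓ m → Pos n m
  point = Vec.zipWith lookup

  hits : ∀ {n ℓ m} → Array n m → Pos ℓ m → Rows n ℓ m → ℕ
  hits A ι s = 𝟙 (at A (point s ι))

  points : ∀ {n ℓ m} → Array n m → Rows n ℓ m → ℕ
  points {ℓ = ℓ} {m} A s = ∑ (allPos ℓ m) (λ ι → hits A ι s)

  -- Truncated subtraction makes this the indicator of having no point. Repeated entries in a side
  -- may count a point several times, which leaves the indicator unchanged.
  empty : ∀ {n ℓ m} → Array n m → Rows n ℓ m → ℕ
  empty A s = 1 ∸ points A s

  -- The sides of a random box are independent uniform tuples with repetitions allowed, so that
  -- all entries are independent.
  boxes : ∀ n ℓ m → List (Rows n ℓ m)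
  boxes n ℓ m = allVecs m (allVecs ℓ (allFin n))

  length-boxes : ∀ n ℓ m → length (boxes n ℓ m) ≡ (n ^ ℓ) ^ m
  length-boxes n ℓ m = trans (length-allVecs m (allVecs ℓ (allFin n))) (cong (_^ m) (length-allPos n ℓ))

  ∑-boxes-suc : ∀ n ℓ m (f : Rows n ℓ (suc m) → ℕ) →
    ∑ (boxes n ℓ (suc m)) f ≡ ∑ (allVecs ℓ (allFin n)) (λ v → ∑ (boxes n ℓ m) (λ s → f (v ∷ s)))
  ∑-boxes-suc n ℓ m f = ∑-allVecs-suc m (allVecs ℓ (allFin n)) f

  first-line : ∀ {n m} (A : Array n (suc m)) → Lines A → Fin n → ∀ α → ∑ (allFin n) (λ x → 𝟙 (at A (x ∷ α))) ≡ 1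
  first-line A lines x₀ α = trans (sym (lineCount-∑ A zero (x₀ ∷ α))) (lines zero (x₀ ∷ α))

  -- With the other sides fixed, the entry in the first coordinate runs along a line of `A`, which
  -- carries a single 1; so a cell of a random box is hit with probability 1/n.
  ∑-hits : ∀ {n ℓ k} (A : Array (suc n) (suc k)) → Lines A → (ι : Pos ℓ (suc k)) →
    suc n * ∑ (boxes (suc n) ℓ (suc k)) (hits A ι) ≡ (suc n ^ ℓ) ^ suc k
  ∑-hits {n} {ℓ} {k} A lines (a ∷ ι) = begin
    suc n * ∑ (boxes (suc n) ℓ (suc k)) (hits A (a ∷ ι))
      ≡⟨ cong (suc n *_) (trans (∑-boxes-suc (suc n) ℓ k _) (∑-swap (allVecs ℓ (allFin (suc n))) (boxes (suc n) ℓ k) _)) ⟩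
    suc n * ∑ (boxes (suc n) ℓ k) (λ s → ∑ (allVecs ℓ (allFin (suc n))) (λ v → 𝟙 (at A (lookup v a ∷ point s ι))))
      ≡⟨ *-∑-const (suc n) (suc n ^ ℓ) (boxes (suc n) ℓ k) _ column ⟩
    length (boxes (suc n) ℓ k) * suc n ^ ℓ
      ≡⟨ cong (_* suc n ^ ℓ) (length-boxes (suc n) ℓ k) ⟩
    (suc n ^ ℓ) ^ k * suc n ^ ℓ
      ≡⟨ *-comm ((suc n ^ ℓ) ^ k) _ ⟩
    (suc n ^ ℓ) ^ suc k ∎
    where
    open ≡-Reasoning
    column : ∀ s → suc n * ∑ (allVecs ℓ (allFin (suc n))) (λ v → 𝟙 (at A (lookup v a ∷ point s ι))) ≡ suc n ^ ℓ
    column s = trans (∑-entry ℓ a (λ x → 𝟙 (at A (x ∷ point s ι))))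
      (trans (cong (suc n ^ ℓ *_) (first-line A lines zero (point s ι))) (*-identityʳ _))

  -- Two distinct cells of a random box are hit independently: in a coordinate where they differ,
  -- the two entries can be resampled separately along two lines.
  ∑-hits-pair : ∀ {n ℓ} m (A : Array (suc n) m) → Lines A → (ι κ : Pos ℓ m) → ι ≢ κ →
    suc n * suc n * ∑ (boxes (suc n) ℓ m) (λ s → hits A ι s * hits A κ s) ≡ (suc n ^ ℓ) ^ m
  ∑-hits-pair zero A lines [] [] ι≢κ = contradiction refl ι≢κ
  ∑-hits-pair {n} {ℓ} (suc m) A lines (a ∷ ι) (b ∷ κ) ι≢κ with a FinP.≟ b
  ... | no a≢b = begin
    suc n * suc n * ∑ (boxes (suc n) ℓ (suc m)) (λ s → hits A (a ∷ ι) s * hits A (b ∷ κ) s)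
      ≡⟨ cong (suc n * suc n *_) (trans (∑-boxes-suc (suc n) ℓ m _) (∑-swap (allVecs ℓ (allFin (suc n))) (boxes (suc n) ℓ m) _)) ⟩
    suc n * suc n * ∑ (boxes (suc n) ℓ m) (λ s → ∑ (allVecs ℓ (allFin (suc n))) (λ v → g s (lookup v a) * h s (lookup v b)))
      ≡⟨ *-∑-const (suc n * suc n) (suc n ^ ℓ) (boxes (suc n) ℓ m) _ columns ⟩
    length (boxes (suc n) ℓ m) * suc n ^ ℓ
      ≡⟨ cong (_* suc n ^ ℓ) (length-boxes (suc n) ℓ m) ⟩
    (suc n ^ ℓ) ^ m * suc n ^ ℓ
      ≡⟨ *-comm ((suc n ^ ℓ) ^ m) _ ⟩
    (suc n ^ ℓ) ^ suc m ∎
    where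
    open ≡-Reasoning
    g h : Rows (suc n) ℓ m → Fin (suc n) → ℕ
    g s x = 𝟙 (at A (x ∷ point s ι))
    h s x = 𝟙 (at A (x ∷ point s κ))
    columns : ∀ s → suc n * suc n * ∑ (allVecs ℓ (allFin (suc n))) (λ v → g s (lookup v a) * h s (lookup v b)) ≡ suc n ^ ℓ
    columns s = trans (∑-entries ℓ a b a≢b (g s) (h s))
      (trans (cong (suc n ^ ℓ *_) (cong₂ _*_ (first-line A lines zero (point s ι)) (first-line A lines zero (point s κ)))) (*-identityʳ _))
  -- Both cells lie in the same slice of `A`, whose lines again carry one 1 each, and they differ in
  -- a later coordinate.
  ... | yes refl = begin
    suc n * suc n * ∑ (boxes (suc n) ℓ (suc m)) (λ s → hits A (a ∷ ι) s * hits A (a ∷ κ) s)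
      ≡⟨ cong (suc n * suc n *_) (∑-boxes-suc (suc n) ℓ m _) ⟩
    suc n * suc n * ∑ (allVecs ℓ (allFin (suc n))) (λ v → ∑ (boxes (suc n) ℓ m) (λ s → hits (lookup A (lookup v a)) ι s * hits (lookup A (lookup v a)) κ s))
      ≡⟨ *-∑-const (suc n * suc n) ((suc n ^ ℓ) ^ m) (allVecs ℓ (allFin (suc n))) _
           (λ v → ∑-hits-pair m (lookup A (lookup v a)) (λ j α → lines (suc j) (lookup v a ∷ α)) ι κ (ι≢κ ∘ cong (a ∷_))) ⟩
    length (allVecs ℓ (allFin (suc n))) * (suc n ^ ℓ) ^ m
      ≡⟨ cong (_* (suc n ^ ℓ) ^ m) (length-allPos (suc n) ℓ) ⟩
    (suc n ^ ℓ) ^ suc m ∎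
    where open ≡-Reasoning

  ∑-points : ∀ {n ℓ k} (A : Array (suc n) (suc k)) → Lines A →
    suc n * ∑ (boxes (suc n) ℓ (suc k)) (points A) ≡ ℓ ^ suc k * (suc n ^ ℓ) ^ suc k
  ∑-points {n} {ℓ} {k} A lines = begin
    suc n * ∑ (boxes (suc n) ℓ (suc k)) (points A)
      ≡⟨ cong (suc n *_) (∑-swap (boxes (suc n) ℓ (suc k)) (allPos ℓ (suc k)) (λ s ι → hits A ι s)) ⟩
    suc n * ∑ (allPos ℓ (suc k)) (λ ι → ∑ (boxes (suc n) ℓ (suc k)) (hits A ι))
      ≡⟨ *-∑-const (suc n) ((suc n ^ ℓ) ^ suc k) (allPos ℓ (suc k)) _ (∑-hits A lines) ⟩
    length (allPos ℓ (suc k)) * (suc n ^ ℓ) ^ suc k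
      ≡⟨ cong (_* (suc n ^ ℓ) ^ suc k) (length-allPos ℓ (suc k)) ⟩
    ℓ ^ suc k * (suc n ^ ℓ) ^ suc k ∎
    where open ≡-Reasoning

  𝟙² : ∀ b → 𝟙 b * 𝟙 b ≡ 𝟙 b
  𝟙² true  = refl
  𝟙² false = refl

  -- With μ = ℓ^(k+1)/n this is E[Y²] ≤ μ + μ²: equal cells contribute μ, and the pairs of distinct
  -- cells at most μ² by independence.
  ∑-points² : ∀ {n ℓ k} (A : Array (suc n) (suc k)) → Lines A →
    suc n * suc n * ∑ (boxes (suc n) ℓ (suc k)) (λ s → points A s * points A s)
    ≤ ℓ ^ suc k * ((suc n + ℓ ^ suc k) * (suc n ^ ℓ) ^ suc k)
  ∑-points² {n} {ℓ} {k} A lines = begin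
    suc n * suc n * ∑ B (λ s → points A s * points A s)
      ≡⟨ cong (suc n * suc n *_) (∑-cong B (λ s → sym (∑-*-∑ I I _ _))) ⟩
    suc n * suc n * ∑ B (λ s → ∑ I (λ ι → ∑ I (λ κ → hits A ι s * hits A κ s)))
      ≡⟨ cong (suc n * suc n *_) (trans (∑-swap B I _) (∑-cong I (λ ι → ∑-swap B I _))) ⟩
    suc n * suc n * ∑ I (λ ι → ∑ I (λ κ → ∑ B (λ s → hits A ι s * hits A κ s)))
      ≡⟨ trans (sym (∑-*ˡ I (suc n * suc n) _)) (∑-cong I (λ ι → sym (∑-*ˡ I (suc n * suc n) _))) ⟩
    ∑ I (λ ι → ∑ I (λ κ → suc n * suc n * ∑ B (λ s → hits A ι s * hits A κ s)))
      ≤⟨ ∑-mono I (λ ι → ∑-mono I (pair ι)) ⟩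
    ∑ I (λ ι → ∑ I (λ κ → 𝟙 (does (κ ≟ᵖ ι)) * (suc n * N) + N))
      ≤⟨ ∑-mono I row ⟩
    ∑ I (λ ι → (suc n + ℓ ^ suc k) * N)
      ≡⟨ trans (∑-const I _) (cong (_* ((suc n + ℓ ^ suc k) * N)) (length-allPos ℓ (suc k))) ⟩
    ℓ ^ suc k * ((suc n + ℓ ^ suc k) * N) ∎
    where
    open ≤-Reasoning
    B = boxes (suc n) ℓ (suc k)
    I = allPos ℓ (suc k)
    N = (suc n ^ ℓ) ^ suc k
    _≟ᵖ_ : (ι κ : Pos ℓ (suc k)) → Dec (ι ≡ κ)
    _≟ᵖ_ = ≡-dec FinP._≟_
    pair : ∀ ι κ → suc n * suc n * ∑ B (λ s → hits A ι s * hits A κ s) ≤ 𝟙 (does (κ ≟ᵖ ι)) * (suc n * N) + N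
    pair ι κ with κ ≟ᵖ ι
    ... | no κ≢ι  = ≤-reflexive (∑-hits-pair (suc k) A lines ι κ (κ≢ι ∘ sym))
    ... | yes refl = begin
      suc n * suc n * ∑ B (λ s → hits A ι s * hits A ι s)
        ≡⟨ cong (suc n * suc n *_) (∑-cong B (λ s → 𝟙² (at A (point s ι)))) ⟩
      suc n * suc n * ∑ B (hits A ι)
        ≡⟨ trans (*-assoc (suc n) (suc n) _) (cong (suc n *_) (∑-hits A lines ι)) ⟩
      suc n * N
        ≤⟨ ≤-trans (m≤m+n (suc n * N) N) (≤-reflexive (cong (_+ N) (sym (+-identityʳ (suc n * N))))) ⟩
      1 * (suc n * N) + N ∎
    row : ∀ ι → ∑ I (λ κ → 𝟙 (does (κ ≟ᵖ ι)) * (suc n * N) + N) ≤ (suc n + ℓ ^ suc k) * N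
    row ι = begin
      ∑ I (λ κ → 𝟙 (does (κ ≟ᵖ ι)) * (suc n * N) + N)
        ≡⟨ trans (∑-+ I _ _) (cong₂ _+_ (∑-*ʳ I (suc n * N) _) (trans (∑-const I N) (cong (_* N) (length-allPos ℓ (suc k))))) ⟩
      ∑ I (λ κ → 𝟙 (does (κ ≟ᵖ ι))) * (suc n * N) + ℓ ^ suc k * N
        ≤⟨ +-monoˡ-≤ (ℓ ^ suc k * N) (*-monoˡ-≤ (suc n * N) (∑-≟-unique _≟ᵖ_ ι (allVecs-unique (suc k) (UniqueP.allFin⁺ ℓ)))) ⟩
      1 * (suc n * N) + ℓ ^ suc k * N
        ≡⟨ trans (cong (_+ ℓ ^ suc k * N) (+-identityʳ _)) (sym (*-distribʳ-+ N (suc n) (ℓ ^ suc k))) ⟩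
      (suc n + ℓ ^ suc k) * N ∎

  -- Bonferroni: 1[Y ≥ 1] ≥ Y − Y(Y−1)/2.
  bonferroni : ∀ y → 2 * (1 ∸ y) + 3 * y ≤ 2 + y * y
  bonferroni 0                   = ≤-refl
  bonferroni 1                   = ≤-refl
  bonferroni 2                   = ≤-refl
  bonferroni (suc (suc (suc y))) = ≤-trans (*-monoˡ-≤ (3 + y) (m≤m+n 3 y)) (m≤n+m _ 2)

  -- With μ = ℓ^(k+1)/n, `bonferroni` gives emptiness probability at most 1 - 3μ/2 + (μ + μ²)/2,
  -- which is at most 1 - μ/2 because μ ≤ 1. The other size hypothesis says μ ≥ 2^(-(k+1)), so the
  -- bound is 1 - 2^(-(k+2)).
  ∑-empty : ∀ {n ℓ k} (A : Array (suc n) (suc k)) → Lines A → ℓ ^ suc k ≤ suc n → suc n ≤ 2 ^ suc k * ℓ ^ suc k →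
    let N = (suc n ^ ℓ) ^ suc k in 2 ^ suc (suc k) * ∑ (boxes (suc n) ℓ (suc k)) (empty A) + N ≤ 2 ^ suc (suc k) * N
  ∑-empty {n} {ℓ} {k} A lines P≤n n≤cP = *-cancelˡ-≤ n′ (begin
    n′ * (2 * c * E + N)
      ≡⟨ expand n′ c E N ⟩
    c * (2 * n′ * E) + n′ * N
      ≤⟨ +-monoʳ-≤ (c * (2 * n′ * E)) (*-monoˡ-≤ N n≤cP) ⟩
    c * (2 * n′ * E) + c * P * N
      ≡⟨ trans (cong (c * (2 * n′ * E) +_) (*-assoc c P N)) (sym (*-distribˡ-+ c (2 * n′ * E) (P * N))) ⟩
    c * (2 * n′ * E + P * N)
      ≤⟨ *-monoʳ-≤ c linear ⟩
    c * (2 * n′ * N)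
      ≡⟨ collect n′ c N ⟩
    n′ * (2 * c * N) ∎)
    where
    open ≤-Reasoning
    n′ = suc n
    c = 2 ^ suc k
    P = ℓ ^ suc k
    B = boxes (suc n) ℓ (suc k)
    N = (suc n ^ ℓ) ^ suc k
    E = ∑ B (empty A)
    Y = ∑ B (points A)
    Y² = ∑ B (λ s → points A s * points A s)
    expand : ∀ n c e N → n * (2 * c * e + N) ≡ c * (2 * n * e) + n * N
    expand = solve-∀
    collect : ∀ n c N → c * (2 * n * N) ≡ n * (2 * c * N)
    collect = solve-∀
    summed : 2 * E + 3 * Y ≤ N * 2 + Y²
    summed = begin
      2 * E + 3 * Y
        ≡⟨ trans (∑-+ B _ _) (cong₂ _+_ (∑-*ˡ B 2 (empty A)) (∑-*ˡ B 3 (points A))) ⟨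
      ∑ B (λ s → 2 * empty A s + 3 * points A s)
        ≤⟨ ∑-mono B (λ s → bonferroni (points A s)) ⟩
      ∑ B (λ s → 2 + points A s * points A s)
        ≡⟨ trans (∑-+ B _ _) (cong (_+ Y²) (trans (∑-const B 2) (cong (_* 2) (length-boxes (suc n) ℓ (suc k))))) ⟩
      N * 2 + Y² ∎
    e₁ : ∀ n e P N → n * (2 * n * e + P * N) + 2 * (n * (P * N)) ≡ n * n * (2 * e) + 3 * n * (P * N)
    e₁ = solve-∀
    e₂ : ∀ n e y → n * n * (2 * e) + 3 * n * (n * y) ≡ n * n * (2 * e + 3 * y)
    e₂ = solve-∀
    e₃ : ∀ n N y → n * n * (N * 2 + y) ≡ n * (2 * n * N) + n * n * y
    e₃ = solve-∀
    e₄ : ∀ n P N → P * ((n + n) * N) ≡ 2 * (n * (P * N))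
    e₄ = solve-∀
    linear : 2 * n′ * E + P * N ≤ 2 * n′ * N
    linear = *-cancelˡ-≤ n′ (+-cancelʳ-≤ (2 * (n′ * (P * N))) _ _ (begin
      n′ * (2 * n′ * E + P * N) + 2 * (n′ * (P * N))
        ≡⟨ e₁ n′ E P N ⟩
      n′ * n′ * (2 * E) + 3 * n′ * (P * N)
        ≡⟨ cong (λ z → n′ * n′ * (2 * E) + 3 * n′ * z) (sym (∑-points {ℓ = ℓ} A lines)) ⟩
      n′ * n′ * (2 * E) + 3 * n′ * (n′ * Y)
        ≡⟨ e₂ n′ E Y ⟩
      n′ * n′ * (2 * E + 3 * Y)
        ≤⟨ *-monoʳ-≤ (n′ * n′) summed ⟩
      n′ * n′ * (N * 2 + Y²)
        ≡⟨ e₃ n′ N Y² ⟩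
      n′ * (2 * n′ * N) + n′ * n′ * Y²
        ≤⟨ +-monoʳ-≤ (n′ * (2 * n′ * N)) (∑-points² {ℓ = ℓ} A lines) ⟩
      n′ * (2 * n′ * N) + P * ((n′ + P) * N)
        ≤⟨ +-monoʳ-≤ (n′ * (2 * n′ * N)) (*-monoʳ-≤ P (*-monoˡ-≤ N (+-monoʳ-≤ n′ P≤n))) ⟩
      n′ * (2 * n′ * N) + P * ((n′ + n′) * N)
        ≡⟨ cong (n′ * (2 * n′ * N) +_) (e₄ n′ P N) ⟩
      n′ * (2 * n′ * N) + 2 * (n′ * (P * N)) ∎))

  allEmpty : ∀ {n ℓ m} t → Array n m → Rows n (t * ℓ) m → ℕ
  allEmpty         zero    A β = 1
  allEmpty {ℓ = ℓ} (suc t) A β = empty A (Vec.map (Vec.take ℓ) β) * allEmpty t A (Vec.map (Vec.drop ℓ) β)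

  permute-point : ∀ {n m ℓ} (σ : Perms n m) (s : Rows n ℓ m) ι → permute σ (point s ι) ≡ point (permuteRows σ s) ι
  permute-point []      []      []      = refl
  permute-point (π ∷ σ) (v ∷ s) (a ∷ ι) = cong₂ _∷_ (sym (lookup-map a (π ⟨$⟩ʳ_) v)) (permute-point σ s ι)

  empty-relabel : ∀ {n m ℓ} (σ : Perms n m) (A : Array n m) (s : Rows n ℓ m) → empty (relabel σ A) s ≡ empty A (permuteRows σ s)
  empty-relabel {m = m} {ℓ} σ A s = cong (1 ∸_) (∑-cong (allPos ℓ m) (λ ι →
    cong 𝟙 (trans (at-relabel σ A _) (cong (at A) (permute-point σ s ι)))))

  permute-take : ∀ {n m r} ℓ (σ : Perms n m) (β : Rows n (ℓ + r) m) →
    permuteRows σ (Vec.map (Vec.take ℓ) β) ≡ Vec.map (Vec.take ℓ) (permuteRows σ β)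
  permute-take ℓ []      []      = refl
  permute-take ℓ (π ∷ σ) (u ∷ β) = cong₂ _∷_ (sym (take-map (π ⟨$⟩ʳ_) ℓ u)) (permute-take ℓ σ β)

  permute-drop : ∀ {n m r} ℓ (σ : Perms n m) (β : Rows n (ℓ + r) m) →
    permuteRows σ (Vec.map (Vec.drop ℓ) β) ≡ Vec.map (Vec.drop ℓ) (permuteRows σ β)
  permute-drop ℓ []      []      = refl
  permute-drop ℓ (π ∷ σ) (u ∷ β) = cong₂ _∷_ (sym (drop-map (π ⟨$⟩ʳ_) ℓ u)) (permute-drop ℓ σ β)

  allEmpty-relabel : ∀ {n m ℓ} t (σ : Perms n m) (A : Array n m) (β : Rows n (t * ℓ) m) →
    allEmpty t (relabel σ A) β ≡ allEmpty t A (permuteRows σ β)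
  allEmpty-relabel         zero    σ A β = refl
  allEmpty-relabel {ℓ = ℓ} (suc t) σ A β = cong₂ _*_
    (trans (empty-relabel σ A _) (cong (empty A) (permute-take ℓ σ β)))
    (trans (allEmpty-relabel t σ A _) (cong (allEmpty t A) (permute-drop ℓ σ β)))

  -- Distinct blocks of ℓ entries are independent, so for fixed `A` the count of t simultaneously
  -- empty boxes is an exact power.
  ∑-allEmpty : ∀ {n m} ℓ t (A : Array n m) →
    ∑ (boxes n (t * ℓ) m) (allEmpty {ℓ = ℓ} t A) ≡ ∑ (boxes n ℓ m) (empty A) ^ t
  ∑-allEmpty {n} {m} ℓ zero    A = trans (∑-1 (boxes n 0 m)) (trans (length-boxes n 0 m) (^-zeroˡ m))
  ∑-allEmpty {n} {m} ℓ (suc t) A = begin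
    ∑ (boxes n (ℓ + t * ℓ) m) (allEmpty {ℓ = ℓ} (suc t) A)
      ≡⟨ ∑-allVecs-unzip _ (allVecs ℓ (allFin n)) (allVecs (t * ℓ) (allFin n)) (Vec.take ℓ) (Vec.drop ℓ)
           (∑-allVecs-++ ℓ (t * ℓ) (allFin n)) m (λ s γ → empty A s * allEmpty t A γ) ⟩
    ∑ (boxes n ℓ m) (λ s → ∑ (boxes n (t * ℓ) m) (λ γ → empty A s * allEmpty t A γ))
      ≡⟨ ∑-*-∑ (boxes n ℓ m) (boxes n (t * ℓ) m) _ _ ⟩
    ∑ (boxes n ℓ m) (empty A) * ∑ (boxes n (t * ℓ) m) (allEmpty t A)
      ≡⟨ cong (∑ (boxes n ℓ m) (empty A) *_) (∑-allEmpty ℓ t A) ⟩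
    ∑ (boxes n ℓ m) (empty A) ^ suc t ∎
    where open ≡-Reasoning

  ∑-L-allEmpty : ∀ n k ℓ t → ℓ ^ suc k ≤ suc n → suc n ≤ 2 ^ suc k * ℓ ^ suc k →
    (β : Rows (suc n) (t * ℓ) (suc k)) → (∀ j → V.Unique (lookup β j)) →
    let Q = 2 ^ suc (suc k) ; N = (suc n ^ ℓ) ^ suc k in
    Q ^ t * (fall (suc n) (t * ℓ) ^ suc k * ∑ (L (suc n) k) (λ A → allEmpty {ℓ = ℓ} t A β)) ≤ card (suc n) k * ((Q ∸ 1) * N) ^ t
  ∑-L-allEmpty n k ℓ t P≤n n≤cP β β! = begin
    Q ^ t * (fall (suc n) (t * ℓ) ^ suc k * ∑ (L (suc n) k) (λ A → allEmpty {ℓ = ℓ} t A β))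
      ≤⟨ *-monoʳ-≤ (Q ^ t) (transfer (allEmpty {ℓ = ℓ} t) (allEmpty-relabel t) β β!) ⟩
    Q ^ t * ∑ (L (suc n) k) (λ A → ∑ (boxes (suc n) (t * ℓ) (suc k)) (allEmpty {ℓ = ℓ} t A))
      ≡⟨ ∑-*ˡ (L (suc n) k) (Q ^ t) _ ⟨
    ∑ (L (suc n) k) (λ A → Q ^ t * ∑ (boxes (suc n) (t * ℓ) (suc k)) (allEmpty {ℓ = ℓ} t A))
      ≤⟨ ∑-mono-∈ (L (suc n) k) (λ {A} A∈ → each A (∈-L⁻ A∈)) ⟩
    ∑ (L (suc n) k) (λ _ → ((Q ∸ 1) * N) ^ t)
      ≡⟨ ∑-const (L (suc n) k) _ ⟩
    card (suc n) k * ((Q ∸ 1) * N) ^ t ∎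
    where
    open ≤-Reasoning
    Q = 2 ^ suc (suc k)
    N = (suc n ^ ℓ) ^ suc k
    each : ∀ A → Lines A → Q ^ t * ∑ (boxes (suc n) (t * ℓ) (suc k)) (allEmpty {ℓ = ℓ} t A) ≤ ((Q ∸ 1) * N) ^ t
    each A lines = begin
      Q ^ t * ∑ (boxes (suc n) (t * ℓ) (suc k)) (allEmpty {ℓ = ℓ} t A)
        ≡⟨ trans (cong (Q ^ t *_) (∑-allEmpty ℓ t A)) (sym (^-distribʳ-* t Q E)) ⟩
      (Q * E) ^ t
        ≤⟨ ^-monoˡ-≤ t (≤-trans (m+n≤o⇒m≤o∸n (Q * E) (∑-empty {ℓ = ℓ} A lines P≤n n≤cP))
             (≤-reflexive (sym (trans (*-distribʳ-∸ N Q 1) (cong (Q * N ∸_) (*-identityˡ N)))))) ⟩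
      ((Q ∸ 1) * N) ^ t ∎
      where E = ∑ (boxes (suc n) ℓ (suc k)) (empty A)

  -- Diagonal boxes

  ∑-positive : {A : Set} (xs : List A) (f : A → ℕ) → 1 ≤ ∑ xs f → ∃[ x ] 1 ≤ f x
  ∑-positive (x ∷ xs) f 1≤ with f x in eq
  ... | suc _ = x , subst (1 ≤_) (sym eq) (s≤s z≤n)
  ... | zero  = ∑-positive xs f 1≤

  𝟙⇒T : ∀ {b} → 1 ≤ 𝟙 b → T b
  𝟙⇒T {true} _ = _

  HasMonotone-fromList : ∀ {n m} (A : Array n m) (s : List (Pos n m)) → IsMonotoneSubseq A s → HasMonotone A (length s)
  HasMonotone-fromList A s mono =
    lose (∈-allVecs⁺ (length s) (Vec.fromList s) (λ i → ∈-allPos (lookup (Vec.fromList s) i)))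
         (subst (IsMonotoneSubseq A) (sym (toList∘fromList s)) mono)

  take-++ : ∀ {A : Set} {a b} (xs : Vec A a) (ys : Vec A b) → Vec.take a (xs Vec.++ ys) ≡ xs
  take-++ []       ys = refl
  take-++ (x ∷ xs) ys = cong (x ∷_) (take-++ xs ys)

  drop-++ : ∀ {A : Set} {a b} (xs : Vec A a) (ys : Vec A b) → Vec.drop a (xs Vec.++ ys) ≡ ys
  drop-++ []       ys = refl
  drop-++ (x ∷ xs) ys = drop-++ xs ys

  ∸^≤fall : ∀ U t r → r ≤ t → (U ∸ t) ^ r ≤ fall U r
  ∸^≤fall U t zero    r≤t = ≤-refl
  ∸^≤fall U t (suc r) r<t = *-mono-≤ (∸-monoʳ-≤ U (<⇒≤ r<t)) (∸^≤fall U t r (<⇒≤ r<t))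

  -- Each element raises the lower bound `b` by at least 1 for those after it. The empty list is
  -- separate since `b` may exceed `M`.
  sorted-bound : ∀ {M} b {is : List (Fin M)} → AllPairs Fin._<_ is → All (λ i → b ≤ toℕ i) is → is ≡ [] ⊎ length is + b ≤ M
  sorted-bound b []           _         = inj₁ refl
  sorted-bound {M} b {i ∷ is} (i<is ∷ is<) (b≤i ∷ _) with sorted-bound (suc b) is< (All.map (≤-<-trans b≤i) i<is)
  ... | inj₁ refl = inj₂ (≤-<-trans b≤i (FinP.toℕ<n i))
  ... | inj₂ le   = inj₂ (subst (_≤ M) (+-suc (length is) b) le)

  length-sorted : ∀ {M} {is : List (Fin M)} → AllPairs Fin._<_ is → length is ≤ M
  length-sorted is< with sorted-bound 0 is< (All.universal (λ _ → z≤n) _)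
  ... | inj₁ refl = z≤n
  ... | inj₂ le   = ≤-trans (≤-reflexive (sym (+-identityʳ _))) le

  module Diagonal {n ℓ M : ℕ} (Mℓ≤n : M * ℓ ≤ n) where

    -- The number iℓ + x: box i occupies the i-th interval of length ℓ in every coordinate, and the
    -- last n - Mℓ values stay uncovered.
    index : Fin M → Fin ℓ → Fin n
    index i x = inject≤ (combine i x) Mℓ≤n

    cell : Fin M → Vec (Fin n) ℓ
    cell i = Vec.tabulate (index i)

    box : ∀ m → Fin M → Rows n ℓ m
    box m i = Vec.replicate m (cell i)

    cells : ∀ {t} → Vec (Fin M) t → Vec (Fin n) (t * ℓ)
    cells is = Vec.concat (Vec.map cell is)

    index-injective : ∀ {i j x y} → index i x ≡ index j y → i ≡ j × x ≡ y
    index-injective {i} {j} {x} {y} eq = FinP.combine-injective i x j y (FinP.inject≤-injective Mℓ≤n Mℓ≤n _ _ eq)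

    index-mono : ∀ {i j} x y → i Fin.< j → toℕ (index i x) < toℕ (index j y)
    index-mono {i} {j} x y i<j = subst₂ _<_ (sym (FinP.toℕ-inject≤ (combine i x) Mℓ≤n)) (sym (FinP.toℕ-inject≤ (combine j y) Mℓ≤n))
      (FinP.combine-monoˡ-< x y i<j)

    -- Distinct boxes have disjoint sides; this is the injectivity that `transfer` asks for.
    cells-unique : ∀ {t} (is : Vec (Fin M) t) → V.Unique is → V.Unique (cells is)
    cells-unique is is! = VAllPairsP.concat⁺
      (VAllP.map⁺ (VAll.universal (λ i → VUniqueP.tabulate⁺ (proj₂ ∘ index-injective {i} {i})) is))
      (VAllPairsP.map⁺ (VAllPairs.map (λ i≢j → VAllP.tabulate⁺ (λ x → VAllP.tabulate⁺ (λ y → i≢j ∘ proj₁ ∘ index-injective))) is!))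

    allEmpty-cells : ∀ {m t} (A : Array n m) (is : Vec (Fin M) t) →
      allEmpty {ℓ = ℓ} t A (Vec.replicate m (cells is)) ≡ ∏ (λ i → empty A (box m i)) is
    allEmpty-cells         A []       = refl
    allEmpty-cells {m} {suc t} A (i ∷ is) = cong₂ _*_
      (cong (empty A) (trans (map-replicate (Vec.take ℓ) (cells (i ∷ is)) m) (cong (Vec.replicate m) (take-++ (cell i) (cells is)))))
      (trans (cong (allEmpty {ℓ = ℓ} t A) (trans (map-replicate (Vec.drop ℓ) (cells (i ∷ is)) m) (cong (Vec.replicate m) (drop-++ (cell i) (cells is)))))
        (allEmpty-cells A is))

    emptyBoxes : ∀ {m} → Array n m → ℕ
    emptyBoxes {m} A = ∑ (allFin M) (λ i → empty A (box m i))

    lookup-point : ∀ {m} i (ι : Pos ℓ m) j → lookup (point (box m i) ι) j ≡ index i (lookup ι j)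
    lookup-point {m} i ι j = trans (lookup-zipWith lookup j (box m i) ι)
      (trans (cong (λ v → lookup v (lookup ι j)) (lookup-replicate j (cell i))) (lookup∘tabulate (index i) (lookup ι j)))

    Marked : ∀ {m} → Array n m → Fin M × Pos ℓ m → Set
    Marked {m} A (i , ι) = T (at A (point (box m i) ι))

    -- Every listed box is charged either to a point picked inside it or to its own emptiness. The
    -- last component is the invariant that keeps a newly added box index below all those already
    -- picked.
    nonempty : ∀ {m} (A : Array n m) (is : List (Fin M)) → AllPairs Fin._<_ is → Σ (List (Fin M × Pos ℓ m)) λ ps →
      length is ≤ length ps + ∑ is (λ i → empty A (box m i)) × All (Marked A) ps ×
      AllPairs Fin._<_ (List.map proj₁ ps) × (∀ {i} → All (i Fin.<_) is → All (i Fin.<_) (List.map proj₁ ps))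
    nonempty A []       _ = [] , z≤n , [] , [] , λ _ → []
    nonempty {m} A (i ∷ is) (i<is ∷ is<) with nonempty A is is<
    ... | ps , len , marked , ps< , bound with points A (box m i) in eq
    ...   | zero  = ps , ≤-trans (s≤s len) (≤-reflexive (sym (+-suc (length ps) _))) , marked , ps< , λ { (_ ∷ below) → bound below }
    ...   | suc y with ∑-positive (allPos ℓ m) (λ ι → hits A ι (box m i)) (subst (1 ≤_) (sym eq) (s≤s z≤n))
    ...     | ι , 1≤hit = (i , ι) ∷ ps , s≤s (≤-trans len (+-monoʳ-≤ (length ps) (m≤n+m _ (0 ∸ y)))) , 𝟙⇒T 1≤hit ∷ marked , bound i<is ∷ ps< , λ { (i<i′ ∷ below) → i<i′ ∷ bound below }

    nonempty-boxes≤H : ∀ {k} (A : Array n (suc k)) → 1 ≤ ℓ → M ≤ H k A + emptyBoxes A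
    nonempty-boxes≤H {k} A 1≤ℓ with nonempty A (allFin M) (AllPairsP.tabulate⁺-< (λ i<j → i<j))
    ... | ps , len , marked , ps< , _ = ≤-trans (≤-trans (≤-reflexive (sym (length-allFin M))) len)
          (+-monoˡ-≤ (emptyBoxes A) (subst (_≤ H k A) (length-map locate ps) (H-max A length≤n (HasMonotone-fromList A s (in-A , columns)))))
      where
      locate : Fin M × Pos ℓ (suc k) → Pos n (suc k)
      locate (i , ι) = point (box (suc k) i) ι
      s = List.map locate ps
      in-A : All (λ α → T (at A α)) s
      in-A = AllP.map⁺ marked
      column< : ∀ j → AllPairs _<_ (List.map (λ α → toℕ (lookup α j)) s)
      column< j = AllPairsP.map⁺ (AllPairsP.map⁺ (AllPairs.map
        (λ {p} {q} i<i′ → subst₂ _<_ (cong toℕ (sym (lookup-point (proj₁ p) (proj₂ p) j)))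
          (cong toℕ (sym (lookup-point (proj₁ q) (proj₂ q) j))) (index-mono _ _ i<i′))
        (AllPairsP.map⁻ ps<)))
      columns : All (λ j → StrictlyMonotone (List.map (λ α → toℕ (lookup α j)) s)) (allFin (suc k))
      columns = All.universal (λ j → inj₁ (AllPairs⇒Linked (column< j))) (allFin (suc k))
      length≤M : length s ≤ M
      length≤M = subst (_≤ M) (trans (length-map proj₁ ps) (sym (length-map locate ps))) (length-sorted ps<)
      -- `H` maximises only over lengths up to n; `1≤ℓ` gives M ≤ Mℓ ≤ n.
      length≤n : length s ≤ n
      length≤n = ≤-trans length≤M (≤-trans (m≤m*n M ℓ {{>-nonZero 1≤ℓ}}) Mℓ≤n)

  -- The falling factorial of the number of empty boxes is at most a sum over injective t-tuples of
  -- boxes of the product of their emptiness indicators. Each tuple is bounded by `∑-L-allEmpty`,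
  -- and there are at most M^t of them.
  moment : ∀ n k ℓ M t (Mℓ≤n : M * ℓ ≤ suc n) → ℓ ^ suc k ≤ suc n → suc n ≤ 2 ^ suc k * ℓ ^ suc k →
    let Q = 2 ^ suc (suc k) ; N = (suc n ^ ℓ) ^ suc k in
    Q ^ t * fall (suc n) (t * ℓ) ^ suc k * ∑ (L (suc n) k) (λ A → fall (Diagonal.emptyBoxes {suc n} {ℓ} {M} Mℓ≤n A) t)
    ≤ M ^ t * (card (suc n) k * ((Q ∸ 1) * N) ^ t)
  moment n k ℓ M t Mℓ≤n P≤n n≤cP = begin
    c * ∑ (L (suc n) k) (λ A → fall (emptyBoxes A) t)
      ≤⟨ *-monoʳ-≤ c (∑-mono (L (suc n) k) (λ A → fall≤∑∏ t (λ i → empty A (box (suc k) i)) (λ i → m∸n≤m 1 (points A (box (suc k) i))))) ⟩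
    c * ∑ (L (suc n) k) (λ A → ∑ (injVecs M t) (∏ (λ i → empty A (box (suc k) i))))
      ≡⟨ cong (c *_) (∑-swap (L (suc n) k) (injVecs M t) _) ⟩
    c * ∑ (injVecs M t) (λ is → ∑ (L (suc n) k) (λ A → ∏ (λ i → empty A (box (suc k) i)) is))
      ≡⟨ ∑-*ˡ (injVecs M t) c _ ⟨
    ∑ (injVecs M t) (λ is → c * ∑ (L (suc n) k) (λ A → ∏ (λ i → empty A (box (suc k) i)) is))
      ≤⟨ ∑-mono-∈ (injVecs M t) (λ {is} is∈ → each is (proj₂ (∈-filter⁻ unique? {xs = allVecs t (allFin M)} is∈))) ⟩
    ∑ (injVecs M t) (λ _ → X)
      ≤⟨ ∑-filter-≤ unique? (allVecs t (allFin M)) (λ _ → X) ⟩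
    ∑ (allVecs t (allFin M)) (λ _ → X)
      ≡⟨ trans (∑-const (allVecs t (allFin M)) X) (cong (_* X) (length-allPos M t)) ⟩
    M ^ t * X ∎
    where
    open ≤-Reasoning
    open Diagonal {suc n} {ℓ} {M} Mℓ≤n
    Q = 2 ^ suc (suc k)
    N = (suc n ^ ℓ) ^ suc k
    c = Q ^ t * fall (suc n) (t * ℓ) ^ suc k
    X = card (suc n) k * ((Q ∸ 1) * N) ^ t
    each : ∀ is → V.Unique is → c * ∑ (L (suc n) k) (λ A → ∏ (λ i → empty A (box (suc k) i)) is) ≤ X
    each is is! = begin
      c * ∑ (L (suc n) k) (λ A → ∏ (λ i → empty A (box (suc k) i)) is)
        ≡⟨ cong (c *_) (∑-cong (L (suc n) k) (λ A → sym (allEmpty-cells A is))) ⟩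
      c * ∑ (L (suc n) k) (λ A → allEmpty {ℓ = ℓ} t A (Vec.replicate (suc k) (cells is)))
        ≡⟨ *-assoc (Q ^ t) _ _ ⟩
      Q ^ t * (fall (suc n) (t * ℓ) ^ suc k * ∑ (L (suc n) k) (λ A → allEmpty {ℓ = ℓ} t A (Vec.replicate (suc k) (cells is))))
        ≤⟨ ∑-L-allEmpty n k ℓ t P≤n n≤cP (Vec.replicate (suc k) (cells is))
             (λ j → subst V.Unique (sym (lookup-replicate j (cells is))) (cells-unique is is!)) ⟩
      X ∎

  -- Markov's inequality for the number of empty boxes

  𝟙-*-≤ : {P : Set} (P? : Dec P) {x y : ℕ} → (P → x ≤ y) → 𝟙 (does P?) * x ≤ y
  𝟙-*-≤ (yes p) {x} x≤y = ≤-trans (≤-reflexive (+-identityʳ x)) (x≤y p)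
  𝟙-*-≤ (no _)      x≤y = z≤n

  -- Put Q = q + 1. Losing less than M/(4Q) nonempty boxes and another t ≤ M/(4Q) leaves U - t ≥ (1
  -- - 1/(2Q))M, which exceeds the (1 - 1/Q)M allowed by the mean; this gap is the ratio 2q/(2q + 1)
  -- gained per factor of the moment.
  most-empty : ∀ q M H U t → M ≤ H + U → 4 * suc q * H < M → 4 * suc q * t ≤ M → (2 * q + 1) * M ≤ 2 * suc q * (U ∸ t)
  most-empty q M H U t M≤ H< t≤ = *-cancelˡ-≤ 2 (+-cancelʳ-≤ (2 * M) _ _ (begin
    2 * ((2 * q + 1) * M) + 2 * M
      ≡⟨ e₁ q M ⟩
    4 * suc q * M
      ≤⟨ *-monoʳ-≤ (4 * suc q) (≤-trans M≤ (+-monoʳ-≤ H (m≤n+m∸n U t))) ⟩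
    4 * suc q * (H + (t + (U ∸ t)))
      ≡⟨ e₂ q H t (U ∸ t) ⟩
    4 * suc q * H + 4 * suc q * t + 2 * (2 * suc q * (U ∸ t))
      ≤⟨ +-monoˡ-≤ (2 * (2 * suc q * (U ∸ t))) (+-mono-≤ (<⇒≤ H<) t≤) ⟩
    M + M + 2 * (2 * suc q * (U ∸ t))
      ≡⟨ e₃ M (2 * (2 * suc q * (U ∸ t))) ⟩
    2 * (2 * suc q * (U ∸ t)) + 2 * M ∎))
    where
    open ≤-Reasoning
    e₁ : ∀ q M → 2 * ((2 * q + 1) * M) + 2 * M ≡ 4 * (1 + q) * M
    e₁ = solve-∀
    e₂ : ∀ q H t u → 4 * (1 + q) * (H + (t + u)) ≡ 4 * (1 + q) * H + 4 * (1 + q) * t + 2 * (2 * (1 + q) * u)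
    e₂ = solve-∀
    e₃ : ∀ M x → M + M + x ≡ x + 2 * M
    e₃ = solve-∀

  -- Birthday estimate: the falling factorial is at least (n - r)^r, and `^-halving` with exponent
  -- rm loses at most 2. So m independent uniform rows of length r are all injective with
  -- probability at least 1/2.
  power≤2*fall : ∀ n r m → 1 ≤ m → 2 * (r * m * r) ≤ suc n → suc n ^ (r * m) ≤ 2 * fall (suc n) r ^ m
  power≤2*fall n r m 1≤m 2rmr≤n = begin
    suc n ^ (r * m)               ≡⟨ cong (_^ (r * m)) (m∸n+n≡m r≤n) ⟨
    (suc n ∸ r + r) ^ (r * m)     ≤⟨ ^-halving (suc n ∸ r) r (r * m) (≤-trans (s≤s z≤n) (≤-reflexive (sym (m∸n+n≡m r≤n))))
                                       (≤-trans 2rmr≤n (≤-reflexive (sym (m∸n+n≡m r≤n)))) ⟩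
    2 * (suc n ∸ r) ^ (r * m)     ≡⟨ cong (2 *_) (^-*-assoc (suc n ∸ r) r m) ⟨
    2 * ((suc n ∸ r) ^ r) ^ m     ≤⟨ *-monoʳ-≤ 2 (^-monoˡ-≤ m (∸^≤fall (suc n) r r ≤-refl)) ⟩
    2 * fall (suc n) r ^ m        ∎
    where
    open ≤-Reasoning
    r≤rmr : ∀ r → r ≤ r * m * r
    r≤rmr zero    = z≤n
    r≤rmr (suc r) = m≤n*m (suc r) (suc r * m) {{>-nonZero (*-mono-≤ {1} {suc r} {1} {m} (s≤s z≤n) 1≤m)}}
    r≤n : r ≤ suc n
    r≤n = ≤-trans (r≤rmr r) (≤-trans (m≤m+n _ _) 2rmr≤n)

  -- Bernoulli's inequality (1 + 1/p)^t ≥ 1 + t/p with denominators cleared.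
  geometric : ∀ p t → p ^ t * (p + t) ≤ p * suc p ^ t
  geometric p zero    = ≤-reflexive (trans (+-identityʳ (p + 0)) (trans (+-identityʳ p) (sym (*-identityʳ p))))
  geometric p (suc t) = begin
    p * p ^ t * (p + suc t)
      ≤⟨ m≤m+n _ (p ^ t * t) ⟩
    p * p ^ t * (p + suc t) + p ^ t * t
      ≡⟨ e p t (p ^ t) ⟩
    suc p * (p ^ t * (p + t))
      ≤⟨ *-monoʳ-≤ (suc p) (geometric p t) ⟩
    suc p * (p * suc p ^ t)
      ≡⟨ e′ p (suc p ^ t) ⟩
    p * (suc p * suc p ^ t) ∎
    where
    open ≤-Reasoning
    e : ∀ p t x → p * x * (p + (1 + t)) + x * t ≡ (1 + p) * (x * (p + t))
    e = solve-∀
    e′ : ∀ p y → (1 + p) * (p * y) ≡ p * ((1 + p) * y)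
    e′ = solve-∀

  short : ∀ n k → ℕ → ℕ → ℕ
  short n k c M = ∑ (L n k) (λ A → 𝟙 (does (c * H k A <? M)))

  -- On the event in question `most-empty` forces the factorial moment variable to be at least ((1 -
  -- 1/(2Q))M)^t with Q = q + 1. Dividing its mean from `moment` by this leaves (2q/(2q + 1))^t, and
  -- the leading 2 is the birthday factor of `power≤2*fall`.
  short-bound : ∀ n k ℓ M t q → 2 ^ suc (suc k) ≡ suc q → 1 ≤ ℓ → 1 ≤ M → M * ℓ ≤ suc n →
    ℓ ^ suc k ≤ suc n → suc n ≤ 2 ^ suc k * ℓ ^ suc k →
    4 * suc q * t ≤ M → 2 * (t * ℓ * suc k * (t * ℓ)) ≤ suc n →
    short (suc n) k (4 * suc q) M * (2 * q + 1) ^ t ≤ 2 * (2 * q) ^ t * card (suc n) k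
  short-bound n k ℓ M t q Q≡ 1≤ℓ 1≤M Mℓ≤n P≤n n≤cP t≤M r≤n =
    -- `Z` collects the cleared denominators: M^t, (q + 1)^t and the number N^t of t-tuples of
    -- random boxes.
    *-cancelˡ-≤ Z {{>-nonZero (*-mono-≤ {1} {_} {1} (*-mono-≤ {1} {_} {1} (1≤^ t 1≤M) (1≤^ t (s≤s z≤n))) (1≤^ t (1≤^ (suc k) (1≤^ ℓ (s≤s z≤n)))))}} (begin
    M ^ t * suc q ^ t * N ^ t * (S * (2 * q + 1) ^ t)
      ≡⟨ e₁ (M ^ t) (suc q ^ t) (N ^ t) S ((2 * q + 1) ^ t) ⟩
    N ^ t * (suc q ^ t * (S * ((2 * q + 1) ^ t * M ^ t)))
      ≤⟨ *-mono-≤ N^t≤ (*-monoʳ-≤ (suc q ^ t) (≤-trans (≤-reflexive (cong (S *_) (sym (^-distribʳ-* t (2 * q + 1) M)))) counted)) ⟩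
    2 * F * (suc q ^ t * ((2 * suc q) ^ t * Φ))
      ≡⟨ e₂ F (suc q ^ t) ((2 * suc q) ^ t) Φ ⟩
    2 * (2 * suc q) ^ t * (suc q ^ t * F * Φ)
      ≤⟨ *-monoʳ-≤ (2 * (2 * suc q) ^ t) (subst (λ Q → Q ^ t * F * Φ ≤ M ^ t * (card (suc n) k * ((Q ∸ 1) * N) ^ t)) Q≡
           (moment n k ℓ M t Mℓ≤n P≤n n≤cP)) ⟩
    2 * (2 * suc q) ^ t * (M ^ t * (card (suc n) k * (q * N) ^ t))
      ≡⟨ cong₂ (λ x y → 2 * x * (M ^ t * (card (suc n) k * y))) (^-distribʳ-* t 2 (suc q)) (^-distribʳ-* t q N) ⟩
    2 * (2 ^ t * suc q ^ t) * (M ^ t * (card (suc n) k * (q ^ t * N ^ t)))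
      ≡⟨ e₃ (2 ^ t) (suc q ^ t) (M ^ t) (card (suc n) k) (q ^ t) (N ^ t) ⟩
    M ^ t * suc q ^ t * N ^ t * (2 * (2 ^ t * q ^ t) * card (suc n) k)
      ≡⟨ cong (λ x → Z * (2 * x * card (suc n) k)) (^-distribʳ-* t 2 q) ⟨
    Z * (2 * (2 * q) ^ t * card (suc n) k) ∎)
    where
    open ≤-Reasoning
    open Diagonal {suc n} {ℓ} {M} Mℓ≤n
    N = (suc n ^ ℓ) ^ suc k
    S = short (suc n) k (4 * suc q) M
    F = fall (suc n) (t * ℓ) ^ suc k
    Φ = ∑ (L (suc n) k) (λ A → fall (emptyBoxes A) t)
    Z = M ^ t * suc q ^ t * N ^ t
    e₁ : ∀ a b c s x → a * b * c * (s * x) ≡ c * (b * (s * (x * a)))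
    e₁ = solve-∀
    e₂ : ∀ f b c x → 2 * f * (b * (c * x)) ≡ 2 * c * (b * f * x)
    e₂ = solve-∀
    e₃ : ∀ a b m c x y → 2 * (a * b) * (m * (c * (x * y))) ≡ m * b * y * (2 * (a * x) * c)
    e₃ = solve-∀
    e₄ : ∀ ℓ k t → ℓ * k * t ≡ t * ℓ * k
    e₄ = solve-∀
    N^t≤ : N ^ t ≤ 2 * F
    N^t≤ = begin
      ((suc n ^ ℓ) ^ suc k) ^ t   ≡⟨ cong (_^ t) (^-*-assoc (suc n) ℓ (suc k)) ⟩
      (suc n ^ (ℓ * suc k)) ^ t   ≡⟨ ^-*-assoc (suc n) (ℓ * suc k) t ⟩
      suc n ^ (ℓ * suc k * t)     ≡⟨ cong (suc n ^_) (e₄ ℓ (suc k) t) ⟩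
      suc n ^ (t * ℓ * suc k)     ≤⟨ power≤2*fall n (t * ℓ) (suc k) (s≤s z≤n) r≤n ⟩
      2 * F                       ∎
    counted : S * ((2 * q + 1) * M) ^ t ≤ (2 * suc q) ^ t * Φ
    counted = begin
      S * ((2 * q + 1) * M) ^ t
        ≡⟨ ∑-*ʳ (L (suc n) k) (((2 * q + 1) * M) ^ t) _ ⟨
      ∑ (L (suc n) k) (λ A → 𝟙 (does (4 * suc q * H k A <? M)) * ((2 * q + 1) * M) ^ t)
        ≤⟨ ∑-mono (L (suc n) k) (λ A → 𝟙-*-≤ (4 * suc q * H k A <? M) (each A)) ⟩
      ∑ (L (suc n) k) (λ A → (2 * suc q) ^ t * fall (emptyBoxes A) t)
        ≡⟨ ∑-*ˡ (L (suc n) k) ((2 * suc q) ^ t) _ ⟩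
      (2 * suc q) ^ t * Φ ∎
      where
      each : ∀ A → 4 * suc q * H k A < M → ((2 * q + 1) * M) ^ t ≤ (2 * suc q) ^ t * fall (emptyBoxes A) t
      each A H< = begin
        ((2 * q + 1) * M) ^ t
          ≤⟨ ^-monoˡ-≤ t (most-empty q M (H k A) (emptyBoxes A) t (nonempty-boxes≤H A 1≤ℓ) H< t≤M) ⟩
        (2 * suc q * (emptyBoxes A ∸ t)) ^ t
          ≡⟨ ^-distribʳ-* t (2 * suc q) (emptyBoxes A ∸ t) ⟩
        (2 * suc q) ^ t * (emptyBoxes A ∸ t) ^ t
          ≤⟨ *-monoʳ-≤ ((2 * suc q) ^ t) (∸^≤fall (emptyBoxes A) t t ≤-refl) ⟩
        (2 * suc q) ^ t * fall (emptyBoxes A) t ∎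

  -- The lower tail for k ≥ 2

  below : ∀ n k → ℕ → ℕ
  below n k c = ∑ (L n k) (λ A → 𝟙 (does ((c * H k A) ^ suc k <? n ^ k)))

  𝟙-mono : {P Q : Set} (P? : Dec P) (Q? : Dec Q) → (P → Q) → 𝟙 (does P?) ≤ 𝟙 (does Q?)
  𝟙-mono (no _)  _       _   = z≤n
  𝟙-mono (yes p) (yes _) _   = ≤-refl
  𝟙-mono (yes p) (no ¬q) p⇒q = contradiction (p⇒q p) ¬q

  -- The exponent 2Dp is chosen so that `geometric` gives (1 + 1/p)^(2Dp) ≥ 2D, which beats the
  -- factor 2 and leaves D.
  geometric-decay : ∀ D p x y → 1 ≤ p → x * suc p ^ (D * 2 * p) ≤ 2 * p ^ (D * 2 * p) * y → D * x ≤ y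
  geometric-decay D p x y 1≤p x≤ = *-cancelˡ-≤ (suc p ^ t) {{m^n≢0 (suc p) t}} (begin
    suc p ^ t * (D * x)          ≡⟨ e₁ (suc p ^ t) D x ⟩
    D * (x * suc p ^ t)          ≤⟨ *-monoʳ-≤ D x≤ ⟩
    D * (2 * p ^ t * y)          ≡⟨ e₂ D (p ^ t) y ⟩
    D * 2 * p ^ t * y            ≤⟨ *-monoˡ-≤ y grown ⟩
    suc p ^ t * y                ∎)
    where
    open ≤-Reasoning
    t = D * 2 * p
    e₁ : ∀ a D x → a * (D * x) ≡ D * (x * a)
    e₁ = solve-∀
    e₂ : ∀ D a y → D * (2 * a * y) ≡ D * 2 * a * y
    e₂ = solve-∀
    e₃ : ∀ p D a → p * (D * a) ≡ a * (D * p)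
    e₃ = solve-∀
    grown : D * 2 * p ^ t ≤ suc p ^ t
    grown = *-cancelˡ-≤ p {{>-nonZero 1≤p}} (begin
      p * (D * 2 * p ^ t)    ≡⟨ e₃ p (D * 2) (p ^ t) ⟩
      p ^ t * t              ≤⟨ *-monoʳ-≤ (p ^ t) (m≤n+m t p) ⟩
      p ^ t * (p + t)        ≤⟨ geometric p t ⟩
      p * suc p ^ t          ∎)

  -- The side length ℓ ≈ n^(1/(k+1)) makes the expected number of points per box constant;
  -- k ≥ 2 ensures ℓ³ ≤ n, so that boundedly many boxes meet no birthday collisions.
  -- A box is empty with probability at most 1 - 1/Q, and t is the order of the moment of the number of
  -- empty diagonal boxes: Markov's inequality then bounds the probability by 2 (p/(p+1))^t with p = 2Q - 2.
  lower-tail-≥2 : ∀ k D → 2 ≤ k → ∃[ N ] ∀ n → N ≤ n → D * below n k (8 * 2 ^ suc (suc k)) ≤ card n k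
  lower-tail-≥2 k D 2≤k = suc (R ^ m) , main
    where
    m = suc k
    Q = 2 ^ suc (suc k)
    q = pred Q
    Q≡ : Q ≡ suc q
    Q≡ = sym (suc-pred Q {{m^n≢0 2 (suc (suc k))}})
    p = 2 * q
    t = D * 2 * p
    -- The first summand yields 8Qt ≤ ℓ ≤ 2M, so M is at least 4Qt; the second yields 2t²mℓ² ≤ ℓ³ ≤
    -- n, the birthday condition for rows of length tℓ.
    R = suc (8 * Q * t + 2 * (t * t * m))
    1≤p : 1 ≤ p
    1≤p = ≤-trans (pred-mono-≤ (*-mono-≤ {2} {2} {1} (s≤s (s≤s z≤n)) (1≤^ (suc k) (s≤s z≤n)))) (m≤m+n q (q + 0))
    main : ∀ n → suc (R ^ m) ≤ n → D * below n k (8 * Q) ≤ card n k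
    main (suc n) R<n with ceilingRoot k (suc n) (s≤s z≤n)
    ... | ℓ , n≤root , root<n = ≤-trans
      (*-monoʳ-≤ D (∑-mono (L (suc n) k) (λ A → 𝟙-mono ((8 * Q * H k A) ^ m <? suc n ^ k) (4 * suc q * H k A <? M) (sparse (H k A)))))
      (geometric-decay D p _ _ 1≤p (subst (λ z → short (suc n) k (4 * suc q) M * z ^ t ≤ 2 * p ^ t * card (suc n) k) (+-comm p 1)
        (short-bound n k ℓ M t q Q≡ 1≤ℓ 1≤M (m/n*n≤m (suc n) ℓ) P≤n n≤cP t≤M r≤n)))
      where
      open ≤-Reasoning
      R≤ℓ : R ≤ ℓ
      R≤ℓ = ≮⇒≥ (λ ℓ<R → 1+n≰n (≤-trans R<n (≤-trans n≤root (^-monoˡ-≤ m ℓ<R))))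
      1≤ℓ : 1 ≤ ℓ
      1≤ℓ = ≤-trans (s≤s z≤n) R≤ℓ
      instance
        ℓ≢0 : NonZero ℓ
        ℓ≢0 = >-nonZero 1≤ℓ
      M = suc n / ℓ
      P≤n : ℓ ^ m ≤ suc n
      P≤n = <⇒≤ root<n
      n≤cP : suc n ≤ 2 ^ m * ℓ ^ m
      n≤cP = ≤-trans n≤root (≤-trans (^-monoˡ-≤ m (≤-trans (+-monoˡ-≤ ℓ 1≤ℓ) (≤-reflexive (cong (ℓ +_) (sym (+-identityʳ ℓ))))))
        (≤-reflexive (^-distribʳ-* m 2 ℓ)))
      1≤M : 1 ≤ M
      1≤M = m≥n⇒m/n>0 (≤-trans (x≤x^suc ℓ k) P≤n)
      n≤2Mℓ : suc n ≤ 2 * M * ℓ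
      n≤2Mℓ = begin
        suc n                       ≡⟨ m≡m%n+[m/n]*n (suc n) ℓ ⟩
        suc n % ℓ + M * ℓ           ≤⟨ +-monoˡ-≤ (M * ℓ) (≤-trans (<⇒≤ (m%n<n (suc n) ℓ)) (m≤n*m ℓ M {{>-nonZero 1≤M}})) ⟩
        M * ℓ + M * ℓ               ≡⟨ e M ℓ ⟩
        2 * M * ℓ                   ∎
        where
        e : ∀ M ℓ → M * ℓ + M * ℓ ≡ 2 * M * ℓ
        e = solve-∀
      ℓ³≤n : ℓ * (ℓ * ℓ) ≤ suc n
      ℓ³≤n = ≤-trans (≤-trans (≤-reflexive (cong (λ z → ℓ * (ℓ * z)) (sym (*-identityʳ ℓ)))) (^-monoʳ-≤ ℓ (s≤s 2≤k))) P≤n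
      ℓ≤2M : ℓ ≤ 2 * M
      ℓ≤2M = *-cancelʳ-≤ ℓ (2 * M) ℓ (≤-trans (≤-trans (m≤n*m (ℓ * ℓ) ℓ) ℓ³≤n) n≤2Mℓ)
      t≤M : 4 * suc q * t ≤ M
      t≤M = *-cancelˡ-≤ 2 (begin
        2 * (4 * suc q * t)         ≡⟨ cong (λ z → 2 * (4 * z * t)) Q≡ ⟨
        2 * (4 * Q * t)             ≡⟨ e Q t ⟩
        8 * Q * t                   ≤⟨ ≤-trans (m≤m+n (8 * Q * t) _) (≤-trans (n≤1+n _) R≤ℓ) ⟩
        ℓ                           ≤⟨ ℓ≤2M ⟩
        2 * M                       ∎)
        where
        e : ∀ Q t → 2 * (4 * Q * t) ≡ 8 * Q * t
        e = solve-∀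
      r≤n : 2 * (t * ℓ * m * (t * ℓ)) ≤ suc n
      r≤n = begin
        2 * (t * ℓ * m * (t * ℓ))   ≡⟨ e t ℓ m ⟩
        2 * (t * t * m) * (ℓ * ℓ)   ≤⟨ *-monoˡ-≤ (ℓ * ℓ) (≤-trans (m≤n+m _ (8 * Q * t)) (≤-trans (n≤1+n _) R≤ℓ)) ⟩
        ℓ * (ℓ * ℓ)                 ≤⟨ ℓ³≤n ⟩
        suc n                       ∎
        where
        e : ∀ t ℓ m → 2 * (t * ℓ * m * (t * ℓ)) ≡ 2 * (t * t * m) * (ℓ * ℓ)
        e = solve-∀
      -- If M ≤ 4Qh, then n ≤ 2Mℓ gives n^m ≤ (8Qh)^m ℓ^m ≤ (8Qh)^m n, and one factor n cancels. The
      -- 8 is thus 2 · 4, the 2 paying for the rounding in M.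
      sparse : ∀ h → (8 * Q * h) ^ m < suc n ^ k → 4 * suc q * h < M
      sparse h small = ≰⇒> (λ M≤ → <⇒≱ small (*-cancelˡ-≤ (suc n) (begin
        suc n ^ m                   ≤⟨ ^-monoˡ-≤ m n≤2Mℓ ⟩
        (2 * M * ℓ) ^ m             ≤⟨ ^-monoˡ-≤ m (*-monoˡ-≤ ℓ (*-monoʳ-≤ 2 M≤)) ⟩
        (2 * (4 * suc q * h) * ℓ) ^ m ≡⟨ cong (λ z → (2 * (4 * z * h) * ℓ) ^ m) Q≡ ⟨
        (2 * (4 * Q * h) * ℓ) ^ m   ≡⟨ cong (λ z → (z * ℓ) ^ m) (e Q h) ⟩
        (8 * Q * h * ℓ) ^ m         ≡⟨ ^-distribʳ-* m (8 * Q * h) ℓ ⟩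
        (8 * Q * h) ^ m * ℓ ^ m     ≤⟨ *-monoʳ-≤ ((8 * Q * h) ^ m) P≤n ⟩
        (8 * Q * h) ^ m * suc n     ≡⟨ *-comm ((8 * Q * h) ^ m) (suc n) ⟩
        suc n * (8 * Q * h) ^ m     ∎)))
        where
        e : ∀ Q h → 2 * (4 * Q * h) ≡ 8 * Q * h
        e = solve-∀

  -- The Erdős–Szekeres theorem and the case k = 1

  module ErdősSzekeres {I : Set} (pos key : I → ℕ) where

    Distinct Up Down : I → I → Set
    Distinct i j = pos i < pos j × key i ≢ key j
    Up       i j = pos i < pos j × key i < key j
    Down     i j = pos i < pos j × key i > key j

    -- `μ` is the current left-to-right minimum of the keys. A larger key goes to `rest` with `μ` as
    -- its smaller predecessor; a smaller one extends the decreasing chain and becomes the new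
    -- minimum. The predicate attached to `rest` is the one with which `erdős-szekeres` recurses,
    -- and the last component transports order relations to `rest`.
    splitMinima : (P : I → Set) (μ : I) (xs : List I) → P μ → All P xs → AllPairs Distinct (μ ∷ xs) →
      Σ (List I) λ minima → Σ (List I) λ rest →
        AllPairs Down (μ ∷ minima) × AllPairs Distinct rest × All (λ x → P x × ∃[ y ] P y × Up y x) rest ×
        length minima + length rest ≡ length xs × (∀ {R : I → Set} → All R xs → All R rest)
    splitMinima P μ []       pμ _          _ = [] , [] , [] ∷ [] , [] , [] , refl , λ _ → []
    splitMinima P μ (x ∷ xs) pμ (px ∷ pxs) (((μ<x , μ≢x) ∷ μ-xs) ∷ (x-xs ∷ xs!)) with <-cmp (key μ) (key x)
    ... | tri≈ _ μ≡x _ = contradiction μ≡x μ≢x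
    ... | tri< μ↑x _ _ with splitMinima P μ xs pμ pxs (μ-xs ∷ xs!)
    ...   | minima , rest , down , distinct , preds , len , ⊆xs =
      minima , x ∷ rest , down , ⊆xs x-xs ∷ distinct , (px , μ , pμ , μ<x , μ↑x) ∷ preds ,
      trans (+-suc (length minima) (length rest)) (cong suc len) , λ { (r ∷ rs) → r ∷ ⊆xs rs }
    splitMinima P μ (x ∷ xs) pμ (px ∷ pxs) (((μ<x , μ≢x) ∷ μ-xs) ∷ (x-xs ∷ xs!)) | tri> _ _ μ↓x with splitMinima P x xs px pxs (x-xs ∷ xs!)
    ...   | minima , rest , down@(x-down ∷ _) , distinct , preds , len , ⊆xs =
      x ∷ minima , rest , ((μ<x , μ↓x) ∷ All.map (λ { (x<y , x↓y) → <-trans μ<x x<y , <-trans x↓y μ↓x }) x-down) ∷ down ,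
      distinct , preds , cong suc len , λ { (_ ∷ rs) → ⊆xs rs }

    -- An element that is not a left-to-right minimum exceeds an earlier one, which can be prepended to
    -- an increasing chain starting there; this gives the induction on r.
    erdős-szekeres : (P : I → Set) (r s : ℕ) (xs : List I) → All P xs → AllPairs Distinct xs → r * s < length xs →
      (Σ (List I) λ ys → AllPairs Up ys × All P ys × r < length ys) ⊎ (Σ (List I) λ ys → AllPairs Down ys × s < length ys)
    erdős-szekeres P zero    s (x ∷ xs) (px ∷ _)   _   _  = inj₁ (x ∷ [] , [] ∷ [] , px ∷ [] , s≤s z≤n)
    erdős-szekeres P (suc r) s (x ∷ xs) (px ∷ pxs) xs! rs< with splitMinima P x xs px pxs xs!
    ... | minima , rest , down , distinct , preds , len , _ with s <? length (x ∷ minima)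
    ...   | yes s< = inj₂ (x ∷ minima , down , s<)
    ...   | no  s≮ with erdős-szekeres _ r s rest preds distinct
                         (+-cancelˡ-< s (r * s) (length rest) (<-≤-trans rs< (≤-trans (≤-reflexive (sym (cong suc len))) (+-monoˡ-≤ (length rest) (≮⇒≥ s≮)))))
    ...     | inj₂ decreasing = inj₂ decreasing
    ...     | inj₁ (z ∷ ys , z-ys ∷ up , (pz , y , py , y<z , y↑z) ∷ preds′ , r<) =
      inj₁ (y ∷ z ∷ ys , ((y<z , y↑z) ∷ All.map (λ { (z<w , z↑w) → <-trans y<z z<w , <-trans y↑z z↑w }) z-ys) ∷ z-ys ∷ up ,
        py ∷ pz ∷ All.map proj₁ preds′ , s≤s r<)

  pair≤∑ : {A : Set} {xs : List A} (f : A → ℕ) {x y : A} → x ≢ y → x ∈ xs → y ∈ xs → f x + f y ≤ ∑ xs f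
  pair≤∑ f x≢y (here refl) (here refl) = contradiction refl x≢y
  pair≤∑ f x≢y (here refl) (there y∈)  = +-monoʳ-≤ _ (term≤∑ f y∈)
  pair≤∑ f {x} x≢y (there x∈) (here refl) = ≤-trans (≤-reflexive (+-comm (f x) _)) (+-monoʳ-≤ _ (term≤∑ f x∈))
  pair≤∑ f x≢y (there x∈)  (there y∈)  = ≤-trans (pair≤∑ f x≢y x∈ y∈) (m≤n+m _ _)

  module Permutation {n : ℕ} (A : Array n 2) (lines : Lines A) where

    entry : ∀ i → ∃[ j ] T (at A (i ∷ j ∷ []))
    entry i with ∑-positive (allFin n) (λ j → 𝟙 (at A (i ∷ j ∷ [])))
                   (≤-reflexive (sym (trans (sym (lineCount-∑ A (suc zero) (i ∷ i ∷ []))) (lines (suc zero) (i ∷ i ∷ [])))))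
    ... | j , 1≤ = j , 𝟙⇒T 1≤

    value : Fin n → Fin n
    value i = proj₁ (entry i)

    -- Equal values would put two 1s on one line.
    value-injective : ∀ {i i′} → i ≢ i′ → toℕ (value i) ≢ toℕ (value i′)
    value-injective {i} {i′} i≢i′ eq = contradiction
      (≤-trans (≤-reflexive (cong₂ _+_ (sym (T⇒𝟙 (proj₂ (entry i)))) (sym (T⇒𝟙 (subst (λ j → T (at A (i′ ∷ j ∷ []))) (sym (FinP.toℕ-injective eq)) (proj₂ (entry i′)))))))
        (≤-trans (pair≤∑ (λ x → 𝟙 (at A (x ∷ value i ∷ []))) i≢i′ (∈-allFin i) (∈-allFin i′))
          (≤-reflexive (first-line A lines i (value i ∷ [])))))
      1+n≰n
      where
      T⇒𝟙 : ∀ {b} → T b → 𝟙 b ≡ 1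
      T⇒𝟙 {true} _ = refl

    open ErdősSzekeres toℕ (toℕ ∘ value)

    locate : Fin n → Pos n 2
    locate i = i ∷ value i ∷ []

    column : ∀ (f : Pos n 2 → ℕ) {R : ℕ → ℕ → Set} {S : Fin n → Fin n → Set} → (∀ {i j} → S i j → R (f (locate i)) (f (locate j))) →
      ∀ {is} → AllPairs S is → AllPairs R (List.map f (List.map locate is))
    column f S⇒R is! = AllPairsP.map⁺ (AllPairsP.map⁺ (AllPairs.map S⇒R is!))

    chain≤H : ∀ {is} → AllPairs Fin._<_ is → StrictlyMonotone (List.map (λ α → toℕ (lookup α (suc zero))) (List.map locate is)) →
      length is ≤ H 1 A
    chain≤H {is} is< mono = subst (_≤ H 1 A) (length-map locate is) (H-max A
      (≤-trans (≤-reflexive (length-map locate is)) (length-sorted is<))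
      (HasMonotone-fromList A (List.map locate is)
        ( AllP.map⁺ (All.universal (λ i → proj₂ (entry i)) is)
        , inj₁ (AllPairs⇒Linked (column (λ α → toℕ (lookup α zero)) (λ i<j → i<j) is<)) ∷ mono ∷ [])))

    -- Erdős-Szekeres with r = s = H would otherwise produce a monotone subsequence longer than H.
    n≤H² : n ≤ H 1 A * H 1 A
    n≤H² = ≮⇒≥ impossible
      where
      distinct : AllPairs Distinct (allFin n)
      distinct = AllPairsP.tabulate⁺-< (λ i<j → i<j , value-injective (FinP.<⇒≢ i<j))
      impossible : ¬ H 1 A * H 1 A < n
      impossible H²<n with erdős-szekeres (λ _ → ⊤) (H 1 A) (H 1 A) (allFin n) (All.universal (λ _ → tt) _) distinct
                             (subst (H 1 A * H 1 A <_) (sym (length-allFin n)) H²<n)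
      ... | inj₁ (ys , up , _ , long) = <⇒≱ long (chain≤H (AllPairs.map proj₁ up)
              (inj₁ (AllPairs⇒Linked (column (λ α → toℕ (lookup α (suc zero))) proj₂ up))))
      ... | inj₂ (ys , down , long)   = <⇒≱ long (chain≤H (AllPairs.map proj₁ down)
              (inj₂ (AllPairs⇒Linked (column (λ α → toℕ (lookup α (suc zero))) proj₂ down))))

  lower-tail-1 : ∀ n c → 1 ≤ c → below n 1 c ≡ 0
  lower-tail-1 n c 1≤c = trans (∑-cong-∈ (L n 1) (λ {A} A∈ → cong 𝟙 (dec-false ((c * H 1 A) ^ 2 <? n ^ 1) (≤⇒≯ (begin
    n ^ 1                          ≡⟨ *-identityʳ n ⟩
    n                              ≤⟨ Permutation.n≤H² A (∈-L⁻ A∈) ⟩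
    H 1 A * H 1 A                  ≡⟨ cong (H 1 A *_) (*-identityʳ (H 1 A)) ⟨
    H 1 A ^ 2                      ≤⟨ ^-monoˡ-≤ 2 (m≤n*m (H 1 A) c {{>-nonZero 1≤c}}) ⟩
    (c * H 1 A) ^ 2                ∎)))))
    (trans (∑-const (L n 1) 0) (*-zeroʳ (card n 1)))
    where open ≤-Reasoning

  -- `c` is quantified before `D`, so a single constant a serves all ε. The constant proper is
  -- `suc c`, whose reciprocal is `recip c`.
  lower-tail : ∀ k → 1 ≤ k → ∃[ c ] ∀ D → ∃[ N ] ∀ n → N ≤ n → D * below n k (suc c) ≤ card n k
  lower-tail 1             _ = 0 , λ D → 0 , λ n _ →
    ≤-trans (≤-reflexive (trans (cong (D *_) (lower-tail-1 n 1 ≤-refl)) (*-zeroʳ D))) z≤n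
  lower-tail (suc (suc k)) _ = pred c , λ D → subst (λ z → ∃[ N ] ∀ n → N ≤ n → D * below n (2 + k) z ≤ card n (2 + k))
    (sym (suc-pred c {{m*n≢0 8 (2 ^ (4 + k)) {{_}} {{m^n≢0 2 (4 + k)}}}})) (lower-tail-≥2 (2 + k) D (s≤s (s≤s z≤n)))
    where
    c = 8 * 2 ^ (4 + k)

  -- Bounds for the mean

  1≤𝟙 : {P : Set} (P? : Dec P) → P → 1 ≤ 𝟙 (does P?)
  1≤𝟙 P? p = ≤-reflexive (cong 𝟙 (sym (dec-true P? p)))

  ≤-+-𝟙-* : {P : Set} (P? : Dec P) {x a b : ℕ} → (P → x ≤ a + b) → (¬ P → x ≤ a) → x ≤ a + 𝟙 (does P?) * b
  ≤-+-𝟙-* (yes p) {a = a} {b} x≤a+b _ = ≤-trans (x≤a+b p) (≤-reflexive (cong (a +_) (sym (+-identityʳ b))))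
  ≤-+-𝟙-* (no ¬p) {a = a}     _ x≤a   = ≤-trans (x≤a ¬p) (m≤m+n a 0)

  -- Let h be the least integer with ch ≥ n^(k/(k+1)). An array not counted by `below` has H ≥ h,
  -- and these are at least half of all arrays, so the mean is at least h/2; hence the constant 2c.
  total-lower : ∀ n k c → 1 ≤ c → 2 * below n k c ≤ card n k → card n k ^ suc k * n ^ k ≤ (2 * c * totalH n k) ^ suc k
  total-lower n k c 1≤c few = attained
    (least (λ h → n ^ k ≤? (c * h) ^ suc k) (n ^ k) (≤-trans (m≤n*m (n ^ k) c {{>-nonZero 1≤c}}) (x≤x^suc (c * n ^ k) k)))
    where
    open ≤-Reasoning
    K = card n k
    attained : (∃[ h ] n ^ k ≤ (c * h) ^ suc k × (∀ s → s < h → ¬ n ^ k ≤ (c * s) ^ suc k)) → K ^ suc k * n ^ k ≤ (2 * c * totalH n k) ^ suc k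
    attained (h , n^k≤ , minimal) = begin
      K ^ suc k * n ^ k              ≤⟨ *-monoʳ-≤ (K ^ suc k) n^k≤ ⟩
      K ^ suc k * (c * h) ^ suc k    ≡⟨ ^-distribʳ-* (suc k) K (c * h) ⟨
      (K * (c * h)) ^ suc k          ≡⟨ cong (_^ suc k) (e K c h) ⟩
      (c * (K * h)) ^ suc k          ≤⟨ ^-monoˡ-≤ (suc k) (*-monoʳ-≤ c average) ⟩
      (c * (2 * totalH n k)) ^ suc k ≡⟨ cong (_^ suc k) (e′ c (totalH n k)) ⟩
      (2 * c * totalH n k) ^ suc k   ∎
      where
      e : ∀ K c h → K * (c * h) ≡ c * (K * h)
      e = solve-∀
      e′ : ∀ c t → c * (2 * t) ≡ 2 * c * t
      e′ = solve-∀
      e″ : ∀ t b h → 2 * (t + b * h) ≡ 2 * t + 2 * b * h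
      e″ = solve-∀
      each : ∀ A → h ≤ H k A + 𝟙 (does ((c * H k A) ^ suc k <? n ^ k)) * h
      each A = ≤-+-𝟙-* ((c * H k A) ^ suc k <? n ^ k) (λ _ → m≤n+m h (H k A))
        (λ ¬lt → ≮⇒≥ (λ H<h → minimal (H k A) H<h (≮⇒≥ ¬lt)))
      average : K * h ≤ 2 * totalH n k
      average = +-cancelʳ-≤ (K * h) (K * h) (2 * totalH n k) (begin
        K * h + K * h
          ≡⟨ cong (_+_ (K * h)) (+-identityʳ (K * h)) ⟨
        2 * (K * h)
          ≡⟨ cong (2 *_) (∑-const (L n k) h) ⟨
        2 * ∑ (L n k) (λ _ → h)
          ≤⟨ *-monoʳ-≤ 2 (∑-mono (L n k) each) ⟩
        2 * ∑ (L n k) (λ A → H k A + 𝟙 (does ((c * H k A) ^ suc k <? n ^ k)) * h)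
          ≡⟨ cong (2 *_) (trans (∑-+ (L n k) (H k) _) (cong (totalH n k +_) (∑-*ʳ (L n k) h _))) ⟩
        2 * (totalH n k + below n k c * h)
          ≡⟨ e″ (totalH n k) (below n k c) h ⟩
        2 * totalH n k + 2 * below n k c * h
          ≤⟨ +-monoʳ-≤ (2 * totalH n k) (*-monoˡ-≤ h few) ⟩
        2 * totalH n k + K * h ∎)

  -- Since t ≥ 1, the additive term pK is absorbed: the mean T/K is at most (p + 1)t.
  mean-bound : ∀ m T K p b t X → 1 ≤ t → t ^ m ≤ b ^ m * X → T ≤ K * t + p * K → T ^ m ≤ (suc p * b * K) ^ m * X
  mean-bound m T K p b t X 1≤t t^m≤ T≤ = begin
    T ^ m
      ≤⟨ ^-monoˡ-≤ m (≤-trans T≤ (≤-trans (+-monoʳ-≤ (K * t) (*-monoʳ-≤ p (m≤m*n K t {{>-nonZero 1≤t}}))) (≤-reflexive (e K t p)))) ⟩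
    (K * suc p * t) ^ m
      ≡⟨ ^-distribʳ-* m (K * suc p) t ⟩
    (K * suc p) ^ m * t ^ m
      ≤⟨ *-monoʳ-≤ ((K * suc p) ^ m) t^m≤ ⟩
    (K * suc p) ^ m * (b ^ m * X)
      ≡⟨ *-assoc ((K * suc p) ^ m) (b ^ m) X ⟨
    (K * suc p) ^ m * b ^ m * X
      ≡⟨ cong (_* X) (^-distribʳ-* m (K * suc p) b) ⟨
    (K * suc p * b) ^ m * X
      ≡⟨ cong (λ z → z ^ m * X) (e′ K (suc p) b) ⟩
    (suc p * b * K) ^ m * X ∎
    where
    open ≤-Reasoning
    e : ∀ K t p → K * t + p * (K * t) ≡ K * (1 + p) * t
    e = solve-∀
    e′ : ∀ K x b → K * x * b ≡ x * b * K
    e′ = solve-∀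

  -- H is at most t off the tail event and at most n on it.
  total-split : ∀ n k t → totalH n k ≤ card n k * t + n * long n k t
  total-split n k t = begin
    totalH n k
      ≤⟨ ∑-mono (L n k) (λ A → ≤-+-𝟙-* (t ≤? H k A) (λ _ → ≤-trans (H≤n A) (m≤n+m n t)) (λ ¬le → <⇒≤ (≰⇒> ¬le))) ⟩
    ∑ (L n k) (λ A → t + 𝟙 (does (t ≤? H k A)) * n)
      ≡⟨ ∑-+ (L n k) (λ _ → t) (λ A → 𝟙 (does (t ≤? H k A)) * n) ⟩
    ∑ (L n k) (λ _ → t) + ∑ (L n k) (λ A → 𝟙 (does (t ≤? H k A)) * n)
      ≡⟨ cong₂ _+_ (∑-const (L n k) t) (trans (∑-*ʳ (L n k) n (λ A → 𝟙 (does (t ≤? H k A)))) (*-comm (long n k t) n)) ⟩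
    card n k * t + n * long n k t ∎
    where open ≤-Reasoning

  total-upper : ∀ n k → 1 ≤ k → totalH (suc n) k ^ suc k ≤ (suc (2 ^ suc k) * 16 * card (suc n) k) ^ suc k * suc n ^ k
  total-upper n k 1≤k =
    let t , 1≤t , t^m≤ , few = upper-tail k 1≤k n in
    mean-bound (suc k) (totalH (suc n) k) (card (suc n) k) (2 ^ suc k) 16 t (suc n ^ k) 1≤t t^m≤
      (≤-trans (total-split (suc n) k t) (+-monoʳ-≤ (card (suc n) k * t) few))

  -- Passage to ℚ

  -- `ℕ→ℚ` is defined through normalisation; the explicit normal form lets arithmetic and order on
  -- it reduce to numerators.
  ℕ→ℚ-mkℚ : ∀ n → ℕ→ℚ n ≡ mkℚ (ℤ.+ n) 0 (Coprime.sym (Coprime.1-coprimeTo n))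
  ℕ→ℚ-mkℚ n = ℚP.normalize-coprime (Coprime.sym (Coprime.1-coprimeTo n))

  ℕ→ℚ-* : ∀ a b → ℕ→ℚ (a * b) ≡ ℕ→ℚ a ℚ.* ℕ→ℚ b
  ℕ→ℚ-* a b = sym (trans (cong₂ ℚ._*_ (ℕ→ℚ-mkℚ a) (ℕ→ℚ-mkℚ b)) (cong (λ z → z ℚ./ 1) (sym (ℤP.pos-* a b))))

  ℕ→ℚ-+ : ∀ a b → ℕ→ℚ (a + b) ≡ ℕ→ℚ a ℚ.+ ℕ→ℚ b
  ℕ→ℚ-+ a b = sym (trans (cong₂ ℚ._+_ (ℕ→ℚ-mkℚ a) (ℕ→ℚ-mkℚ b))
    (cong (λ z → z ℚ./ 1) (cong₂ ℤ._+_ (ℤP.*-identityʳ (ℤ.+ a)) (ℤP.*-identityʳ (ℤ.+ b)))))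

  ℕ→ℚ-mono-≤ : ∀ {a b} → a ≤ b → ℕ→ℚ a ℚ.≤ ℕ→ℚ b
  ℕ→ℚ-mono-≤ {a} {b} a≤b = subst₂ ℚ._≤_ (sym (ℕ→ℚ-mkℚ a)) (sym (ℕ→ℚ-mkℚ b))
    (ℚ.*≤* (ℤP.*-monoʳ-≤-nonNeg (ℤ.+ 1) (ℤ.+≤+ a≤b)))

  ℕ→ℚ-^ : ∀ a e → ℕ→ℚ (a ^ e) ≡ ℕ→ℚ a ^ℚ e
  ℕ→ℚ-^ a zero    = refl
  ℕ→ℚ-^ a (suc e) = trans (ℕ→ℚ-* a (a ^ e)) (cong (ℕ→ℚ a ℚ.*_) (ℕ→ℚ-^ a e))

  ℕ→ℚ-nonNeg : ∀ n → ℚ.NonNegative (ℕ→ℚ n)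
  ℕ→ℚ-nonNeg n = ℚP.normalize-nonNeg n 1

  *-interchangeℚ : ∀ p q r s → (p ℚ.* q) ℚ.* (r ℚ.* s) ≡ (p ℚ.* r) ℚ.* (q ℚ.* s)
  *-interchangeℚ = interchange
    where
    open CommutativeMonoid ℚP.*-1-commutativeMonoid using (commutativeSemigroup)
    open import Algebra.Properties.CommutativeSemigroup commutativeSemigroup using (interchange)

  ^ℚ-distrib-* : ∀ p q e → (p ℚ.* q) ^ℚ e ≡ (p ^ℚ e) ℚ.* (q ^ℚ e)
  ^ℚ-distrib-* p q zero    = refl
  ^ℚ-distrib-* p q (suc e) = trans (cong ((p ℚ.* q) ℚ.*_) (^ℚ-distrib-* p q e)) (*-interchangeℚ p q (p ^ℚ e) (q ^ℚ e))

  ^ℚ-nonNeg : ∀ p e → ℚ.NonNegative p → ℚ.NonNegative (p ^ℚ e)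
  ^ℚ-nonNeg p zero    p≥0 = _
  ^ℚ-nonNeg p (suc e) p≥0 = ℚP.nonNeg*nonNeg⇒nonNeg p {{p≥0}} (p ^ℚ e) {{^ℚ-nonNeg p e p≥0}}

  ℕ→ℚ-pos : ∀ n → ℚ.Positive (ℕ→ℚ (suc n))
  ℕ→ℚ-pos n = ℚP.normalize-pos (suc n) 1

  recip : ℕ → ℚ
  recip c = (ℚ.1/ ℕ→ℚ (suc c)) {{ℚP.pos⇒nonZero (ℕ→ℚ (suc c)) {{ℕ→ℚ-pos c}}}}

  recip-inverse : ∀ c → recip c ℚ.* ℕ→ℚ (suc c) ≡ 1ℚ
  recip-inverse c = ℚP.*-inverseˡ (ℕ→ℚ (suc c)) {{ℚP.pos⇒nonZero (ℕ→ℚ (suc c)) {{ℕ→ℚ-pos c}}}}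

  recip-pos : ∀ c → ℚ.Positive (recip c)
  recip-pos c = ℚP.1/pos⇒pos (ℕ→ℚ (suc c)) {{ℕ→ℚ-pos c}}

  recip-nonNeg : ∀ c → ℚ.NonNegative (recip c)
  recip-nonNeg c = ℚP.pos⇒nonNeg (recip c) {{recip-pos c}}

  recip≤1 : ∀ c → recip c ℚ.≤ 1ℚ
  recip≤1 c = begin
    recip c                        ≡⟨ ℚP.*-identityʳ (recip c) ⟨
    recip c ℚ.* ℕ→ℚ 1              ≤⟨ ℚP.*-monoˡ-≤-nonNeg (recip c) {{recip-nonNeg c}} (ℕ→ℚ-mono-≤ {1} {suc c} (s≤s z≤n)) ⟩
    recip c ℚ.* ℕ→ℚ (suc c)        ≡⟨ recip-inverse c ⟩
    1ℚ                             ∎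
    where open ℚP.≤-Reasoning

  -- The factor `x` serves both halves of the theorem: x = 1 for a single array, and x = `card` for
  -- the sum over all arrays.
  scaled-≤ : ∀ n k c x h → x ^ suc k * n ^ k ≤ (suc c * h) ^ suc k → (recip c ℚ.* ℕ→ℚ x) ·n^[ n /1+ k ]≤ ℕ→ℚ h
  scaled-≤ n k c x h le = begin
    ((recip c ℚ.* ℕ→ℚ x) ^ℚ m) ℚ.* (ℕ→ℚ n ^ℚ k)
      ≡⟨ cong (ℚ._* (ℕ→ℚ n ^ℚ k)) (^ℚ-distrib-* (recip c) (ℕ→ℚ x) m) ⟩
    (r ℚ.* (ℕ→ℚ x ^ℚ m)) ℚ.* (ℕ→ℚ n ^ℚ k)
      ≡⟨ ℚP.*-assoc r (ℕ→ℚ x ^ℚ m) (ℕ→ℚ n ^ℚ k) ⟩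
    r ℚ.* ((ℕ→ℚ x ^ℚ m) ℚ.* (ℕ→ℚ n ^ℚ k))
      ≡⟨ cong (r ℚ.*_) (trans (cong₂ ℚ._*_ (sym (ℕ→ℚ-^ x m)) (sym (ℕ→ℚ-^ n k))) (sym (ℕ→ℚ-* (x ^ m) (n ^ k)))) ⟩
    r ℚ.* ℕ→ℚ (x ^ m * n ^ k)
      ≤⟨ ℚP.*-monoˡ-≤-nonNeg r {{^ℚ-nonNeg (recip c) m (recip-nonNeg c)}} (ℕ→ℚ-mono-≤ le) ⟩
    r ℚ.* ℕ→ℚ ((suc c * h) ^ m)
      ≡⟨ cong (r ℚ.*_) (trans (ℕ→ℚ-^ (suc c * h) m) (cong (_^ℚ m) (ℕ→ℚ-* (suc c) h))) ⟩
    r ℚ.* ((ℕ→ℚ (suc c) ℚ.* ℕ→ℚ h) ^ℚ m)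
      ≡⟨ ^ℚ-distrib-* (recip c) (ℕ→ℚ (suc c) ℚ.* ℕ→ℚ h) m ⟨
    (recip c ℚ.* (ℕ→ℚ (suc c) ℚ.* ℕ→ℚ h)) ^ℚ m
      ≡⟨ cong (_^ℚ m) (trans (sym (ℚP.*-assoc (recip c) (ℕ→ℚ (suc c)) (ℕ→ℚ h)))
           (trans (cong (ℚ._* ℕ→ℚ h) (recip-inverse c)) (ℚP.*-identityˡ (ℕ→ℚ h)))) ⟩
    ℕ→ℚ h ^ℚ m ∎
    where
    open ℚP.≤-Reasoning
    m = suc k
    r = recip c ^ℚ m

  ≤-scaled : ∀ n k C h → h ^ suc k ≤ C ^ suc k * n ^ k → ℕ→ℚ h ≤ ℕ→ℚ C ·n^[ n /1+ k ]
  ≤-scaled n k C h le = subst₂ ℚ._≤_ (ℕ→ℚ-^ h (suc k))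
    (trans (ℕ→ℚ-* (C ^ suc k) (n ^ k)) (cong₂ ℚ._*_ (ℕ→ℚ-^ C (suc k)) (ℕ→ℚ-^ n k))) (ℕ→ℚ-mono-≤ le)

  -- Combining the two tails

  𝟙-cover : {G P Q : Set} (G? : Dec G) (P? : Dec P) (Q? : Dec Q) → (¬ P → ¬ Q → G) → 1 ≤ 𝟙 (does G?) + (𝟙 (does P?) + 𝟙 (does Q?))
  𝟙-cover G? (yes _) Q?      _ = m≤n⇒m≤o+n (𝟙 (does G?)) (s≤s z≤n)
  𝟙-cover G? (no _)  (yes _) _ = m≤n+m 1 (𝟙 (does G?))
  𝟙-cover G? (no ¬p) (no ¬q) g = ≤-trans (1≤𝟙 G? (g ¬p ¬q)) (m≤m+n _ 0)

  -- An array outside both tail events is good: it has (c + 1)H ≥ n^(k/(k+1)) and H < t ≤ 16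
  -- n^(k/(k+1)).
  good-count : ∀ n k c t → t ^ suc k ≤ 16 ^ suc k * n ^ k →
    card n k ≤ goodCount n k (recip c) (ℕ→ℚ 16) + (below n k (suc c) + long n k t)
  good-count n k c t t^m≤ = begin
    card n k
      ≡⟨ ∑-1 (L n k) ⟨
    ∑ (L n k) (λ _ → 1)
      ≤⟨ ∑-mono (L n k) each ⟩
    ∑ (L n k) (λ A → 𝟙 (does (good? k (recip c) (ℕ→ℚ 16) A)) + (𝟙 (does ((suc c * H k A) ^ suc k <? n ^ k)) + 𝟙 (does (t ≤? H k A))))
      ≡⟨ trans (∑-+ (L n k) _ _) (cong₂ _+_ (sym (length-filter (good? k (recip c) (ℕ→ℚ 16)) (L n k))) (∑-+ (L n k) _ _)) ⟩
    goodCount n k (recip c) (ℕ→ℚ 16) + (below n k (suc c) + long n k t) ∎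
    where
    open ≤-Reasoning
    each : ∀ A → 1 ≤ 𝟙 (does (good? k (recip c) (ℕ→ℚ 16) A)) + (𝟙 (does ((suc c * H k A) ^ suc k <? n ^ k)) + 𝟙 (does (t ≤? H k A)))
    each A = 𝟙-cover (good? k (recip c) (ℕ→ℚ 16) A) ((suc c * H k A) ^ suc k <? n ^ k) (t ≤? H k A)
      (λ ¬lt ¬le → subst (λ a → a ·n^[ n /1+ k ]≤ ℕ→ℚ (H k A)) (ℚP.*-identityʳ (recip c))
                 (scaled-≤ n k c 1 (H k A) (≤-trans (≤-reflexive (trans (cong (_* n ^ k) (^-zeroˡ (suc k))) (+-identityʳ (n ^ k)))) (≮⇒≥ ¬lt)))
             , ≤-scaled n k 16 (H k A) (≤-trans (^-monoˡ-≤ (suc k) (<⇒≤ (≰⇒> ¬le))) t^m≤))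

  -- The denominator of ε serves as d, because dε is then the numerator, a positive integer.
  archimedean : ∀ ε → 0ℚ ℚ.< ε → ∃[ d ] 1ℚ ℚ.≤ ℕ→ℚ d ℚ.* ε
  archimedean ε@(mkℚ (ℤ.+ zero)    d-1 _) ε>0 = contradiction (ℚP.<-≤-trans ε>0 (ℚ.*≤* (ℤ.+≤+ z≤n))) (ℚP.<-irrefl refl)
  archimedean ε@(mkℚ ℤ.-[1+ _ ]  d-1 _) ε>0 = contradiction (ℚP.<-≤-trans ε>0 (ℚ.*≤* ℤ.-≤+)) (ℚP.<-irrefl refl)
  archimedean ε@(mkℚ (ℤ.+ suc p)   d-1 _) ε>0 = suc d-1 , ℚP.toℚᵘ-cancel-≤
    (ℚᵘP.≤-trans (ℚᵘ.*≤* (ℤ.+≤+ le)) (ℚᵘP.≤-reflexive (ℚᵘP.≃-sym (ℚᵘP.≃-trans (ℚP.toℚᵘ-homo-* (ℕ→ℚ (suc d-1)) ε)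
      (ℚᵘP.*-cong (ℚᵘP.≃-reflexive (cong ℚ.toℚᵘ (ℕ→ℚ-mkℚ (suc d-1)))) ℚᵘP.≃-refl)))))
    where
    le : 1 * (1 * suc d-1) ≤ suc d-1 * suc p * 1
    le = ≤-trans (≤-reflexive (trans (+-identityʳ _) (+-identityʳ _))) (≤-trans (m≤m*n (suc d-1) (suc p)) (≤-reflexive (sym (*-identityʳ _))))

  discount : ∀ ε d K G B → 0ℚ ℚ.< ε → 1ℚ ℚ.≤ ℕ→ℚ d ℚ.* ε → d * B ≤ K → K ≤ G + B → (1ℚ ℚ.- ε) ℚ.* ℕ→ℚ K ℚ.≤ ℕ→ℚ G
  discount ε d K G B ε>0 1≤dε dB≤K K≤G+B = begin
    (1ℚ ℚ.- ε) ℚ.* ℕ→ℚ K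
      ≡⟨ ℚP.*-distribʳ-+ (ℕ→ℚ K) 1ℚ (ℚ.- ε) ⟩
    1ℚ ℚ.* ℕ→ℚ K ℚ.+ (ℚ.- ε) ℚ.* ℕ→ℚ K
      ≡⟨ cong₂ ℚ._+_ (ℚP.*-identityˡ (ℕ→ℚ K)) (sym (ℚP.neg-distribˡ-* ε (ℕ→ℚ K))) ⟩
    ℕ→ℚ K ℚ.- ε ℚ.* ℕ→ℚ K
      ≤⟨ ℚP.+-mono-≤ (ℕ→ℚ-mono-≤ K≤G+B) (ℚP.neg-antimono-≤ B≤εK) ⟩
    ℕ→ℚ (G + B) ℚ.- ℕ→ℚ B
      ≡⟨ trans (cong (ℚ._- ℕ→ℚ B) (ℕ→ℚ-+ G B)) (trans (ℚP.+-assoc (ℕ→ℚ G) (ℕ→ℚ B) (ℚ.- ℕ→ℚ B))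
           (trans (cong (ℕ→ℚ G ℚ.+_) (ℚP.+-inverseʳ (ℕ→ℚ B))) (ℚP.+-identityʳ (ℕ→ℚ G)))) ⟩
    ℕ→ℚ G ∎
    where
    open ℚP.≤-Reasoning
    B≤εK : ℕ→ℚ B ℚ.≤ ε ℚ.* ℕ→ℚ K
    B≤εK = begin
      ℕ→ℚ B                              ≡⟨ ℚP.*-identityˡ (ℕ→ℚ B) ⟨
      1ℚ ℚ.* ℕ→ℚ B                       ≤⟨ ℚP.*-monoʳ-≤-nonNeg (ℕ→ℚ B) {{ℕ→ℚ-nonNeg B}} 1≤dε ⟩
      (ℕ→ℚ d ℚ.* ε) ℚ.* ℕ→ℚ B            ≡⟨ trans (cong (ℚ._* ℕ→ℚ B) (ℚP.*-comm (ℕ→ℚ d) ε)) (ℚP.*-assoc ε (ℕ→ℚ d) (ℕ→ℚ B)) ⟩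
      ε ℚ.* (ℕ→ℚ d ℚ.* ℕ→ℚ B)            ≡⟨ cong (ε ℚ.*_) (ℕ→ℚ-* d B) ⟨
      ε ℚ.* ℕ→ℚ (d * B)                  ≤⟨ ℚP.*-monoˡ-≤-nonNeg ε {{ℚP.pos⇒nonNeg ε {{ℚ.positive ε>0}}}} (ℕ→ℚ-mono-≤ dB≤K) ⟩
      ε ℚ.* ℕ→ℚ K                        ∎

  -- Each tail is allowed K/(2d). The first meets this by assumption; the second has at most (c +
  -- 1)K/n members, which suffices once n ≥ 2d(c + 1).
  rare-events : ∀ d c n B W K → 2 * d * B ≤ K → n * W ≤ suc c * K → 2 * d * suc c ≤ n → d * (B + W) ≤ K
  rare-events d c n B W K rare few large = *-cancelˡ-≤ 2 (begin
    2 * (d * (B + W))          ≡⟨ e d B W ⟩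
    2 * d * B + 2 * d * W      ≤⟨ +-mono-≤ rare 2dW≤K ⟩
    K + K                      ≡⟨ cong (K +_) (+-identityʳ K) ⟨
    2 * K                      ∎)
    where
    open ≤-Reasoning
    e : ∀ d B W → 2 * (d * (B + W)) ≡ 2 * d * B + 2 * d * W
    e = solve-∀
    e′ : ∀ c d w → (1 + c) * (2 * d * w) ≡ 2 * d * (1 + c) * w
    e′ = solve-∀
    2dW≤K : 2 * d * W ≤ K
    2dW≤K = *-cancelˡ-≤ (suc c) (begin
      suc c * (2 * d * W)      ≡⟨ e′ c d W ⟩
      2 * d * suc c * W        ≤⟨ *-monoˡ-≤ W large ⟩
      n * W                    ≤⟨ few ⟩
      suc c * K                ∎)

  mostly-good : ∀ k c d → 1 ≤ k → (∃[ N ] ∀ n → N ≤ n → 2 * d * below n k (suc c) ≤ card n k) →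
    ∃[ N ] ∀ n → N ≤ n → Σ ℕ λ B → d * B ≤ card n k × card n k ≤ goodCount n k (recip c) (ℕ→ℚ 16) + B
  mostly-good k c d 1≤k (N , rare) = suc (N + 2 * d * suc p) , large
    where
    p = pred (2 ^ suc k)
    2^m≡ : 2 ^ suc k ≡ suc p
    2^m≡ = sym (suc-pred (2 ^ suc k) {{m^n≢0 2 (suc k)}})
    large : ∀ n → suc (N + 2 * d * suc p) ≤ n → Σ ℕ λ B → d * B ≤ card n k × card n k ≤ goodCount n k (recip c) (ℕ→ℚ 16) + B
    large (suc n) N<n =
      let t , 1≤t , t^m≤ , few = upper-tail k 1≤k n in
      below (suc n) k (suc c) + long (suc n) k t ,
      rare-events d p (suc n) (below (suc n) k (suc c)) (long (suc n) k t) (card (suc n) k)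
        (rare (suc n) (≤-trans (m≤m+n N _) (<⇒≤ N<n)))
        (subst (λ z → suc n * long (suc n) k t ≤ z * card (suc n) k) 2^m≡ few)
        (≤-trans (m≤n+m _ N) (<⇒≤ N<n)) ,
      good-count (suc n) k c t t^m≤

  expectation : ∀ k → 1 ≤ k → Σ ℚ λ c → Σ ℚ λ C → 0ℚ ℚ.< c × 0ℚ ℚ.< C × ∃[ N ] ((n : ℕ) → N ≤ n →
      ((c ℚ.* ℕ→ℚ (card n k)) ·n^[ n /1+ k ]≤ ℕ→ℚ (totalH n k))
      × (ℕ→ℚ (totalH n k) ≤ (C ℚ.* ℕ→ℚ (card n k)) ·n^[ n /1+ k ]))
  expectation k 1≤k =
    let c , tail = lower-tail k 1≤k
        -- For the mean it is enough that at most half of the arrays lie in the lower tail.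
        N , rare = tail 2
        r = c + 1 * suc c in  -- suc r is 2 * suc c by computation
    -- In the upper constant 16 comes from `upper-tail`, and p = 2^(k+1) bounds the contribution to
    -- the mean of the arrays with H ≥ t. The threshold `suc N` excludes n = 0.
    recip r , ℕ→ℚ (suc p * 16) , ℚP.positive⁻¹ (recip r) {{recip-pos r}} ,
    ℚP.positive⁻¹ (ℕ→ℚ (suc p * 16)) {{ℕ→ℚ-pos (15 + p * 16)}} , suc N ,
    λ { (suc n) N<n →
        scaled-≤ (suc n) k r (card (suc n) k) (totalH (suc n) k) (total-lower (suc n) k (suc c) (s≤s z≤n) (rare (suc n) (<⇒≤ N<n))) ,
        subst (λ q → ℕ→ℚ (totalH (suc n) k) ≤ q ·n^[ suc n /1+ k ]) (ℕ→ℚ-* (suc p * 16) (card (suc n) k))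
          (≤-scaled (suc n) k (suc p * 16 * card (suc n) k) (totalH (suc n) k) (total-upper n k 1≤k)) }
    where
    p = 2 ^ suc k

  concentration : ∀ k → 1 ≤ k → Σ ℚ λ a → Σ ℚ λ b → 0ℚ ℚ.< a × a ℚ.< b × ((ε : ℚ) → 0ℚ ℚ.< ε → ∃[ N ] ((n : ℕ) → N ≤ n →
      (1ℚ ℚ.- ε) ℚ.* ℕ→ℚ (card n k) ℚ.≤ ℕ→ℚ (goodCount n k a b)))
  concentration k 1≤k =
    let c , tail = lower-tail k 1≤k in
    recip c , ℕ→ℚ 16 , ℚP.positive⁻¹ (recip c) {{recip-pos c}} , ℚP.≤-<-trans (recip≤1 c) (toWitness {a? = 1ℚ ℚ.<? ℕ→ℚ 16} _) ,
    λ ε ε>0 →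
      -- Since 1/d ≤ ε, it suffices that the two tails together have probability at most 1/d; each
      -- gets half of that, whence `2 * d` in the lower tail.
      let d , 1≤dε = archimedean ε ε>0
          N , large = mostly-good k c d 1≤k (tail (2 * d)) in
      N , λ n N≤n →
        let B , dB≤K , K≤G+B = large n N≤n in
        discount ε d (card n k) (goodCount n k (recip c) (ℕ→ℚ 16)) B ε>0 1≤dε dB≤K K≤G+B

open import Data.Nat using (ℕ)
import Data.Nat
open import Data.Rational using (ℚ; 0ℚ; 1ℚ; _*_; _-_; _<_)
import Data.Rational
open import Data.Product using (Σ; ∃; ∃-syntax; _×_; _,_)

theorem5 : (k : ℕ) → 1 Data.Nat.≤ k →
    (Σ ℚ λ c → Σ ℚ λ C → 0ℚ < c × 0ℚ < C × ∃[ N ] ((n : ℕ) → N Data.Nat.≤ n →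
    ((c * ℕ→ℚ (card n k)) ·n^[ n /1+ k ]≤ ℕ→ℚ (totalH n k))
    × (ℕ→ℚ (totalH n k) ≤ (C * ℕ→ℚ (card n k)) ·n^[ n /1+ k ])))
    × (Σ ℚ λ a → Σ ℚ λ b → 0ℚ < a × a < b × ((ε : ℚ) → 0ℚ < ε → ∃[ N ] ((n : ℕ) → N Data.Nat.≤ n →
    (1ℚ - ε) * ℕ→ℚ (card n k) Data.Rational.≤ ℕ→ℚ (goodCount n k a b))))
theorem5 k 1≤k = Counting.expectation k 1≤k , Counting.concentration k 1≤k
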